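{- Let $G$ be a plane bipartite graph with a perfect matching whose resonance graph $R(G)$ is connected, and let $d$ be the number of finite faces of $G$ having no forbidden edges on their peripheries. Then $\mathrm{idim}(R(G))\ge d$, and equality holds if and only if $G$ is a plane weakly elementary bipartite graph each of whose elementary components with more than two vertices has forcing infinite face.
   Context: All graphs are finite; $\mathcal{M}(G)$ is the set of perfect matchings. An edge is forbidden if it lies in no perfect matching. A bipartite graph is elementary if connected with no forbidden edges. A plane bipartite graph with a perfect matching is weakly elementary if removing all its forbidden edges creates no new finite faces; the components of the resulting graph are its elementary components (each is a plane elementary bipartite graph). The resonance graph $R(G)$ has vertex set $\mathcal{M}(G)$, with $M_1M_2$ an edge iff $M_1\oplus M_2$ is the facial cycle of a finite face of $G$. A connected $R(G)$ embeds isometrically in a hypercube; $\mathrm{idim}(R(G))$ is the least $m$ such that $R(G)$ has a distance-preserving embedding into the hypercube $Q_m$. The infinite face of a plane graph $E$ is forcing if the periphery of $E$ is an even cycle and deleting all its vertices leaves either the empty graph or a graph with exactly one perfect matching. -}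

module Defs where

-- Plane graphs are encoded combinatorially:
-- a plane graph G is a spanning subgraph (edge set S) of a connected,
-- loopless plane multigraph H given by a rotation system of genus 0
-- (Euler's formula), together with a designated dart lying on the
-- infinite face of H.  Faces of G are the regions obtained by gluing
-- faces of H across the edges of H that are not edges of G.

open import Data.Nat using (ℕ; zero; suc; _+_; _≤_; _<_)
open import Data.Nat.Divisibility using (_∣_)
open import Data.Fin using (Fin)
open import Data.Bool using (Bool; true; false; not; _xor_)
open import Data.Product using (Σ; ∃; ∃-syntax; _×_; _,_; proj₁; proj₂)
open import Data.Sum using (_⊎_)
open import Data.Empty using (⊥)
open import Data.Unit using (⊤)
open import Data.List using (List; length; map; allFin)
open import Data.Nat.ListAction using (sum)
open import Data.List.Relation.Unary.All using (All)
open import Data.List.Relation.Unary.Any using (Any)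
open import Data.List.Relation.Unary.AllPairs using (AllPairs)
open import Data.List.Membership.Propositional using (_∈_)
open import Relation.Nullary using (¬_)
open import Relation.Binary.PropositionalEquality using (_≡_; _≢_)
open import Function.Bundles using (_⇔_)

-- raw combinatorial map: edges Fin nE, darts (e , b) for b : Bool;
-- the dart (e , b) starts at the vertex  end e b ;  σ is the rotation
-- (next dart in the cyclic order around its starting vertex).
record Map : Set where
  field
    nV nE : ℕ
    end   : Fin nE → Bool → Fin nV
    σ     : Fin nE × Bool → Fin nE × Bool

iter : {A : Set} → (A → A) → ℕ → A → A
iter f zero    x = x
iter f (suc n) x = f (iter f n x)

module _ (H : Map) where
  open Map H

  Dart : Set
  Dart = Fin nE × Bool

  tail : Dart → Fin nV
  tail (e , b) = end e b

  α : Dart → Dart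
  α (e , b) = (e , not b)

  φ : Dart → Dart
  φ d = σ (α d)

  Inc : Fin nE → Fin nV → Set
  Inc e v = end e false ≡ v ⊎ end e true ≡ v

  data Reach (E : Fin nE → Set) : Fin nV → Fin nV → Set where
    r-refl : ∀ {v} → Reach E v v
    r-step : ∀ {v} e b → E e → Reach E (end e (not b)) v → Reach E (end e b) v

  SameFaceH : Dart → Dart → Set
  SameFaceH a c = ∃[ n ] iter φ n a ≡ c

  FaceCount : ℕ → Set
  FaceCount k = Σ (List Dart) λ reps →
    length reps ≡ k × AllPairs (λ a c → ¬ SameFaceH a c) reps ×
    (∀ d → Any (SameFaceH d) reps)

  IsPlaneMap : Set
  IsPlaneMap =
    (∀ e → end e false ≢ end e true) ×
    (∀ d → tail (σ d) ≡ tail d) ×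
    (∀ d d' → σ d ≡ σ d' → d ≡ d') ×
    (∀ d d' → tail d ≡ tail d' → ∃[ n ] iter σ n d ≡ d') ×
    (∀ u v → Reach (λ _ → ⊤) u v) ×
    (∃[ k ] (FaceCount k × nV + k ≡ nE + 2))

  -- Regions of the plane graph with edge set E (a spanning subgraph of H):
  -- faces of H glued across edges of H not in E.
  data FaceRel (E : Fin nE → Set) : Dart → Dart → Set where
    f-refl  : ∀ {d} → FaceRel E d d
    f-φ     : ∀ {d} → FaceRel E d (φ d)
    f-α     : ∀ {d} → ¬ E (proj₁ d) → FaceRel E d (α d)
    f-sym   : ∀ {d d'} → FaceRel E d d' → FaceRel E d' d
    f-trans : ∀ {d d' d''} → FaceRel E d d' → FaceRel E d' d'' → FaceRel E d d''

  Periph : (Fin nE → Set) → Dart → Fin nE → Set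
  Periph E f e = E e × ∃[ b ] FaceRel E f (e , b)

  IsCycle : (Fin nE → Set) → Set
  IsCycle P =
    (∃[ e ] P e) ×
    (∀ v → (∀ e → P e → ¬ Inc e v) ⊎
           (∃[ e₁ ] ∃[ e₂ ] (e₁ ≢ e₂ × P e₁ × P e₂ × Inc e₁ v × Inc e₂ v ×
              (∀ e → P e → Inc e v → e ≡ e₁ ⊎ e ≡ e₂)))) ×
    (∀ e e' → P e → P e' → Reach P (end e false) (end e' false))

  EdgeCount : (Fin nE → Set) → ℕ → Set
  EdgeCount P k = Σ (List (Fin nE)) λ l →
    length l ≡ k × AllPairs _≢_ l × All P l × (∀ e → P e → e ∈ l)

  EdgeSet : Set
  EdgeSet = Fin nE → Bool

  IsPM : (Fin nV → Set) → (Fin nE → Set) → EdgeSet → Set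
  IsPM W E M =
    (∀ e → M e ≡ true → E e) ×
    (∀ v → W v → ∃[ e ] (M e ≡ true × Inc e v ×
                         (∀ e' → M e' ≡ true → Inc e' v → e' ≡ e)))

  UniquePM : (Fin nV → Set) → (Fin nE → Set) → Set
  UniquePM W E = ∃[ M ] (IsPM W E M ×
    (∀ M' → IsPM W E M' → ∀ e → M' e ≡ M e))

  module _ (S : EdgeSet) where
    GE : Fin nE → Set
    GE e = S e ≡ true

    IsPMG : EdgeSet → Set
    IsPMG = IsPM (λ _ → ⊤) GE

    Bipartite : Set
    Bipartite = Σ (Fin nV → Bool) λ c →
      ∀ e → GE e → c (end e false) ≢ c (end e true)

    Allowed : Fin nE → Set
    Allowed e = ∃[ M ] (IsPMG M × M e ≡ true)

    Forbidden : Fin nE → Set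
    Forbidden e = GE e × ¬ Allowed e

    module _ (outer : Dart) where
      Finite : Dart → Set
      Finite f = ¬ FaceRel GE f outer

      Adj : EdgeSet → EdgeSet → Set
      Adj M₁ M₂ = ∃[ f ] (Finite f × IsCycle (Periph GE f) ×
        (∀ e → (M₁ e xor M₂ e ≡ true → Periph GE f e) ×
               (Periph GE f e → M₁ e xor M₂ e ≡ true)))

      data Walk : EdgeSet → EdgeSet → ℕ → Set where
        w-nil  : ∀ {M M'} → (∀ e → M e ≡ M' e) → Walk M M' zero
        w-cons : ∀ {M M₁ M' k} → IsPMG M₁ → Adj M M₁ → Walk M₁ M' k →
                 Walk M M' (suc k)

      RConnected : Set
      RConnected = ∀ M M' → IsPMG M → IsPMG M' → ∃[ k ] Walk M M' k

      hamming : (m : ℕ) → (Fin m → Bool) → (Fin m → Bool) → ℕ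
      hamming m u v = sum (map (λ i → if' (u i xor v i)) (allFin m))
        where
          if' : Bool → ℕ
          if' true  = 1
          if' false = 0

      IsoEmb : ℕ → Set
      IsoEmb m = Σ ((M : EdgeSet) → IsPMG M → Fin m → Bool) λ f →
        ∀ M M' (p : IsPMG M) (p' : IsPMG M') →
          Walk M M' (hamming m (f M p) (f M' p')) ×
          (∀ j → Walk M M' j → hamming m (f M p) (f M' p') ≤ j)

      IsIdim : ℕ → Set
      IsIdim m = IsoEmb m × (∀ k → k < m → ¬ IsoEmb k)

      GoodFace : Dart → Set
      GoodFace f = Finite f × (∀ e → Periph GE f e → ¬ Forbidden e)

      NumGoodFaces : ℕ → Set
      NumGoodFaces k = Σ (List Dart) λ reps →
        length reps ≡ k × AllPairs (λ a c → ¬ FaceRel GE a c) reps ×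
        All GoodFace reps × (∀ f → GoodFace f → Any (FaceRel GE f) reps)

      -- removing forbidden edges creates no new finite faces: every finite
      -- face of G - F is a face of G
      WeaklyElementary : Set
      WeaklyElementary = ∀ d d' → FaceRel Allowed d d' →
        ¬ FaceRel Allowed d outer → FaceRel GE d d'

      InComp : Fin nV → Fin nV → Set
      InComp v u = Reach Allowed v u

      CompE : Fin nV → Fin nE → Set
      CompE v e = Allowed e × InComp v (end e false)

      MoreThanTwoVertices : Fin nV → Set
      MoreThanTwoVertices v = ∃[ a ] ∃[ b ] ∃[ c ]
        (a ≢ b × a ≢ c × b ≢ c × InComp v a × InComp v b × InComp v c)

      ForcingInfFace : Fin nV → Set
      ForcingInfFace v =
        IsCycle P × (∃[ k ] (EdgeCount P k × 2 ∣ k)) ×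
        ((∀ u → ¬ W u) ⊎ UniquePM W E')
        where
          P : Fin nE → Set
          P = Periph (CompE v) outer
          W : Fin nV → Set
          W u = InComp v u × ¬ (∃[ e ] (P e × Inc e u))
          E' : Fin nE → Set
          E' e = CompE v e × W (end e false) × W (end e true)

{-# OPTIONS --safe #-}
-- By Euler's formula every circulation on a plane map is a coboundary of the dual graph. Hence any
-- two perfect matchings M, N differ by a height function diff M N on the faces, which vanishes on the
-- infinite face and jumps by one across the edges of M ⊕ N. Pointwise joins and meets of heights are
-- again heights of matchings, so there are a least matching bot and a greatest one top. Edges of R(G)
-- change the height of one face by one, and if R(G) is connected, any two matchings are joined by a
-- walk moving every face monotonically; thus the distance is the l¹-distance of the heights, and
-- idim R(G) is the sum over the faces of the height h of top over bot. A local surgery on bot shows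
-- that h vanishes only on the infinite face of G minus its forbidden edges, so h ≥ 1 exactly on the
-- good faces, and idim R(G) = d means h ≤ 1. If h ≤ 1, then top ⊕ bot is in each component the
-- periphery, a single cycle, off which the matching is forced; conversely a forcing infinite face
-- confines top ⊕ bot to that cycle and h ≤ 1 follows.
module Submission where

open import Defs
open import Data.Nat as ℕ using (ℕ; zero; suc; z≤n; s≤s; _≤_; _<_)
open import Data.Nat.Properties as ℕₚ using ()
open import Data.Integer as ℤ using (ℤ; +_; -_; 0ℤ; 1ℤ; -1ℤ; +≤+) renaming (_+_ to _⊕_; _*_ to _⊛_; _≤_ to _≼_)
open import Data.Integer.Properties as ℤₚ using ()
open import Data.Integer.Tactic.RingSolver using (solve-∀)
open import Data.Fin as F using (Fin; zero; suc)
open import Data.Fin.Properties as Fₚ using (pigeonhole; all?; any?)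
open import Data.Bool using (Bool; true; false; not; _xor_; _∧_; if_then_else_)
open import Data.Bool.Properties as Bₚ using (not-involutive)
open import Data.Product using (Σ; ∃; ∃₂; ∃-syntax; _×_; _,_; proj₁; proj₂)
open import Data.Product.Properties using (≡-dec)
open import Data.Sum as Sum using (_⊎_; inj₁; inj₂; [_,_]′)
open import Data.Empty using (⊥; ⊥-elim)
open import Data.Unit using (⊤; tt)
open import Data.List as L using (List; []; _∷_; length; allFin)
open import Data.List.Relation.Unary.All as All using (All; []; _∷_)
open import Data.List.Relation.Unary.Any as Any using (Any; here; there)
open import Data.List.Relation.Unary.AllPairs as AllPairs using (AllPairs; []; _∷_)
open import Data.List.Membership.Propositional using (_∈_)
open import Data.List.Membership.Propositional.Properties using (∈-allFin; ∈-filter⁺; ∈-filter⁻; ∈-cartesianProduct⁺; ∈-cartesianProductWith⁺; ∈-map⁺; ∈-++⁺ˡ; ∈-++⁺ʳ)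
open import Relation.Nullary using (¬_; Dec; yes; no; does; contradiction; map′; _×-dec_; _⊎-dec_; _→-dec_; ¬?)
open import Relation.Binary using (IsEquivalence; Decidable; DecidableEquality; tri<; tri≈; tri>)
open import Relation.Binary.PropositionalEquality using (_≡_; _≢_; refl; sym; trans; cong; cong₂; subst; isEquivalence; module ≡-Reasoning)
open import Function using (_∘_; id)
open import Algebra.Properties.CommutativeMonoid.Sum ℤₚ.+-0-commutativeMonoid using (sum; sum-cong-≗; ∑-distrib-+; ∑-comm)
import Data.List.Relation.Unary.Unique.Propositional.Properties as Uniqueₚ
open import Data.List.Properties using (length-tabulate; length-++; length-map)
open import Data.List.Membership.DecPropositional using () renaming (_∈?_ to ∈-dec)
open import Algebra.Properties.AbelianGroup ℤₚ.+-0-abelianGroup using () renaming (∙-cancelˡ to +-cancelˡ; ∙-cancelʳ to +-cancelʳ)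
open import Data.Nat.ListAction using () renaming (sum to nsum)
open import Data.Nat.Tactic.RingSolver using () renaming (solve-∀ to ℕ-solve-∀)
import Data.List.Relation.Unary.All.Properties as Allₚ
import Data.List.Relation.Unary.AllPairs.Properties as AllPairsₚ
open import Data.Nat.Divisibility using (_∣_; divides)
open import Function.Bundles using (_⇔_; mk⇔)

-- A rotation system carries no topology, so separation arguments are replaced by one principle: the
-- jumps of a function on faces cancel around each vertex (`one-jump`). It yields that a forest does
-- not separate the plane, that a function jumping only along a cycle is determined by one of its
-- jumps, and that the boundary of a region cannot end at a vertex. Heights of matchings can be cut
-- and recombined because the faces around a vertex take at most two consecutive values, so no
-- vertex sees both signs. A walk in R(G) need not be monotone; the lattice operations extract from
-- it a flip of its first matching in the wanted direction. The lower bound on the dimension then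
-- comes from a single pair: the least and greatest matchings already lie at distance equal to the
-- sum of the maximal heights. Weak elementarity comes from connectedness: a flip moves one face of
-- G, while heights are constant on the regions of G minus its forbidden edges.

-- Connectivity, forests and potentials on finite edge lists

module UnionFind {A Ed : Set} (src tgt : Ed → A) {Q : A → A → Set}
                 (Q-equiv : IsEquivalence Q) (_Q?_ : Decidable Q) where

  private module Q = IsEquivalence Q-equiv

  -- Adding an edge to the list creates only paths that use it once, in one of two directions; so
  -- connectivity is a finite disjunction and decidable by recursion. The base relation `Q` lets the
  -- same module treat the orbits of `φ`, the graph itself, and its dual, whose vertices are classes
  -- of darts.
  Conn : List Ed → A → A → Set
  Conn []      x y = Q x y
  Conn (e ∷ L) x y = Conn L x y
    ⊎ (Conn L x (src e) × Conn L (tgt e) y)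
    ⊎ (Conn L x (tgt e) × Conn L (src e) y)

  conn? : ∀ L → Decidable (Conn L)
  conn? []      x y = x Q? y
  conn? (e ∷ L) x y = conn? L x y
    ⊎-dec ((conn? L x (src e) ×-dec conn? L (tgt e) y)
    ⊎-dec (conn? L x (tgt e) ×-dec conn? L (src e) y))

  conn-Q : ∀ L {x y} → Q x y → Conn L x y
  conn-Q []      q = q
  conn-Q (e ∷ L) q = inj₁ (conn-Q L q)

  conn-refl : ∀ L {x} → Conn L x x
  conn-refl L = conn-Q L Q.refl

  conn-sym : ∀ L {x y} → Conn L x y → Conn L y x
  conn-sym []      q = Q.sym q
  conn-sym (e ∷ L) (inj₁ p) = inj₁ (conn-sym L p)
  conn-sym (e ∷ L) (inj₂ (inj₁ (p , q))) = inj₂ (inj₂ (conn-sym L q , conn-sym L p))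
  conn-sym (e ∷ L) (inj₂ (inj₂ (p , q))) = inj₂ (inj₁ (conn-sym L q , conn-sym L p))

  conn-trans : ∀ L {x y z} → Conn L x y → Conn L y z → Conn L x z
  conn-trans []      = Q.trans
  conn-trans (e ∷ L) = go
    where
    infixr 5 _∙_
    _∙_ : ∀ {x y z} → Conn L x y → Conn L y z → Conn L x z
    _∙_ = conn-trans L
    go : ∀ {x y z} → Conn (e ∷ L) x y → Conn (e ∷ L) y z → Conn (e ∷ L) x z
    go (inj₁ p) (inj₁ q) = inj₁ (p ∙ q)
    go (inj₁ p) (inj₂ (inj₁ (q , r))) = inj₂ (inj₁ (p ∙ q , r))
    go (inj₁ p) (inj₂ (inj₂ (q , r))) = inj₂ (inj₂ (p ∙ q , r))
    go (inj₂ (inj₁ (p , q))) (inj₁ r) = inj₂ (inj₁ (p , q ∙ r))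
    go (inj₂ (inj₁ (p , q))) (inj₂ (inj₁ (r , s))) = inj₂ (inj₁ (p , s))
    go (inj₂ (inj₁ (p , q))) (inj₂ (inj₂ (r , s))) = inj₁ (p ∙ s)
    go (inj₂ (inj₂ (p , q))) (inj₁ r) = inj₂ (inj₂ (p , q ∙ r))
    go (inj₂ (inj₂ (p , q))) (inj₂ (inj₁ (r , s))) = inj₁ (p ∙ s)
    go (inj₂ (inj₂ (p , q))) (inj₂ (inj₂ (r , s))) = inj₂ (inj₂ (p , s))

  conn-equiv : ∀ L → IsEquivalence (Conn L)
  conn-equiv L = record { refl = conn-refl L ; sym = conn-sym L ; trans = conn-trans L }

  conn-edge : ∀ {L e} → e ∈ L → Conn L (src e) (tgt e)
  conn-edge {_ ∷ L} (here refl) = inj₂ (inj₁ (conn-refl L , conn-refl L))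
  conn-edge (there i) = inj₁ (conn-edge i)

  conn-least : ∀ {R : A → A → Set} → IsEquivalence R → (∀ {x y} → Q x y → R x y) →
               ∀ L → (∀ e → e ∈ L → R (src e) (tgt e)) → ∀ {x y} → Conn L x y → R x y
  conn-least {R} R-equiv Q⊆R = go
    where
    module R = IsEquivalence R-equiv
    go : ∀ L → (∀ e → e ∈ L → R (src e) (tgt e)) → ∀ {x y} → Conn L x y → R x y
    go [] h q = Q⊆R q
    go (e ∷ L) h (inj₁ p) = go L (λ e i → h e (there i)) p
    go (e ∷ L) h (inj₂ (inj₁ (p , q))) =
      R.trans (go L (λ e i → h e (there i)) p)
        (R.trans (h e (here refl)) (go L (λ e i → h e (there i)) q))
    go (e ∷ L) h (inj₂ (inj₂ (p , q))) =
      R.trans (go L (λ e i → h e (there i)) p)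
        (R.trans (R.sym (h e (here refl))) (go L (λ e i → h e (there i)) q))

  Forest : List Ed → Set
  Forest []      = ⊤
  Forest (e ∷ L) = ¬ Conn L (src e) (tgt e) × Forest L

  -- Kruskal's algorithm: `X` collects the edges whose ends are already joined when they are met, so
  -- that discarding them loses no connectivity.
  greedy : ∀ L → ∃₂ λ T X → Forest T × length T ℕ.+ length X ≡ length L ×
           (∀ e → e ∈ L → e ∈ T ⊎ e ∈ X) × (∀ {x y} → Conn L x y → Conn T x y)
  greedy [] = [] , [] , tt , refl , (λ _ ()) , id
  greedy (e ∷ L) with greedy L
  ... | T , X , forest , len , cover , span with conn? T (src e) (tgt e)
  ... | yes c = T , e ∷ X , forest , trans (ℕₚ.+-suc _ _) (cong suc len)
      , (λ { _ (here refl) → inj₂ (here refl) ; e' (there i) → Sum.map₂ there (cover e' i) })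
      , λ { (inj₁ p) → span p
          ; (inj₂ (inj₁ (p , q))) → conn-trans T (span p) (conn-trans T c (span q))
          ; (inj₂ (inj₂ (p , q))) → conn-trans T (span p) (conn-trans T (conn-sym T c) (span q)) }
  ... | no ¬c = e ∷ T , X , (¬c , forest) , cong suc len
      , (λ { _ (here refl) → inj₁ (here refl) ; e' (there i) → Sum.map₁ there (cover e' i) })
      , Sum.map span (Sum.map (λ (p , q) → span p , span q) (λ (p , q) → span p , span q))

  Separated : List Ed → List A → Set
  Separated L = AllPairs (λ x y → ¬ Conn L x y)

  private
    -- A separated list meets the class of `t` at most once, so at most one entry is lost. The last
    -- component says that the result is a sublist in the form needed to rebuild separation.
    drop-class : ∀ L t rs → Separated L rs → ∃ λ rs' → Separated L rs' ×
      All (λ r → ¬ Conn L r t) rs' × length rs ≤ suc (length rs') ×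
      (∀ {P : A → Set} → All P rs → All P rs')
    drop-class L t [] [] = [] , [] , [] , z≤n , id
    drop-class L t (r ∷ rs) (h ∷ sep) with conn? L r t
    ... | yes c = rs , sep
        , All.map (λ ¬rr' r't → ¬rr' (conn-trans L c (conn-sym L r't))) h
        , ℕₚ.≤-refl , All.tail
    ... | no ¬c with drop-class L t rs sep
    ... | rs' , sep' , far , len , keep =
          r ∷ rs' , keep h ∷ sep' , ¬c ∷ far , s≤s len , λ { (p ∷ ps) → p ∷ keep ps }

    separated-cons : ∀ e L {rs} → Separated L rs → All (λ r → ¬ Conn L r (tgt e)) rs →
                     Separated (e ∷ L) rs
    separated-cons e L [] [] = []
    separated-cons e L (h ∷ sep) (f ∷ far) =
      All.zipWith (λ { (¬c , f') → λ { (inj₁ c) → ¬c c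
                                     ; (inj₂ (inj₁ (_ , c))) → f' (conn-sym L c)
                                     ; (inj₂ (inj₂ (c , _))) → f c } }) (h , far)
      ∷ separated-cons e L sep far

    separated-mono : ∀ e L {rs} → Conn L (src e) (tgt e) → Separated L rs → Separated (e ∷ L) rs
    separated-mono e L c [] = []
    separated-mono e L c (h ∷ sep) =
      All.map (λ ¬p → λ { (inj₁ p) → ¬p p
                        ; (inj₂ (inj₁ (p , q))) → ¬p (conn-trans L p (conn-trans L c q))
                        ; (inj₂ (inj₂ (p , q))) → ¬p (conn-trans L p (conn-trans L (conn-sym L c) q)) }) h
      ∷ separated-mono e L c sep

  -- Each edge of L merges at most two classes; if L is not a forest, one of its edges merges none.
  count : ∀ L {rs} → Separated [] rs → ∃ λ rs' → Separated L rs' ×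
          length rs ≤ length rs' ℕ.+ length L ×
          (Forest L ⊎ length rs < length rs' ℕ.+ length L)
  count [] {rs} sep = rs , sep , ℕₚ.m≤m+n _ _ , inj₁ tt
  count (e ∷ L) {rs} sep with count L sep
  ... | rs' , sep' , len , forest with conn? L (src e) (tgt e)
  ... | yes c = rs' , separated-mono e L c sep' , ℕₚ.<⇒≤ lt , inj₂ lt
    where
    lt : length rs < length rs' ℕ.+ suc (length L)
    lt = subst (length rs <_) (sym (ℕₚ.+-suc _ _)) (s≤s len)
  ... | no ¬c with drop-class L (tgt e) rs' sep'
  ... | rs″ , sep″ , far , len″ , _ =
    rs″ , separated-cons e L sep″ far , ℕₚ.≤-trans len bound ,
    Sum.map (¬c ,_) (λ lt → ℕₚ.≤-trans lt bound) forest
    where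
    bound : length rs' ℕ.+ length L ≤ length rs″ ℕ.+ suc (length L)
    bound = subst (length rs' ℕ.+ length L ≤_) (sym (ℕₚ.+-suc _ _)) (ℕₚ.+-monoˡ-≤ (length L) len″)

  separated-connected : ∀ L {rs} → (∀ x y → Conn L x y) → Separated L rs → length rs ≤ 1
  separated-connected L conn [] = z≤n
  separated-connected L conn (_ ∷ []) = s≤s z≤n
  separated-connected L conn ((¬c ∷ _) ∷ _ ∷ _) = contradiction (conn _ _) ¬c

  Potential : List Ed → (Ed → ℤ) → (A → ℤ) → Set
  Potential L c p = (∀ {x y} → Q x y → p x ≡ p y) × (∀ e → e ∈ L → p (tgt e) ≡ p (src e) ⊕ c e)

  -- The new edge joins two different classes of `L`, so the whole class of its target can be
  -- shifted by the missing amount `t` without spoiling any earlier jump.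
  forest-potential : ∀ L → Forest L → (c : Ed → ℤ) → ∃ (Potential L c)
  forest-potential [] _ c = (λ _ → 0ℤ) , (λ _ → refl) , λ _ ()
  forest-potential (e ∷ L) (¬c , forest) c with forest-potential L forest c
  ... | p , inv , jump = p' , inv' , jump'
    where
    t : ℤ
    t = p (src e) ⊕ c e ⊕ - p (tgt e)
    shift : ∀ {x} → Dec (Conn L (tgt e) x) → ℤ
    shift {x} (yes _) = p x ⊕ t
    shift {x} (no _)  = p x
    p' : A → ℤ
    p' x = shift (conn? L (tgt e) x)
    shift-cong : ∀ {x y} z → p y ≡ p x ⊕ z → Conn L x y →
                 (dx : Dec (Conn L (tgt e) x)) (dy : Dec (Conn L (tgt e) y)) → shift dy ≡ shift dx ⊕ z
    shift-cong z eq xy (yes cx) (no ¬cy) = contradiction (conn-trans L cx xy) ¬cy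
    shift-cong z eq xy (no ¬cx) (yes cy) = contradiction (conn-trans L cy (conn-sym L xy)) ¬cx
    shift-cong z eq xy (no _)   (no _)   = eq
    shift-cong {x} z eq xy (yes _) (yes _) = trans (cong (_⊕ t) eq) (ar (p x) z t)
      where
      ar : ∀ a b c → (a ⊕ b) ⊕ c ≡ (a ⊕ c) ⊕ b
      ar = solve-∀
    inv' : ∀ {x y} → Q x y → p' x ≡ p' y
    inv' {x} {y} q = sym (trans (shift-cong 0ℤ (trans (sym (inv q)) (sym (ℤₚ.+-identityʳ _)))
      (conn-Q L q) (conn? L _ x) (conn? L _ y)) (ℤₚ.+-identityʳ _))
    jump' : ∀ e' → e' ∈ e ∷ L → p' (tgt e') ≡ p' (src e') ⊕ c e'
    jump' e' (there i) = shift-cong (c e') (jump e' i) (conn-edge i) (conn? L _ _) (conn? L _ _)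
    jump' _ (here refl) with conn? L (tgt e) (src e) | conn? L (tgt e) (tgt e)
    ... | yes a | _     = contradiction (conn-sym L a) ¬c
    ... | no _  | no b  = contradiction (conn-refl L) b
    ... | no _  | yes _ = ar (p (src e)) (c e) (p (tgt e))
      where
      ar : ∀ a b c → c ⊕ (a ⊕ b ⊕ - c) ≡ a ⊕ b
      ar = solve-∀

-- Indicators and sums over darts

ind : ∀ {P : Set} → Dec P → ℤ → ℤ
ind (yes _) x = x
ind (no _)  x = 0ℤ

ind-yes : ∀ {P : Set} (p? : Dec P) {x} → P → ind p? x ≡ x
ind-yes (yes _) p = refl
ind-yes (no ¬p) p = contradiction p ¬p

ind-no : ∀ {P : Set} (p? : Dec P) {x} → ¬ P → ind p? x ≡ 0ℤ
ind-no (yes p) ¬p = contradiction p ¬p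
ind-no (no _)  ¬p = refl

ind-⇔ : ∀ {P R : Set} (p? : Dec P) (r? : Dec R) {x} → (P → R) → (R → P) → ind p? x ≡ ind r? x
ind-⇔ (yes p) r? f g = sym (ind-yes r? (f p))
ind-⇔ (no ¬p) r? f g = sym (ind-no r? (¬p ∘ g))

if-yes : ∀ {P : Set} (p? : Dec P) {a b : Bool} → P → (if does p? then a else b) ≡ a
if-yes (yes _) p = refl
if-yes (no ¬p) p = contradiction p ¬p

if-no : ∀ {P : Set} (p? : Dec P) {a b : Bool} → ¬ P → (if does p? then a else b) ≡ b
if-no (yes p) ¬p = contradiction p ¬p
if-no (no _)  ¬p = refl

sum-zero : ∀ {n} (F : Fin n → ℤ) → (∀ i → F i ≡ 0ℤ) → sum F ≡ 0ℤ
sum-zero {zero}  F h = refl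
sum-zero {suc n} F h = cong₂ _⊕_ (h zero) (sum-zero (F ∘ suc) (h ∘ suc))

sum-single : ∀ {n} (x : Fin n) (F : Fin n → ℤ) → sum (λ i → ind (i F.≟ x) (F i)) ≡ F x
sum-single {suc n} zero F =
  trans (cong (F zero ⊕_) (sum-zero {n} _ (λ _ → refl))) (ℤₚ.+-identityʳ _)
sum-single {suc n} (suc x) F = trans (ℤₚ.+-identityˡ _)
  (trans (sum-cong-≗ (λ i → ind-⇔ (suc i F.≟ suc x) (i F.≟ x) Fₚ.suc-injective (cong suc)))
         (sum-single x (F ∘ suc)))

module DartSum (n : ℕ) where

  D : Set
  D = Fin n × Bool

  infix 4 _≟D_
  abstract
    _≟D_ : DecidableEquality D
    _≟D_ = ≡-dec F._≟_ Bₚ._≟_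

  ΣD : (D → ℤ) → ℤ
  ΣD G = sum (λ e → G (e , false) ⊕ G (e , true))

  ΣD-cong : ∀ {G G'} → (∀ d → G d ≡ G' d) → ΣD G ≡ ΣD G'
  ΣD-cong h = sum-cong-≗ (λ e → cong₂ _⊕_ (h (e , false)) (h (e , true)))

  ΣD-+ : ∀ G G' → ΣD (λ d → G d ⊕ G' d) ≡ ΣD G ⊕ ΣD G'
  ΣD-+ G G' = trans
    (sum-cong-≗ (λ e → ar (G (e , false)) (G' (e , false)) (G (e , true)) (G' (e , true))))
    (∑-distrib-+ (λ e → G (e , false) ⊕ G (e , true)) (λ e → G' (e , false) ⊕ G' (e , true)))
    where
    ar : ∀ a b c d → (a ⊕ b) ⊕ (c ⊕ d) ≡ (a ⊕ c) ⊕ (b ⊕ d)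
    ar = solve-∀

  ΣD-neg : ∀ G → ΣD (λ d → - G d) ≡ - ΣD G
  ΣD-neg G = begin
    ΣD (λ d → - G d)                       ≡⟨ ar (ΣD (λ d → - G d)) (ΣD G) ⟩
    (ΣD (λ d → - G d) ⊕ ΣD G) ⊕ - ΣD G     ≡⟨ cong (_⊕ - ΣD G) (sym (ΣD-+ (λ d → - G d) G)) ⟩
    ΣD (λ d → - G d ⊕ G d) ⊕ - ΣD G        ≡⟨ cong (_⊕ - ΣD G) (sum-zero _ (λ e →
      cong₂ _⊕_ (ℤₚ.+-inverseˡ (G (e , false))) (ℤₚ.+-inverseˡ (G (e , true))))) ⟩
    0ℤ ⊕ - ΣD G                            ≡⟨ ℤₚ.+-identityˡ _ ⟩
    - ΣD G                                 ∎
    where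
    open ≡-Reasoning
    ar : ∀ a b → a ≡ (a ⊕ b) ⊕ - b
    ar = solve-∀

  ΣD-sum : ∀ {m} (G : D → Fin m → ℤ) → ΣD (λ d → sum (G d)) ≡ sum (λ v → ΣD (λ d → G d v))
  ΣD-sum G = trans
    (sum-cong-≗ (λ e → sym (∑-distrib-+ (G (e , false)) (G (e , true)))))
    (∑-comm (λ e v → G (e , false) v ⊕ G (e , true) v))

  ΣD-swap : (G : D → D → ℤ) → ΣD (λ d → ΣD (G d)) ≡ ΣD (λ d' → ΣD (λ d → G d d'))
  ΣD-swap G = trans (ΣD-sum (λ d e → G d (e , false) ⊕ G d (e , true)))
    (sum-cong-≗ (λ e → ΣD-+ (λ d → G d (e , false)) (λ d → G d (e , true))))

  ΣD-single : ∀ x (G : D → ℤ) → ΣD (λ d → ind (d ≟D x) (G d)) ≡ G x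
  ΣD-single (x , b) G = trans (sum-cong-≗ (eq b)) (sum-single x (λ e → G (e , b)))
    where
    eq : ∀ b e → ind ((e , false) ≟D (x , b)) (G (e , false)) ⊕ ind ((e , true) ≟D (x , b)) (G (e , true))
               ≡ ind (e F.≟ x) (G (e , b))
    pick-eq : ∀ {e} b → e ≡ x → ind ((e , b) ≟D (x , b)) (G (e , b)) ≡ ind (e F.≟ x) (G (e , b))
    pick-eq {e} b h = ind-⇔ ((e , b) ≟D (x , b)) (e F.≟ x) (λ _ → h) (λ _ → cong (_, b) h)
    zero-b : ∀ {e} b b' → ¬ (e ≡ x × b ≡ b') → ind ((e , b) ≟D (x , b')) (G (e , b)) ≡ 0ℤ
    zero-b b b' ne = ind-no ((_ , b) ≟D (x , b')) (λ { refl → ne (refl , refl) })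
    eq b e with (e , b) ≟D (x , b)
    eq b e | no ne = trans (cong₂ _⊕_ (zero-b false b (λ (h , _) → ne (cong (_, b) h)))
                                      (zero-b true b (λ (h , _) → ne (cong (_, b) h))))
                           (sym (ind-no (e F.≟ x) (λ h → ne (cong (_, b) h))))
    eq false e | yes refl = trans (cong₂ _⊕_ (pick-eq false refl) (zero-b true false λ ())) (ℤₚ.+-identityʳ _)
    eq true e | yes refl = trans (cong₂ _⊕_ (zero-b false true λ ()) (pick-eq true refl)) (ℤₚ.+-identityˡ _)

  -- Each `G (f d)` is written as a sum over all darts against an indicator; after exchanging the
  -- two sums, the inverse `g` picks out exactly one term again.
  ΣD-reindex : (f g : D → D) → (∀ d → f (g d) ≡ d) → (∀ d → g (f d) ≡ d) →
               ∀ G → ΣD (G ∘ f) ≡ ΣD G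
  ΣD-reindex f g fg gf G = begin
    ΣD (G ∘ f)                                        ≡⟨ ΣD-cong (λ d → sym (ΣD-single (f d) G)) ⟩
    ΣD (λ d → ΣD (λ d' → ind (d' ≟D f d) (G d')))     ≡⟨ ΣD-swap (λ d d' → ind (d' ≟D f d) (G d')) ⟩
    ΣD (λ d' → ΣD (λ d → ind (d' ≟D f d) (G d')))     ≡⟨ ΣD-cong (λ d' → ΣD-cong (λ d →
      ind-⇔ (d' ≟D f d) (d ≟D g d') {G d'} (λ e → trans (sym (gf d)) (cong g (sym e)))
                                    (λ e → trans (sym (fg d')) (cong f (sym e))))) ⟩
    ΣD (λ d' → ΣD (λ d → ind (d ≟D g d') (G d')))     ≡⟨ ΣD-cong (λ d' → ΣD-single (g d') (λ _ → G d')) ⟩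
    ΣD G                                              ∎
    where open ≡-Reasoning

-- Plane maps: faces, dual graph and decidability of regions

iter-comm : ∀ {A : Set} (f : A → A) n x → iter f n (f x) ≡ f (iter f n x)
iter-comm f zero    x = refl
iter-comm f (suc n) x = cong f (iter-comm f n x)

iter-+ : ∀ {A : Set} (f : A → A) m n x → iter f (m ℕ.+ n) x ≡ iter f m (iter f n x)
iter-+ f zero    n x = refl
iter-+ f (suc m) n x = cong f (iter-+ f m n x)

≡-equiv : ∀ {A : Set} → IsEquivalence {A = A} _≡_
≡-equiv = isEquivalence

module PlaneMap (H : Map) (plane : IsPlaneMap H) where
  open Map H public
  open DartSum nE public

  private
    Da : Set
    Da = Dart H

  tl : Da → Fin nV
  tl = tail H

  α′ φ′ : Da → Da
  α′ = α H
  φ′ = φ H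

  loopless : ∀ e → end e false ≢ end e true
  loopless = proj₁ plane
  tail-σ : ∀ d → tl (σ d) ≡ tl d
  tail-σ = proj₁ (proj₂ plane)
  σ-inj : ∀ d d' → σ d ≡ σ d' → d ≡ d'
  σ-inj = proj₁ (proj₂ (proj₂ plane))
  σ-orbit : ∀ d d' → tl d ≡ tl d' → ∃[ n ] iter σ n d ≡ d'
  σ-orbit = proj₁ (proj₂ (proj₂ (proj₂ plane)))
  connected : ∀ u v → Reach H (λ _ → ⊤) u v
  connected = proj₁ (proj₂ (proj₂ (proj₂ (proj₂ plane))))

  αα : ∀ d → α′ (α′ d) ≡ d
  αα (e , b) = cong (e ,_) (not-involutive b)

  φα : ∀ d → φ′ (α′ d) ≡ σ d
  φα d = cong σ (αα d)

  dart-unique : ∀ {e b b'} → end e b ≡ end e b' → b ≡ b'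
  dart-unique {b = false} {false} _ = refl
  dart-unique {b = true}  {true}  _ = refl
  dart-unique {b = false} {true}  h = contradiction h (loopless _)
  dart-unique {b = true}  {false} h = contradiction (sym h) (loopless _)

  same-dart : ∀ {d d'} → proj₁ d ≡ proj₁ d' → tl d ≡ tl d' → d ≡ d'
  same-dart {e , b} {.e , b'} refl h = cong (e ,_) (dart-unique h)

  -- The orbit condition leads from `σ d` back to `d` in some n steps; the n-th iterate of `d`
  -- itself is therefore sent to `d` by `σ`.
  σ⁻ : Da → Da
  σ⁻ d = iter σ (proj₁ (σ-orbit (σ d) d (tail-σ d))) d

  σσ⁻ : ∀ d → σ (σ⁻ d) ≡ d
  σσ⁻ d = trans (sym (iter-comm σ (proj₁ o) d)) (proj₂ o)
    where o = σ-orbit (σ d) d (tail-σ d)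

  σ⁻σ : ∀ d → σ⁻ (σ d) ≡ d
  σ⁻σ d = σ-inj _ _ (σσ⁻ (σ d))

  rotate : ∀ {v} (P : Da → Set) → (∀ d → tl d ≡ v → P d → P (σ d)) →
           ∀ d d' → tl d ≡ v → tl d' ≡ v → P d → P d'
  rotate {v} P step d d' h h' p with σ-orbit d d' (trans h (sym h'))
  ... | n , eq = subst P eq (proj₂ (go n))
    where
    go : ∀ n → tl (iter σ n d) ≡ v × P (iter σ n d)
    go zero = h , p
    go (suc n) = trans (tail-σ _) (proj₁ (go n)) , step _ (proj₁ (go n)) (proj₂ (go n))

  -- The jumps of g around a vertex add up to zero, so a single one of them cannot be nonzero.
  one-jump : ∀ {A : Set} (g : Da → A) d₂ → (∀ d → tl d ≡ tl d₂ → d ≢ d₂ → g (σ d) ≡ g d) →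
             g (σ d₂) ≡ g d₂
  one-jump g d₂ h with σ-orbit (σ d₂) d₂ (tail-σ d₂)
  ... | n , eq = sym (go n (σ d₂) eq (tail-σ d₂))
    where
    go : ∀ n y → iter σ n y ≡ d₂ → tl y ≡ tl d₂ → g d₂ ≡ g y
    go zero y refl _ = refl
    go (suc n) y eq t with y ≟D d₂
    ... | yes refl = refl
    ... | no ne = trans (go n (σ y) (trans (iter-comm σ n y) eq) (trans (tail-σ y) t)) (h y t ne)

  -- `σ` is `φ′` after `α′`, so a set closed under both is closed under rotation at a vertex and
  -- under passing along an edge; connectedness of the map does the rest.
  spread : (P : Da → Set) → (∀ d → P d → P (φ′ d)) → (∀ d → P d → P (α′ d)) →
           ∀ d → P d → ∀ d' → P d'
  spread P Pφ Pα d p d' = go (connected (tl d) (tl d')) d refl p d' refl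
    where
    Pσ : ∀ d → P d → P (σ d)
    Pσ d p = subst P (φα d) (Pφ _ (Pα _ p))
    go : ∀ {u v} → Reach H (λ _ → ⊤) u v → ∀ d → tl d ≡ u → P d → ∀ d' → tl d' ≡ v → P d'
    go r-refl d h p d' h' = rotate P (λ d _ → Pσ d) d d' h h' p
    go (r-step e b _ r) d h p d' h' =
      go r (e , not b) refl (Pα (e , b) (rotate P (λ d _ → Pσ d) d (e , b) h refl p)) d' h'

  spread-const : ∀ {A : Set} (g : Da → A) → (∀ d → g (φ′ d) ≡ g d) → (∀ d → g (α′ d) ≡ g d) →
                 ∀ d d' → g d ≡ g d'
  spread-const g gφ gα d d' =
    spread (λ x → g d ≡ g x) (λ x e → trans e (sym (gφ x))) (λ x e → trans e (sym (gα x))) d refl d'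

  darts : List Da
  darts = L.cartesianProduct (allFin nE) (false ∷ true ∷ [])

  ∈-darts : ∀ d → d ∈ darts
  ∈-darts (e , false) = ∈-cartesianProduct⁺ (∈-allFin e) (here refl)
  ∈-darts (e , true)  = ∈-cartesianProduct⁺ (∈-allFin e) (there (here refl))

  private
    module Orb = UnionFind {Da} {Da} id φ′ ≡-equiv _≟D_

  Orbit : Da → Da → Set
  Orbit = Orb.Conn darts

  orbit-equiv : IsEquivalence Orbit
  orbit-equiv = Orb.conn-equiv darts

  orbit-φ : ∀ d → Orbit d (φ′ d)
  orbit-φ d = Orb.conn-edge (∈-darts d)

  orbit-least : ∀ {R : Da → Da → Set} → IsEquivalence R → (∀ d → R d (φ′ d)) → ∀ {x y} → Orbit x y → R x y
  orbit-least R-equiv h = Orb.conn-least R-equiv (λ { refl → IsEquivalence.refl R-equiv }) darts (λ e _ → h e)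

  φ-inj : ∀ {d d'} → φ′ d ≡ φ′ d' → d ≡ d'
  φ-inj {d} {d'} e = trans (sym (αα d)) (trans (cong α′ (σ-inj _ _ e)) (αα d'))

  private
    dartIx : Da → Fin (nE ℕ.* 2)
    dartIx (e , b) = F.combine e (if b then suc zero else zero)

    dartIx-inj : ∀ {d d'} → dartIx d ≡ dartIx d' → d ≡ d'
    dartIx-inj {e , b} {e' , b'} h with Fₚ.combine-injective e (if b then suc zero else zero) e' (if b' then suc zero else zero) h
    dartIx-inj {e , true}  {.e , true}  h | refl , _ = refl
    dartIx-inj {e , false} {.e , false} h | refl , _ = refl

    iter-inj : ∀ n {d d'} → iter φ′ n d ≡ iter φ′ n d' → d ≡ d'
    iter-inj zero e = e
    iter-inj (suc n) e = iter-inj n (φ-inj e)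

  -- By pigeonhole two iterates of `d` coincide, and injectivity of `φ′` cancels the common initial
  -- part.
  φ-period : ∀ d → ∃[ n ] iter φ′ n (φ′ d) ≡ d
  φ-period d with pigeonhole (ℕₚ.n<1+n (nE ℕ.* 2)) (λ i → dartIx (iter φ′ (F.toℕ i) d))
  ... | i , j , i<j , eq with ℕₚ.m≤n⇒∃[o]m+o≡n i<j
  ... | k , i+k≡j = k , trans (iter-comm φ′ k d) (iter-inj (F.toℕ i) (trans (sym (iter-+ φ′ (F.toℕ i) (suc k) d))
          (trans (cong (λ t → iter φ′ t d) (trans (ℕₚ.+-suc (F.toℕ i) k) i+k≡j)) (sym (dartIx-inj eq)))))

  -- `SameFaceH` only iterates forwards; periodicity makes it symmetric, hence an equivalence
  -- containing the decidable relation `Orbit`. This turns the face representatives of Euler's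
  -- formula into a separated list of the dual graph.
  orbit⇒sameFace : ∀ {x y} → Orbit x y → SameFaceH H x y
  orbit⇒sameFace = orbit-least
    (record { refl = 0 , refl ; sym = λ {x} {y} → sf-sym {x} {y} ; trans = sf-trans }) (λ d → 1 , refl)
    where
    sf-trans : ∀ {x y z} → SameFaceH H x y → SameFaceH H y z → SameFaceH H x z
    sf-trans {x} (m , refl) (n , e) = n ℕ.+ m , trans (iter-+ φ′ n m x) e
    go : ∀ n x → SameFaceH H (iter φ′ n x) x
    go zero x = 0 , refl
    go (suc n) x with φ-period (iter φ′ n x) | go n x
    ... | k , e | m , e' = m ℕ.+ k , trans (iter-+ φ′ m k _) (trans (cong (iter φ′ m) e) e')
    sf-sym : ∀ {x y} → SameFaceH H x y → SameFaceH H y x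
    sf-sym {x} (n , refl) = go n x

  -- In `Dual` the vertices are darts up to `Orbit`, that is, faces, and each edge joins the faces
  -- of its two darts.
  module Dual  = UnionFind {Da} {Fin nE} (_, false) (_, true) orbit-equiv (Orb.conn? darts)
  module Prim  = UnionFind {Fin nV} {Fin nE} (λ e → end e false) (λ e → end e true) ≡-equiv F._≟_

  reach⇒prim : ∀ {E : Fin nE → Set} L → (∀ e → E e → e ∈ L) → ∀ {u v} → Reach H E u v → Prim.Conn L u v
  reach⇒prim L h r-refl = Prim.conn-refl L
  reach⇒prim L h (r-step e false x r) = Prim.conn-trans L (Prim.conn-edge (h e x)) (reach⇒prim L h r)
  reach⇒prim L h (r-step e true x r) =
    Prim.conn-trans L (Prim.conn-sym L (Prim.conn-edge (h e x))) (reach⇒prim L h r)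

  reach-trans : ∀ {E : Fin nE → Set} {u v w} → Reach H E u v → Reach H E v w → Reach H E u w
  reach-trans r-refl s = s
  reach-trans (r-step e b x r) s = r-step e b x (reach-trans r s)

  reach-edge : ∀ {E : Fin nE → Set} e b → E e → Reach H E (end e b) (end e (not b))
  reach-edge e b x = r-step e b x r-refl

  reach-edge′ : ∀ {E : Fin nE → Set} e b → E e → Reach H E (end e (not b)) (end e b)
  reach-edge′ {E} e b x = subst (λ z → Reach H E (end e (not b)) (end e z)) (not-involutive b) (r-step e (not b) x r-refl)

  reach-sym : ∀ {E : Fin nE → Set} {u v} → Reach H E u v → Reach H E v u
  reach-sym r-refl = r-refl
  reach-sym (r-step e b x r) = reach-trans (reach-sym r) (reach-edge′ e b x)

  reach-mono : ∀ {E E' : Fin nE → Set} → (∀ e → E e → E' e) → ∀ {u v} → Reach H E u v → Reach H E' u v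
  reach-mono h r-refl = r-refl
  reach-mono h (r-step e b x r) = r-step e b (h e x) (reach-mono h r)

  reach-equiv : ∀ {E : Fin nE → Set} → IsEquivalence (Reach H E)
  reach-equiv = record { refl = r-refl ; sym = reach-sym ; trans = reach-trans }

  abstract
    reach? : ∀ {E : Fin nE → Set} → (∀ e → Dec (E e)) → ∀ u v → Dec (Reach H E u v)
    reach? {E} E? u v = map′
      (Prim.conn-least reach-equiv (λ { refl → r-refl }) L (λ e i → reach-edge e false (proj₂ (∈-filter⁻ E? {xs = allFin nE} i))))
      (reach⇒prim L (λ e x → ∈-filter⁺ E? (∈-allFin e) x))
      (Prim.conn? L u v)
      where
      L : List (Fin nE)
      L = L.filter E? (allFin nE)

  faceRel-equiv : ∀ {E : Fin nE → Set} → IsEquivalence (FaceRel H E)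
  faceRel-equiv = record { refl = f-refl ; sym = f-sym ; trans = f-trans }

  faceRel⇒dual : ∀ {E : Fin nE → Set} L → (∀ e → ¬ E e → e ∈ L) → ∀ {x y} → FaceRel H E x y → Dual.Conn L x y
  faceRel⇒dual L h f-refl = Dual.conn-refl L
  faceRel⇒dual L h (f-φ {d}) = Dual.conn-Q L (orbit-φ d)
  faceRel⇒dual L h (f-α {e , false} x) = Dual.conn-edge (h e x)
  faceRel⇒dual L h (f-α {e , true} x) = Dual.conn-sym L (Dual.conn-edge (h e x))
  faceRel⇒dual L h (f-sym r) = Dual.conn-sym L (faceRel⇒dual L h r)
  faceRel⇒dual L h (f-trans r s) = Dual.conn-trans L (faceRel⇒dual L h r) (faceRel⇒dual L h s)

  abstract
    faceRel? : ∀ {E : Fin nE → Set} → (∀ e → Dec (E e)) → ∀ x y → Dec (FaceRel H E x y)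
    faceRel? {E} E? x y = map′
      (Dual.conn-least faceRel-equiv (orbit-least faceRel-equiv (λ _ → f-φ)) L
        (λ e i → f-α (proj₂ (∈-filter⁻ (¬? ∘ E?) {xs = allFin nE} i))))
      (faceRel⇒dual L (λ e x → ∈-filter⁺ (¬? ∘ E?) (∈-allFin e) x))
      (Dual.conn? L x y)
      where
      L : List (Fin nE)
      L = L.filter (¬? ∘ E?) (allFin nE)

  faceRel-mono : ∀ {E E' : Fin nE → Set} → (∀ e → E' e → E e) → ∀ {x y} → FaceRel H E x y → FaceRel H E' x y
  faceRel-mono h f-refl = f-refl
  faceRel-mono h f-φ = f-φ
  faceRel-mono h (f-α x) = f-α (x ∘ h _)
  faceRel-mono h (f-sym r) = f-sym (faceRel-mono h r)
  faceRel-mono h (f-trans r s) = f-trans (faceRel-mono h r) (faceRel-mono h s)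

-- Circulations on a plane map are coboundaries of the dual

module Circulations (H : Map) (plane : IsPlaneMap H) where
  open PlaneMap H plane

  -- For `A` the indicator of a vertex this is conservation of flow there. Allowing every vertex
  -- weight makes summation by parts against a potential immediate.
  Antisymmetric Circulation : (Dart H → ℤ) → Set
  Antisymmetric c = ∀ d → c (α′ d) ≡ - c d
  Circulation c = ∀ (A : Fin nV → ℤ) → ΣD (λ d → A (tl d) ⊛ c d) ≡ 0ℤ

  private
    allEdges : List (Fin nE)
    allEdges = allFin nE

    _∈?_ : ∀ (e : Fin nE) L → Dec (e ∈ L)
    _∈?_ = ∈-dec F._≟_

    neg-zero : ∀ {x} → - x ≡ 0ℤ → x ≡ 0ℤ
    neg-zero {x} h = trans (sym (ℤₚ.neg-involutive x)) (cong -_ h)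

    difference-zero : ∀ {a b c} → a ⊕ - b ⊕ - c ≡ 0ℤ → a ≡ b ⊕ c
    difference-zero {a} {b} {c} h = trans (ar a b c) (trans (cong (_⊕ (b ⊕ c)) h) (ℤₚ.+-identityˡ _))
      where
      ar : ∀ a b c → a ≡ (a ⊕ - b ⊕ - c) ⊕ (b ⊕ c)
      ar = solve-∀

    zero-difference : ∀ {a b c} → a ≡ b ⊕ c → a ⊕ - b ⊕ - c ≡ 0ℤ
    zero-difference {b = b} {c} refl = ar b c
      where
      ar : ∀ b c → (b ⊕ c) ⊕ - b ⊕ - c ≡ 0ℤ
      ar = solve-∀

  both-sides : ∀ {p c : Dart H → ℤ} → Antisymmetric c → (∀ e → p (e , true) ≡ p (e , false) ⊕ c (e , false)) →
               ∀ d → p (α′ d) ≡ p d ⊕ c d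
  both-sides anti h (e , false) = h e
  both-sides {p} {c} anti h (e , true) = sym (trans (cong₂ _⊕_ (h e) (anti (e , false))) (ar (p (e , false)) (c (e , false))))
    where
    ar : ∀ a b → (a ⊕ b) ⊕ - b ≡ a
    ar = solve-∀

  -- Weigh the defect g of p by a vertex potential A that jumps across t and across no other edge of
  -- the forest: all terms of the total cancel except the one of t.
  forest-jumps : ∀ T → Prim.Forest T → ∀ {p c : Dart H → ℤ} → Antisymmetric c → Circulation c →
                 (∀ d → p (φ′ d) ≡ p d) →
                 (∀ e → ¬ e ∈ T → p (e , true) ≡ p (e , false) ⊕ c (e , false)) →
                 ∀ e → p (e , true) ≡ p (e , false) ⊕ c (e , false)
  forest-jumps T forest {p} {c} anti circ inv off t with t ∈? T
  ... | no t∉T = off t t∉T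
  ... | yes t∈T with Prim.forest-potential T forest (λ e → ind (e F.≟ t) 1ℤ)
  ... | A , _ , A-jump = difference-zero (neg-zero (trans (sym (sum-single t (λ e → - g (e , false))))
                           (trans (sym (sum-cong-≗ local)) total)))
    where
    g : Dart H → ℤ
    g d = p (α′ d) ⊕ - p d ⊕ - c d

    total : ΣD (λ d → A (tl d) ⊛ g d) ≡ 0ℤ
    total = begin
      ΣD (λ d → A (tl d) ⊛ g d)
        ≡⟨ ΣD-cong (λ d → ar (A (tl d)) (p (α′ d)) (p d) (c d)) ⟩
      ΣD (λ d → A (tl d) ⊛ p (α′ d) ⊕ - (A (tl d) ⊛ p d ⊕ A (tl d) ⊛ c d))
        ≡⟨ ΣD-+ (λ d → A (tl d) ⊛ p (α′ d)) (λ d → - (A (tl d) ⊛ p d ⊕ A (tl d) ⊛ c d)) ⟩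
      ΣD (λ d → A (tl d) ⊛ p (α′ d)) ⊕ ΣD (λ d → - (A (tl d) ⊛ p d ⊕ A (tl d) ⊛ c d))
        ≡⟨ cong₂ _⊕_ shifted (trans (ΣD-neg (λ d → A (tl d) ⊛ p d ⊕ A (tl d) ⊛ c d))
             (cong -_ (trans (ΣD-+ (λ d → A (tl d) ⊛ p d) (λ d → A (tl d) ⊛ c d))
                             (cong (ΣD (λ d → A (tl d) ⊛ p d) ⊕_) (circ A))))) ⟩
      ΣD (λ d → A (tl d) ⊛ p d) ⊕ - (ΣD (λ d → A (tl d) ⊛ p d) ⊕ 0ℤ)
        ≡⟨ ar' (ΣD (λ d → A (tl d) ⊛ p d)) ⟩
      0ℤ ∎
      where
      open ≡-Reasoning
      ar : ∀ a x y z → a ⊛ (x ⊕ - y ⊕ - z) ≡ a ⊛ x ⊕ - (a ⊛ y ⊕ a ⊛ z)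
      ar = solve-∀
      ar' : ∀ a → a ⊕ - (a ⊕ 0ℤ) ≡ 0ℤ
      ar' = solve-∀
      -- `p` takes the same value at `α′ d` and at `σ d`, and `σ` permutes the darts while fixing
      -- their tails.
      shifted : ΣD (λ d → A (tl d) ⊛ p (α′ d)) ≡ ΣD (λ d → A (tl d) ⊛ p d)
      shifted = trans
        (ΣD-cong (λ d → cong₂ _⊛_ (cong A (sym (tail-σ d))) (trans (sym (inv (α′ d))) (cong p (φα d)))))
        (ΣD-reindex σ σ⁻ σσ⁻ σ⁻σ (λ d → A (tl d) ⊛ p d))

    local : ∀ e → A (end e false) ⊛ g (e , false) ⊕ A (end e true) ⊛ g (e , true) ≡ ind (e F.≟ t) (- g (e , false))
    local e = trans (cong (λ z → A (end e false) ⊛ g (e , false) ⊕ A (end e true) ⊛ z) flip)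
                    (go (e ∈? T))
      where
      flip : g (e , true) ≡ - g (e , false)
      flip = trans (cong (p (e , false) ⊕ - p (e , true) ⊕_) (cong -_ (anti (e , false))))
                   (ar (p (e , false)) (p (e , true)) (c (e , false)))
        where
        ar : ∀ a b c → a ⊕ - b ⊕ - (- c) ≡ - (b ⊕ - a ⊕ - c)
        ar = solve-∀
      ar₀ : ∀ a b x → x ≡ 0ℤ → a ⊛ x ⊕ b ⊛ (- x) ≡ 0ℤ
      ar₀ a b _ refl = go' a b
        where
        go' : ∀ a b → a ⊛ 0ℤ ⊕ b ⊛ (- 0ℤ) ≡ 0ℤ
        go' = solve-∀
      ar₁ : ∀ a x → a ⊛ x ⊕ (a ⊕ 1ℤ) ⊛ (- x) ≡ - x
      ar₁ = solve-∀
      ar₂ : ∀ a x → a ⊛ x ⊕ (a ⊕ 0ℤ) ⊛ (- x) ≡ 0ℤ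
      ar₂ = solve-∀
      go : Dec (e ∈ T) → A (end e false) ⊛ g (e , false) ⊕ A (end e true) ⊛ - g (e , false) ≡ ind (e F.≟ t) (- g (e , false))
      go (no e∉T) = trans (ar₀ (A (end e false)) (A (end e true)) (g (e , false)) (zero-difference (off e e∉T)))
                          (sym (ind-no (e F.≟ t) (λ { refl → e∉T t∈T })))
      go (yes e∈T) rewrite A-jump e e∈T with e F.≟ t
      ... | yes _ = ar₁ (A (end e false)) (g (e , false))
      ... | no _  = ar₂ (A (end e false)) (g (e , false))

  private
    -- Tree-cotree decomposition: by Euler's formula the edges off a spanning tree of the map form a
    -- spanning tree of the dual.
    tree-cotree : ∀ c → Antisymmetric c → Circulation c →
                ∃ λ (p : Dart H → ℤ) → (∀ d → p (φ′ d) ≡ p d) × (∀ d → p (α′ d) ≡ p d ⊕ c d)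
    tree-cotree c anti circ = p , (λ d → sym (p-inv (orbit-φ d))) ,
      both-sides {p} {c} anti (forest-jumps T T-forest {p} {c} anti circ (λ d → sym (p-inv (orbit-φ d)))
        (λ e e∉T → p-jump e (off-T e e∉T)))
      where
      G = Prim.greedy allEdges
      T = proj₁ G
      X = proj₁ (proj₂ G)
      T-forest : Prim.Forest T
      T-forest = proj₁ (proj₂ (proj₂ G))
      |T|+|X| : length T ℕ.+ length X ≡ nE
      |T|+|X| = trans (proj₁ (proj₂ (proj₂ (proj₂ G)))) (length-tabulate id)
      off-T : ∀ e → ¬ e ∈ T → e ∈ X
      off-T e e∉T with proj₁ (proj₂ (proj₂ (proj₂ (proj₂ G)))) e (∈-allFin e)
      ... | inj₁ e∈T = contradiction e∈T e∉T
      ... | inj₂ e∈X = e∈X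
      T-spans : ∀ u v → Prim.Conn T u v
      T-spans u v = proj₂ (proj₂ (proj₂ (proj₂ (proj₂ G)))) (reach⇒prim allEdges (λ e _ → ∈-allFin e) (connected u v))

      nV≤ : nV ≤ suc (length T)
      nV≤ with Prim.count T {allFin nV} (Uniqueₚ.allFin⁺ nV)
      ... | rs , sep , le , _ = ℕₚ.≤-trans (subst (_≤ length rs ℕ.+ length T) (length-tabulate {n = nV} id) le)
                                  (ℕₚ.+-monoˡ-≤ (length T) (Prim.separated-connected T T-spans sep))

      -- A forest does not separate the plane: the indicator of the region of `z` has zero jumps
      -- across all edges off `T`, so by `forest-jumps` with the zero circulation it has none across
      -- `T` either.
      off-T-total : ∀ x y → FaceRel H (_∈ T) x y
      off-T-total x y = spread (FaceRel H (_∈ T) x) (λ _ r → f-trans r f-φ) (λ z r → f-trans r (across z)) x f-refl y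
        where
        across : ∀ z → FaceRel H (_∈ T) z (α′ z)
        across z = decide (faceRel? (_∈? T) z (α′ z))
          where
          cls : ∀ y → ℤ
          cls y = ind (faceRel? (_∈? T) z y) 1ℤ
          cls-cong : ∀ {y y'} → FaceRel H (_∈ T) y y' → cls y' ≡ cls y
          cls-cong r = ind-⇔ (faceRel? (_∈? T) z _) (faceRel? (_∈? T) z _) (λ s → f-trans s (f-sym r)) (λ s → f-trans s r)
          jump : ∀ d → cls (α′ d) ≡ cls d ⊕ 0ℤ
          jump = both-sides {cls} {λ _ → 0ℤ} (λ _ → refl) (forest-jumps T T-forest {cls} {λ _ → 0ℤ} (λ _ → refl)
            (λ A → sum-zero _ (λ e → cong₂ _⊕_ (ℤₚ.*-zeroʳ (A (end e false))) (ℤₚ.*-zeroʳ (A (end e true)))))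
            (λ d → cls-cong f-φ)
            (λ e e∉T → trans (cls-cong (f-α e∉T)) (sym (ℤₚ.+-identityʳ _))))
          decide : Dec (FaceRel H (_∈ T) z (α′ z)) → FaceRel H (_∈ T) z (α′ z)
          decide (yes r) = r
          decide (no ¬r) = contradiction
            (trans (sym (ind-no (faceRel? (_∈? T) z (α′ z)) ¬r)) (trans (jump z)
              (trans (ℤₚ.+-identityʳ _) (ind-yes (faceRel? (_∈? T) z z) f-refl))))
            λ ()

      X-connects : ∀ x y → Dual.Conn X x y
      X-connects x y = faceRel⇒dual X off-T (off-T-total x y)

      -- Euler's formula and nV ≤ |T| + 1 give k ≥ |X| + 1 faces. The edges of `X` connect them all,
      -- which |X| edges cannot do if one of them is redundant.
      X-forest : Dual.Forest X
      X-forest with proj₂ (proj₂ (proj₂ (proj₂ (proj₂ plane))))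
      ... | k , (reps , |reps| , reps-sep , _) , euler
        with Dual.count X {reps} (AllPairs.map (λ ¬s o → ¬s (orbit⇒sameFace o)) reps-sep)
      ... | _ , _ , _ , inj₁ forest = forest
      ... | rs , sep , _ , inj₂ lt = contradiction (ℕₚ.≤-trans lt (ℕₚ.+-monoˡ-≤ (length X)
              (Dual.separated-connected X X-connects sep))) (ℕₚ.<⇒≱ (s≤s (subst (suc (length X) ≤_) (sym |reps|) |X|<k)))
        where
        |X|<k : suc (length X) ≤ k
        |X|<k = ℕₚ.+-cancelˡ-≤ (suc (length T)) _ _ (begin
          suc (length T) ℕ.+ suc (length X) ≡⟨ ℕₚ.+-suc (suc (length T)) (length X) ⟩
          2 ℕ.+ (length T ℕ.+ length X)     ≡⟨ cong (2 ℕ.+_) |T|+|X| ⟩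
          2 ℕ.+ nE                          ≡⟨ ℕₚ.+-comm 2 nE ⟩
          nE ℕ.+ 2                          ≡⟨ sym euler ⟩
          nV ℕ.+ k                          ≤⟨ ℕₚ.+-monoˡ-≤ k nV≤ ⟩
          suc (length T) ℕ.+ k              ∎)
          where open ℕₚ.≤-Reasoning

      pot = Dual.forest-potential X X-forest (λ e → c (e , false))
      p : Dart H → ℤ
      p = proj₁ pot
      p-inv : ∀ {x y} → Orbit x y → p x ≡ p y
      p-inv = proj₁ (proj₂ pot)
      p-jump : ∀ e → e ∈ X → p (e , true) ≡ p (e , false) ⊕ c (e , false)
      p-jump = proj₂ (proj₂ pot)

  abstract
    potential : ∀ c → Antisymmetric c → Circulation c →
                ∃ λ (p : Dart H → ℤ) → (∀ d → p (φ′ d) ≡ p d) × (∀ d → p (α′ d) ≡ p d ⊕ c d)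
    potential = tree-cotree

-- Perfect matchings, their heights and the lattice operations

bit : Bool → ℤ
bit true  = 1ℤ
bit false = 0ℤ

sign : Bool → ℤ
sign true  = 1ℤ
sign false = -1ℤ

consBool : ∀ {n} → Bool → (Fin n → Bool) → Fin (suc n) → Bool
consBool b f zero    = b
consBool b f (suc i) = f i

allSubsets : ∀ n → List (Fin n → Bool)
allSubsets zero = (λ ()) ∷ []
allSubsets (suc n) = L.cartesianProductWith consBool (true ∷ false ∷ []) (allSubsets n)

allSubsets-complete : ∀ n (f : Fin n → Bool) → ∃ λ g → g ∈ allSubsets n × (∀ i → g i ≡ f i)
allSubsets-complete zero f = (λ ()) , here refl , λ ()
allSubsets-complete (suc n) f with allSubsets-complete n (f ∘ suc)
... | g , g∈ , eq = _ , ∈-cartesianProductWith⁺ consBool (bool (f zero)) g∈ , λ { zero → refl ; (suc i) → eq i }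
  where
  bool : ∀ b → b ∈ true ∷ false ∷ []
  bool true  = here refl
  bool false = there (here refl)

≤0-or-≥0 : ∀ x → x ≼ 0ℤ ⊎ 0ℤ ≼ x
≤0-or-≥0 x = ℤₚ.≤-total x 0ℤ

antisym-zero : ∀ {x} → x ≼ 0ℤ → 0ℤ ≼ x → x ≡ 0ℤ
antisym-zero = ℤₚ.≤-antisym

module Matchings (H : Map) (plane : IsPlaneMap H) (outer : Dart H)
                 (S : EdgeSet H) (bip : Bipartite H S) where
  open PlaneMap H plane public
  open Circulations H plane

  PM : Set
  PM = ∃ (IsPMG H S)

  infixl 15 _!_
  _!_ : PM → Fin nE → Bool
  M ! e = proj₁ M e

  _≐_ : PM → PM → Set
  M ≐ N = ∀ e → M ! e ≡ N ! e

  pm⊆S : ∀ (M : PM) e → M ! e ≡ true → S e ≡ true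
  pm⊆S M = proj₁ (proj₂ M)

  mate : PM → Fin nV → Fin nE
  mate M v = proj₁ (proj₂ (proj₂ M) v tt)

  mate-in : ∀ M v → M ! mate M v ≡ true
  mate-in M v = proj₁ (proj₂ (proj₂ (proj₂ M) v tt))

  mate-inc : ∀ M v → Inc H (mate M v) v
  mate-inc M v = proj₁ (proj₂ (proj₂ (proj₂ (proj₂ M) v tt)))

  mate-unique : ∀ M v e → M ! e ≡ true → Inc H e v → e ≡ mate M v
  mate-unique M v = proj₂ (proj₂ (proj₂ (proj₂ (proj₂ M) v tt)))

  not-mate : ∀ M v e → Inc H e v → e ≢ mate M v → M ! e ≡ false
  not-mate M v e inc ne with M ! e in eq
  ... | true  = contradiction (mate-unique M v e eq inc) ne
  ... | false = refl

  inc-dart : ∀ {e v} → Inc H e v → ∃ λ b → end e b ≡ v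
  inc-dart (inj₁ h) = false , h
  inc-dart (inj₂ h) = true , h

  dart-inc : ∀ {e b v} → end e b ≡ v → Inc H e v
  dart-inc {b = false} = inj₁
  dart-inc {b = true}  = inj₂

  sgn : Fin nV → ℤ
  sgn v = sign (proj₁ bip v)

  sgn-flip : ∀ e b → S e ≡ true → sgn (end e (not b)) ≡ - sgn (end e b)
  sgn-flip e b s with proj₁ bip (end e b) in eq | proj₁ bip (end e (not b)) in eq'
  ... | true  | false = refl
  ... | false | true  = refl
  ... | true  | true  = contradiction (trans eq (sym eq')) (differ b)
    where
    differ : ∀ b → proj₁ bip (end e b) ≢ proj₁ bip (end e (not b))
    differ false = proj₂ bip e s
    differ true  = proj₂ bip e s ∘ sym
  ... | false | false = contradiction (trans eq (sym eq')) (differ b)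
    where
    differ : ∀ b → proj₁ bip (end e b) ≢ proj₁ bip (end e (not b))
    differ false = proj₂ bip e s
    differ true  = proj₂ bip e s ∘ sym

  -- The colour of the tail orients the edges: opposite colours at the two ends make the function
  -- antisymmetric, and since both matchings cover each vertex once, its values at a vertex add up
  -- to zero.
  step : PM → PM → Dart H → ℤ
  step M N (e , b) = sgn (end e b) ⊛ (bit (N ! e) ⊕ - bit (M ! e))

  step-same : ∀ M N d → M ! proj₁ d ≡ N ! proj₁ d → step M N d ≡ 0ℤ
  step-same M N (e , b) h rewrite h = ar (sgn (end e b)) (bit (N ! e))
    where
    ar : ∀ a x → a ⊛ (x ⊕ - x) ≡ 0ℤ
    ar = solve-∀

  step-cong : ∀ M N N' d → N ! proj₁ d ≡ N' ! proj₁ d → step M N d ≡ step M N' d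
  step-cong M N N' (e , b) h rewrite h = refl

  step-trans : ∀ M N P d → step M N d ⊕ step N P d ≡ step M P d
  step-trans M N P (e , b) = ar (sgn (end e b)) (bit (M ! e)) (bit (N ! e)) (bit (P ! e))
    where
    ar : ∀ s m n p → s ⊛ (n ⊕ - m) ⊕ s ⊛ (p ⊕ - n) ≡ s ⊛ (p ⊕ - m)
    ar = solve-∀

  step-zero : ∀ M N d → step M N d ≡ 0ℤ → M ! proj₁ d ≡ N ! proj₁ d
  step-zero M N (e , b) h with proj₁ bip (end e b) | M ! e | N ! e
  ... | _     | true  | true  = refl
  ... | _     | false | false = refl
  step-zero M N (e , b) () | true  | true  | false
  step-zero M N (e , b) () | true  | false | true
  step-zero M N (e , b) () | false | true  | false
  step-zero M N (e , b) () | false | false | true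

  private
    not-in : ∀ (M : PM) e → S e ≡ false → M ! e ≡ false
    not-in M e s with M ! e in eq
    ... | false = refl
    ... | true = trans (sym (pm⊆S M e eq)) s

    step-anti : ∀ M N → Antisymmetric (step M N)
    step-anti M N (e , b) with S e in eq
    ... | true rewrite sgn-flip e b eq = ar (sgn (end e b)) (bit (N ! e) ⊕ - bit (M ! e))
      where
      ar : ∀ a x → - a ⊛ x ≡ - (a ⊛ x)
      ar = solve-∀
    ... | false rewrite not-in M e eq | not-in N e eq = ar (sgn (end e (not b))) (sgn (end e b))
      where
      ar : ∀ a b → a ⊛ (0ℤ ⊕ - 0ℤ) ≡ - (b ⊛ (0ℤ ⊕ - 0ℤ))
      ar = solve-∀

    -- Every vertex is the tail of exactly one matched dart. The value is thus the same for all
    -- matchings, which makes `step` a circulation.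
    matching-sum : ∀ (M : PM) (B : Fin nV → ℤ) → ΣD (λ d → B (tl d) ⊛ bit (M ! proj₁ d)) ≡ sum B
    matching-sum M B = begin
      ΣD (λ d → B (tl d) ⊛ bit (M ! proj₁ d))
        ≡⟨ ΣD-cong (λ d → sym (sum-single (tl d) (λ v → B v ⊛ bit (M ! proj₁ d)))) ⟩
      ΣD (λ d → sum (λ v → ind (v F.≟ tl d) (B v ⊛ bit (M ! proj₁ d))))
        ≡⟨ ΣD-sum (λ d v → ind (v F.≟ tl d) (B v ⊛ bit (M ! proj₁ d))) ⟩
      sum (λ v → ΣD (λ d → ind (v F.≟ tl d) (B v ⊛ bit (M ! proj₁ d))))
        ≡⟨ sum-cong-≗ (λ v → trans (ΣD-cong (at v)) (ΣD-single (m v) (λ _ → B v))) ⟩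
      sum B ∎
      where
      open ≡-Reasoning
      m : Fin nV → Dart H
      m v = mate M v , proj₁ (inc-dart (mate-inc M v))
      m-tail : ∀ v → tl (m v) ≡ v
      m-tail v = proj₂ (inc-dart (mate-inc M v))
      at : ∀ v d → ind (v F.≟ tl d) (B v ⊛ bit (M ! proj₁ d)) ≡ ind (d ≟D m v) (B v)
      at v d = by (d ≟D m v) (v F.≟ tl d)
        where
        by : Dec (d ≡ m v) → Dec (v ≡ tl d) → ind (v F.≟ tl d) (B v ⊛ bit (M ! proj₁ d)) ≡ ind (d ≟D m v) (B v)
        by (yes h) _ = trans (ind-yes (v F.≟ tl d) (sym (trans (cong tl h) (m-tail v))))
          (trans (trans (cong (λ z → B v ⊛ bit z) (trans (cong (λ z → M ! proj₁ z) h) (mate-in M v))) (ℤₚ.*-identityʳ (B v)))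
                 (sym (ind-yes (d ≟D m v) h)))
        by (no ne) (no ¬h) = trans (ind-no (v F.≟ tl d) ¬h) (sym (ind-no (d ≟D m v) ne))
        by (no ne) (yes h) = trans (ind-yes (v F.≟ tl d) h)
          (trans (trans (cong (λ z → B v ⊛ bit z) (not-mate M v (proj₁ d) (dart-inc (sym h))
                            (λ eq → ne (same-dart eq (trans (sym h) (sym (m-tail v)))))))
                        (ℤₚ.*-zeroʳ (B v))) (sym (ind-no (d ≟D m v) ne)))

    step-circ : ∀ M N → Circulation (step M N)
    step-circ M N A = begin
      ΣD (λ d → A (tl d) ⊛ step M N d)
        ≡⟨ ΣD-cong (λ (e , b) → ar (A (end e b)) (sgn (end e b)) (bit (N ! e)) (bit (M ! e))) ⟩
      ΣD (λ d → B (tl d) ⊛ bit (N ! proj₁ d) ⊕ - (B (tl d) ⊛ bit (M ! proj₁ d)))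
        ≡⟨ ΣD-+ (λ d → B (tl d) ⊛ bit (N ! proj₁ d)) (λ d → - (B (tl d) ⊛ bit (M ! proj₁ d))) ⟩
      ΣD (λ d → B (tl d) ⊛ bit (N ! proj₁ d)) ⊕ ΣD (λ d → - (B (tl d) ⊛ bit (M ! proj₁ d)))
        ≡⟨ cong₂ _⊕_ (matching-sum N B) (trans (ΣD-neg (λ d → B (tl d) ⊛ bit (M ! proj₁ d)))
                                               (cong -_ (matching-sum M B))) ⟩
      sum B ⊕ - sum B
        ≡⟨ ℤₚ.+-inverseʳ (sum B) ⟩
      0ℤ ∎
      where
      open ≡-Reasoning
      B : Fin nV → ℤ
      B v = A v ⊛ sgn v
      ar : ∀ a s n m → a ⊛ (s ⊛ (n ⊕ - m)) ≡ (a ⊛ s) ⊛ n ⊕ - ((a ⊛ s) ⊛ m)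
      ar = solve-∀

  IsHeight : PM → PM → (Dart H → ℤ) → Set
  IsHeight M N q = (∀ d → q (φ′ d) ≡ q d) × q outer ≡ 0ℤ × (∀ d → q (α′ d) ≡ q d ⊕ step M N d)

  abstract
    height : ∀ M N → ∃ (IsHeight M N)
    height M N = (λ d → p d ⊕ - p outer) , (λ d → cong (_⊕ - p outer) (proj₁ (proj₂ pot) d)) ,
      ℤₚ.+-inverseʳ (p outer) ,
      λ d → trans (cong (_⊕ - p outer) (proj₂ (proj₂ pot) d)) (ar (p d) (step M N d) (p outer))
      where
      pot : ∃ λ (p : Dart H → ℤ) → (∀ d → p (φ′ d) ≡ p d) × (∀ d → p (α′ d) ≡ p d ⊕ step M N d)
      pot = potential (step M N) (step-anti M N) (step-circ M N)
      p : Dart H → ℤ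
      p = proj₁ pot
      ar : ∀ a c o → (a ⊕ c) ⊕ - o ≡ (a ⊕ - o) ⊕ c
      ar = solve-∀

  -- The height of N over M: crossing an edge of N ∖ M or M ∖ N changes it by one.
  diff : PM → PM → Dart H → ℤ
  diff M N = proj₁ (height M N)

  diff-φ : ∀ M N d → diff M N (φ′ d) ≡ diff M N d
  diff-φ M N = proj₁ (proj₂ (height M N))

  diff-outer : ∀ M N → diff M N outer ≡ 0ℤ
  diff-outer M N = proj₁ (proj₂ (proj₂ (height M N)))

  diff-jump : ∀ M N d → diff M N (α′ d) ≡ diff M N d ⊕ step M N d
  diff-jump M N = proj₂ (proj₂ (proj₂ (height M N)))

  -- The difference of two heights changes neither along faces nor across edges, so it is constant,
  -- and it vanishes at `outer`.
  diff-unique : ∀ M N q → IsHeight M N q → ∀ d → diff M N d ≡ q d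
  diff-unique M N q (q-φ , q-o , q-jump) d = trans (ar (diff M N d) (q d)) (trans (cong (_⊕ q d) zero-at) (ℤₚ.+-identityˡ _))
    where
    ar : ∀ a b → a ≡ (a ⊕ - b) ⊕ b
    ar = solve-∀
    ar' : ∀ a b c → (a ⊕ c) ⊕ - (b ⊕ c) ≡ a ⊕ - b
    ar' = solve-∀
    zero-at : diff M N d ⊕ - q d ≡ 0ℤ
    zero-at = trans (spread-const (λ x → diff M N x ⊕ - q x)
      (λ x → cong₂ (λ a b → a ⊕ - b) (diff-φ M N x) (q-φ x))
      (λ x → trans (cong₂ (λ a b → a ⊕ - b) (diff-jump M N x) (q-jump x)) (ar' (diff M N x) (q x) (step M N x)))
      d outer) (cong₂ (λ a b → a ⊕ - b) (diff-outer M N) q-o)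

  diff-trans : ∀ M N P d → diff M P d ≡ diff M N d ⊕ diff N P d
  diff-trans M N P = diff-unique M P (λ d → diff M N d ⊕ diff N P d)
    ( (λ d → cong₂ _⊕_ (diff-φ M N d) (diff-φ N P d))
    , cong₂ _⊕_ (diff-outer M N) (diff-outer N P)
    , λ d → trans (cong₂ _⊕_ (diff-jump M N d) (diff-jump N P d))
              (trans (ar (diff M N d) (step M N d) (diff N P d) (step N P d))
                (cong (diff M N d ⊕ diff N P d ⊕_) (step-trans M N P d))) )
    where
    ar : ∀ a b c d → (a ⊕ b) ⊕ (c ⊕ d) ≡ (a ⊕ c) ⊕ (b ⊕ d)
    ar = solve-∀

  diff-≐ : ∀ M N → M ≐ N → ∀ d → diff M N d ≡ 0ℤ
  diff-≐ M N h = diff-unique M N (λ _ → 0ℤ)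
    ((λ _ → refl) , refl , λ d → sym (trans (ℤₚ.+-identityˡ _) (step-same M N d (h (proj₁ d)))))

  diff-self : ∀ M d → diff M M d ≡ 0ℤ
  diff-self M = diff-≐ M M (λ _ → refl)

  diff-inverse : ∀ M N d → diff N M d ≡ - diff M N d
  diff-inverse M N d = trans (ar (diff N M d) (diff M N d))
    (trans (cong (_⊕ - diff M N d) (trans (sym (diff-trans N M N d)) (diff-self N d))) (ℤₚ.+-identityˡ _))
    where
    ar : ∀ a b → a ≡ (a ⊕ b) ⊕ - b
    ar = solve-∀

  level⇒same : ∀ M N d → diff M N (α′ d) ≡ diff M N d → M ! proj₁ d ≡ N ! proj₁ d
  level⇒same M N d h = step-zero M N d (trans (ar (diff M N d) (step M N d))
    (trans (cong (_⊕ - diff M N d) (trans (sym (diff-jump M N d)) h)) (ℤₚ.+-inverseʳ (diff M N d))))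
    where
    ar : ∀ a b → b ≡ (a ⊕ b) ⊕ - a
    ar = solve-∀

  same⇒level : ∀ M N d → M ! proj₁ d ≡ N ! proj₁ d → diff M N (α′ d) ≡ diff M N d
  same⇒level M N d h = trans (diff-jump M N d) (trans (cong (diff M N d ⊕_) (step-same M N d h)) (ℤₚ.+-identityʳ _))

  zero⇒≐ : ∀ M N → (∀ d → diff M N d ≡ 0ℤ) → M ≐ N
  zero⇒≐ M N h e = level⇒same M N (e , false) (trans (h _) (sym (h _)))

  diff-σ : ∀ M N d → diff M N (σ d) ≡ diff M N (α′ d)
  diff-σ M N d = trans (cong (diff M N) (sym (φα d))) (diff-φ M N (α′ d))

  x≢x+1 : ∀ {x} → x ≢ x ⊕ 1ℤ
  x≢x+1 {x} h = contradiction (trans (ℤₚ.+-identityʳ x) h) (λ e → contradiction (+-cancelˡ x 0ℤ 1ℤ e) λ ())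

  -- Rotating from `u`, the value stays at `g u ⊕ 1ℤ` until `w` is passed, and the jump down there
  -- restores `g u`.
  one-up-one-down : ∀ (g : Dart H → ℤ) u w → tl w ≡ tl u → u ≢ w →
    g (σ u) ≡ g u ⊕ 1ℤ → g w ≡ g (σ w) ⊕ 1ℤ →
    (∀ d → tl d ≡ tl u → d ≢ u → d ≢ w → g (σ d) ≡ g d) →
    ∀ d → tl d ≡ tl u → g d ≡ g u ⊎ g d ≡ g u ⊕ 1ℤ
  one-up-one-down g u w tw u≢w up down const d td =
    rotate (λ d → g d ≡ g u ⊎ g d ≡ g u ⊕ 1ℤ) around u d refl td (inj₁ refl)
    where
    +1-inj : ∀ {x y} → x ⊕ 1ℤ ≡ y ⊕ 1ℤ → x ≡ y
    +1-inj {x} {y} = +-cancelʳ 1ℤ x y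
    top : g w ≡ g u ⊕ 1ℤ
    top with σ-orbit (σ u) w (trans (tail-σ u) (sym tw))
    ... | n , eq = go n (σ u) eq (tail-σ u) up
      where
      go : ∀ n y → iter σ n y ≡ w → tl y ≡ tl u → g y ≡ g u ⊕ 1ℤ → g w ≡ g u ⊕ 1ℤ
      go zero y refl _ h = h
      go (suc n) y eq t h with y ≟D u | y ≟D w
      -- Returning to `u` before meeting `w` would give `g u ≡ g u ⊕ 1ℤ`.
      ... | yes refl | _ = contradiction h x≢x+1
      ... | no _ | yes refl = h
      ... | no y≢u | no y≢w = go n (σ y) (trans (iter-comm σ n y) eq) (trans (tail-σ y) t)
                                (trans (const y t y≢u y≢w) h)
    around : ∀ y → tl y ≡ tl u → g y ≡ g u ⊎ g y ≡ g u ⊕ 1ℤ → g (σ y) ≡ g u ⊎ g (σ y) ≡ g u ⊕ 1ℤ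
    around y t h with y ≟D u | y ≟D w
    ... | yes refl | _ = inj₂ up
    ... | no _ | yes refl = inj₁ (+1-inj (trans (sym down) top))
    ... | no y≢u | no y≢w = subst (λ z → z ≡ g u ⊎ z ≡ g u ⊕ 1ℤ) (sym (const y t y≢u y≢w)) h

  -- Around `v` the height can jump only across the two mates of `v`; these lie at the same coloured
  -- vertex, one in `M` and one in `N`, so one jump is up and the other down.
  two-valued : ∀ M N v → ∃ λ a → ∀ d → tl d ≡ v → diff M N d ≡ a ⊎ diff M N d ≡ a ⊕ 1ℤ
  two-valued M N v = go (mate M v F.≟ mate N v)
    where
    g : Dart H → ℤ
    g = diff M N
    m n : Dart H
    m = mate M v , proj₁ (inc-dart (mate-inc M v))
    n = mate N v , proj₁ (inc-dart (mate-inc N v))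
    m-tail : tl m ≡ v
    m-tail = proj₂ (inc-dart (mate-inc M v))
    n-tail : tl n ≡ v
    n-tail = proj₂ (inc-dart (mate-inc N v))
    const : ∀ d → tl d ≡ v → M ! proj₁ d ≡ N ! proj₁ d → g (σ d) ≡ g d
    const d t h = trans (diff-σ M N d) (same⇒level M N d h)
    off : ∀ d → tl d ≡ v → d ≢ m → d ≢ n → M ! proj₁ d ≡ N ! proj₁ d
    off d t d≢m d≢n = trans (not-mate M v (proj₁ d) (dart-inc t) (λ h → d≢m (same-dart h (trans t (sym m-tail)))))
                      (sym (not-mate N v (proj₁ d) (dart-inc t) (λ h → d≢n (same-dart h (trans t (sym n-tail))))))
    jump : ∀ d {x} → step M N d ≡ x → g (σ d) ≡ g d ⊕ x
    jump d h = trans (diff-σ M N d) (trans (diff-jump M N d) (cong (g d ⊕_) h))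
    step-m : mate M v ≢ mate N v → step M N m ≡ sgn v ⊛ -1ℤ
    step-m ne = cong₂ _⊛_ (cong sgn m-tail) (cong₂ (λ x y → bit x ⊕ - bit y)
      (not-mate N v (mate M v) (mate-inc M v) ne) (mate-in M v))
    step-n : mate M v ≢ mate N v → step M N n ≡ sgn v ⊛ 1ℤ
    step-n ne = cong₂ _⊛_ (cong sgn n-tail) (cong₂ (λ x y → bit x ⊕ - bit y)
      (mate-in N v) (not-mate M v (mate N v) (mate-inc N v) (ne ∘ sym)))
    ar : ∀ a → a ≡ a ⊕ -1ℤ ⊕ 1ℤ
    ar = solve-∀
    down : ∀ {x y} → x ≡ y ⊕ -1ℤ → y ≡ x ⊕ 1ℤ
    down {y = y} refl = ar y
    go : Dec (mate M v ≡ mate N v) → _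
    go (yes h) = g m , λ d t → inj₁ (rotate (λ d → g d ≡ g m) (λ d t e → trans (const d t (same d t)) e) m d m-tail t refl)
      where
      same : ∀ d → tl d ≡ v → M ! proj₁ d ≡ N ! proj₁ d
      same d t with proj₁ d F.≟ mate M v
      ... | yes e = trans (trans (cong (proj₁ M) e) (mate-in M v)) (sym (trans (cong (proj₁ N) (trans e h)) (mate-in N v)))
      ... | no ne = trans (not-mate M v (proj₁ d) (dart-inc t) ne) (sym (not-mate N v (proj₁ d) (dart-inc t) (ne ∘ λ e → trans e (sym h))))
    go (no ne) with proj₁ bip v | step-m ne | step-n ne
    ... | true | sm | sn = g n , λ d t → one-up-one-down g n m (trans m-tail (sym n-tail)) (ne ∘ sym ∘ cong proj₁)
            (jump n sn) (down (jump m sm)) (λ d t x y → const d (trans t n-tail) (off d (trans t n-tail) y x)) d (trans t (sym n-tail))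
    ... | false | sm | sn = g m , λ d t → one-up-one-down g m n (trans n-tail (sym m-tail)) (ne ∘ cong proj₁)
            (jump m sm) (down (jump n sn)) (λ d t x y → const d (trans t m-tail) (off d (trans t m-tail) x y)) d (trans t (sym m-tail))

  -- Being a perfect matching is a condition on the edges at each single vertex, so pieces of
  -- different matchings fit together as soon as every vertex sees only one of them. The surgeries
  -- in `splice`, `T` and `M₁` rest on this.
  glue : (J : EdgeSet H) → (∀ v → ∃ λ (N : PM) → ∀ e → Inc H e v → J e ≡ N ! e) → IsPMG H S J
  glue J local = (λ e j → pm⊆S (proj₁ (local (end e false))) e
                     (trans (sym (proj₂ (local (end e false)) e (inj₁ refl))) j))
    , λ v _ → let (N , eq) = local v in mate N v , trans (eq _ (mate-inc N v)) (mate-in N v) , mate-inc N v ,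
        λ e j inc → mate-unique N v e (trans (sym (eq e inc)) j) inc

  -- A matching whose height over M is f (diff M N), provided that f vanishes or is the identity on
  -- either side of 0; joins, meets and medians are of this form.
  splice : ∀ M N (f : ℤ → ℤ) →
    ((∀ x → x ≼ 0ℤ → f x ≡ 0ℤ) ⊎ (∀ x → x ≼ 0ℤ → f x ≡ x)) →
    ((∀ x → 0ℤ ≼ x → f x ≡ 0ℤ) ⊎ (∀ x → 0ℤ ≼ x → f x ≡ x)) →
    ∃ λ (J : PM) → ∀ d → diff M J d ≡ f (diff M N d)
  splice M N f f⁻ f⁺ = J , diff-unique M J (λ d → f (g d))
    ((λ d → cong f (diff-φ M N d)) , trans (cong f (diff-outer M N)) f0 , jump)
    where
    g : Dart H → ℤ
    g = diff M N

    f0 : f 0ℤ ≡ 0ℤ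
    f0 = [ (λ h → h 0ℤ ℤₚ.≤-refl) , (λ h → h 0ℤ ℤₚ.≤-refl) ]′ f⁻

    Local : Fin nV → Set
    Local v = (∀ d → tl d ≡ v → f (g d) ≡ 0ℤ) ⊎ (∀ d → tl d ≡ v → f (g d) ≡ g d)

    -- Two consecutive integers lie on one side of 0, so a single branch of `f` governs all faces
    -- around `v`.
    local : ∀ v → Local v
    local v with two-valued M N v
    ... | a , values with ≤0-or-≥0 (a ⊕ 1ℤ)
    ... | inj₁ a+1≤0 = Sum.map (λ h d t → h (g d) (below d t)) (λ h d t → h (g d) (below d t)) f⁻
      where
      below : ∀ d → tl d ≡ v → g d ≼ 0ℤ
      below d t with values d t
      ... | inj₁ e rewrite e = ℤₚ.≤-trans (ℤₚ.i≤i+j a 1ℤ) a+1≤0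
      ... | inj₂ e rewrite e = a+1≤0
    ... | inj₂ 0≤a+1 with ℤₚ.<-cmp a 0ℤ
    ...   | tri< a<0 _ _ = Sum.map (λ h d t → h (g d) (below d t)) (λ h d t → h (g d) (below d t)) f⁻
      where
      below : ∀ d → tl d ≡ v → g d ≼ 0ℤ
      below d t with values d t
      ... | inj₁ e rewrite e = ℤₚ.<⇒≤ a<0
      ... | inj₂ e rewrite e = subst (_≼ 0ℤ) (ℤₚ.+-comm 1ℤ a) (ℤₚ.i<j⇒suc[i]≤j a<0)
    ...   | tri≈ _ a≡0 _ = Sum.map (λ h d t → h (g d) (above d t)) (λ h d t → h (g d) (above d t)) f⁺
      where
      above : ∀ d → tl d ≡ v → 0ℤ ≼ g d
      above d t with values d t
      ... | inj₁ e rewrite e = ℤₚ.≤-reflexive (sym a≡0)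
      ... | inj₂ e rewrite e = 0≤a+1
    ...   | tri> _ _ 0<a = Sum.map (λ h d t → h (g d) (above d t)) (λ h d t → h (g d) (above d t)) f⁺
      where
      above : ∀ d → tl d ≡ v → 0ℤ ≼ g d
      above d t with values d t
      ... | inj₁ e rewrite e = ℤₚ.<⇒≤ 0<a
      ... | inj₂ e rewrite e = 0≤a+1

    j : EdgeSet H
    j e = if does (f (g (e , false)) ℤₚ.≟ 0ℤ) ∧ does (f (g (e , true)) ℤₚ.≟ 0ℤ) then M ! e else N ! e

    both : ∀ {P : Dart H → Set} e b → P (e , b) → P (e , not b) → P (e , false) × P (e , true)
    both e false p q = p , q
    both e true  p q = q , p

    j-zero : ∀ e b → f (g (e , b)) ≡ 0ℤ → f (g (e , not b)) ≡ 0ℤ → j e ≡ M ! e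
    j-zero e b x y with both {λ d → f (g d) ≡ 0ℤ} e b x y
    ... | p , q rewrite p | q = refl

    j-id : ∀ e b → f (g (e , b)) ≡ g (e , b) → f (g (e , not b)) ≡ g (e , not b) → j e ≡ N ! e
    j-id e b x y with both {λ d → f (g d) ≡ g d} e b x y
    ... | p , q rewrite p | q with g (e , false) ℤₚ.≟ 0ℤ | g (e , true) ℤₚ.≟ 0ℤ
    -- Here `j` chose `M` although `f` is the identity; but zero height on both sides of the edge
    -- means that `M` and `N` agree on it.
    ... | yes z | yes z' = level⇒same M N (e , false) (trans z' (sym z))
    ... | yes z | no _   = refl
    ... | no _  | _      = refl

    far : ∀ {R : ℤ → Set} {v} d → tl d ≡ v → (∀ d → tl d ≡ v → R (g d)) → R (g (α′ d))
    far {R} d t h = subst R (diff-σ M N d) (h (σ d) (trans (tail-σ d) t))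

    J : PM
    J = j , glue j at
      where
      at : ∀ v → ∃ λ (P : PM) → ∀ e → Inc H e v → j e ≡ P ! e
      at v with local v
      ... | inj₁ z = M , λ e inc → let (b , t) = inc-dart inc in
              j-zero e b (z (e , b) t) (far {λ x → f x ≡ 0ℤ} (e , b) t z)
      ... | inj₂ i = N , λ e inc → let (b , t) = inc-dart inc in
              j-id e b (i (e , b) t) (far {λ x → f x ≡ x} (e , b) t i)

    jump : ∀ d → f (g (α′ d)) ≡ f (g d) ⊕ step M J d
    jump d@(e , b) with local (tl d)
    ... | inj₁ z = trans (far {λ x → f x ≡ 0ℤ} d refl z)
            (sym (cong₂ _⊕_ (z d refl) (step-same M J d (sym (j-zero e b (z d refl) (far {λ x → f x ≡ 0ℤ} d refl z))))))
    ... | inj₂ i = begin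
      f (g (α′ d))       ≡⟨ far {λ x → f x ≡ x} d refl i ⟩
      g (α′ d)           ≡⟨ diff-jump M N d ⟩
      g d ⊕ step M N d   ≡⟨ cong₂ _⊕_ (sym (i d refl))
                              (step-cong M N J d (sym (j-id e b (i d refl) (far {λ x → f x ≡ x} d refl i)))) ⟩
      f (g d) ⊕ step M J d ∎
      where open ≡-Reasoning

  abstract
    join : ∀ M N → ∃ λ (J : PM) → ∀ d → diff M J d ≡ diff M N d ℤ.⊔ 0ℤ
    join M N = splice M N (ℤ._⊔ 0ℤ) (inj₁ λ _ → ℤₚ.i≤j⇒i⊔j≡j) (inj₂ λ _ → ℤₚ.i≥j⇒i⊔j≡i)

    meet : ∀ M N → ∃ λ (J : PM) → ∀ d → diff M J d ≡ diff M N d ℤ.⊓ 0ℤ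
    meet M N = splice M N (ℤ._⊓ 0ℤ) (inj₂ λ _ → ℤₚ.i≤j⇒i⊓j≡i) (inj₁ λ _ → ℤₚ.i≥j⇒i⊓j≡j)

  inc? : ∀ e v → Dec (Inc H e v)
  inc? e v = (end e false F.≟ v) ⊎-dec (end e true F.≟ v)

  isPM? : ∀ M → Dec (IsPMG H S M)
  isPM? M = all? (λ e → (M e Bₚ.≟ true) →-dec (S e Bₚ.≟ true)) ×-dec
    all? (λ v → map′ (λ x _ → x) (λ f → f tt) (any? (λ e → (M e Bₚ.≟ true) ×-dec (inc? e v ×-dec
      all? (λ e' → (M e' Bₚ.≟ true) →-dec (inc? e' v →-dec (e' F.≟ e)))))))

  isPM-≗ : ∀ {M N} → (∀ e → M e ≡ N e) → IsPMG H S M → IsPMG H S N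
  isPM-≗ {M} {N} h p = glue N (λ v → (M , p) , λ e _ → sym (h e))

  private
    collect : ∀ (L : List (EdgeSet H)) → ∃ λ (Ms : List PM) → ∀ {M} → M ∈ L → IsPMG H S M → Any (λ N → ∀ e → N ! e ≡ M e) Ms
    collect [] = [] , λ ()
    collect (M ∷ L) with collect L | isPM? M
    ... | Ms , h | yes p = (M , p) ∷ Ms , λ { (here refl) _ → here (λ _ → refl) ; (there i) q → there (h i q) }
    ... | Ms , h | no ¬p = Ms , λ { (here refl) q → contradiction q ¬p ; (there i) q → h i q }

  abstract
    matchings : ∃ λ (Ms : List PM) → ∀ N → Any (_≐ N) Ms
    matchings with collect (allSubsets nE)
    ... | Ms , h = Ms , λ (N , p) → let (g , g∈ , eq) = allSubsets-complete nE N in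
      Any.map (λ k e → trans (k e) (eq e)) (h g∈ (isPM-≗ (sym ∘ eq) p))

  private
    -- The meet of `m` with `N` lies below `N` and below `m`, hence still below all matchings
    -- treated before.
    least : PM → ∀ (L : List PM) → ∃ λ m → All (λ N → ∀ d → 0ℤ ≼ diff m N d) L
    least B [] = B , []
    least B (N ∷ L) with least B L
    ... | m , h with meet m N
    ... | K , eq = K , below-N ∷ All.map (λ {P} h d → subst (0ℤ ≼_) (sym (diff-trans K m P d)) (ℤₚ.+-mono-≤ (below-m d) (h d))) h
      where
      below-m : ∀ d → 0ℤ ≼ diff K m d
      below-m d = subst (0ℤ ≼_) (sym (trans (diff-inverse m K d) (cong -_ (eq d)))) (ℤₚ.neg-mono-≤ (ℤₚ.i⊓j≤j (diff m N d) 0ℤ))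
      below-N : ∀ d → 0ℤ ≼ diff K N d
      below-N d = subst (0ℤ ≼_) (trans (ℤₚ.+-comm (diff m N d) (- (diff m N d ℤ.⊓ 0ℤ))) (sym (trans (diff-trans K m N d)
        (cong (_⊕ diff m N d) (trans (diff-inverse m K d) (cong -_ (eq d)))))))
        (ℤₚ.i≤j⇒0≤j-i (ℤₚ.i⊓j≤i (diff m N d) 0ℤ))

    greatest : PM → ∀ (L : List PM) → ∃ λ m → All (λ N → ∀ d → 0ℤ ≼ diff N m d) L
    greatest B [] = B , []
    greatest B (N ∷ L) with greatest B L
    ... | m , h with join m N
    ... | K , eq = K , above-N ∷ All.map (λ {P} h d → subst (0ℤ ≼_) (sym (diff-trans P m K d)) (ℤₚ.+-mono-≤ (h d) (above-m d))) h
      where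
      above-m : ∀ d → 0ℤ ≼ diff m K d
      above-m d = subst (0ℤ ≼_) (sym (eq d)) (ℤₚ.i≤j⊔i (diff m N d) 0ℤ)
      above-N : ∀ d → 0ℤ ≼ diff N K d
      above-N d = subst (0ℤ ≼_) (trans (ℤₚ.+-comm (diff m N d ℤ.⊔ 0ℤ) (- diff m N d)) (sym (trans (diff-trans N m K d)
        (cong₂ _⊕_ (diff-inverse m N d) (eq d)))))
        (ℤₚ.i≤j⇒0≤j-i (ℤₚ.i≤i⊔j (diff m N d) 0ℤ))

  minimum : PM → ∃ λ m → ∀ N d → 0ℤ ≼ diff m N d
  minimum B with least B (proj₁ matchings)
  ... | m , h = m , λ N d → pick h (proj₂ matchings N) d
    where
    pick : ∀ {N L} → All (λ N → ∀ d → 0ℤ ≼ diff m N d) L → Any (_≐ N) L → ∀ d → 0ℤ ≼ diff m N d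
    pick {N} (h ∷ _) (here {P} eq) d = subst (0ℤ ≼_) (sym (trans (diff-trans m P N d)
      (trans (cong (diff m P d ⊕_) (diff-≐ P N eq d)) (ℤₚ.+-identityʳ _)))) (h d)
    pick (_ ∷ h) (there i) d = pick h i d

  maximum : PM → ∃ λ m → ∀ N d → 0ℤ ≼ diff N m d
  maximum B with greatest B (proj₁ matchings)
  ... | m , h = m , λ N d → pick h (proj₂ matchings N) d
    where
    pick : ∀ {N L} → All (λ N → ∀ d → 0ℤ ≼ diff N m d) L → Any (_≐ N) L → ∀ d → 0ℤ ≼ diff N m d
    pick {N} (h ∷ _) (here {P} eq) d = subst (0ℤ ≼_) (sym (trans (diff-trans N P m d)
      (trans (cong (_⊕ diff P m d) (diff-≐ N P (sym ∘ eq) d)) (ℤₚ.+-identityˡ _)))) (h d)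
    pick (_ ∷ h) (there i) d = pick h i d

  abstract
    allowed? : ∀ e → Dec (Allowed H S e)
    allowed? e = map′ (λ i → let (M , h) = Any.satisfied i in proj₁ M , proj₂ M , h)
      (λ (N , p , h) → Any.map (λ k → trans (k e) h) (proj₂ matchings (N , p)))
      (Any.any? (λ M → M ! e Bₚ.≟ true) (proj₁ matchings))

-- Flips of faces and the metric of the resonance graph

nsum-mono : ∀ {A : Set} (F G : A → ℕ) → (∀ x → F x ≤ G x) → ∀ xs → nsum (L.map F xs) ≤ nsum (L.map G xs)
nsum-mono F G h [] = z≤n
nsum-mono F G h (x ∷ xs) = ℕₚ.+-mono-≤ (h x) (nsum-mono F G h xs)

nsum-cong : ∀ {A : Set} (F G : A → ℕ) → (∀ x → F x ≡ G x) → ∀ xs → nsum (L.map F xs) ≡ nsum (L.map G xs)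
nsum-cong F G h [] = refl
nsum-cong F G h (x ∷ xs) = cong₂ ℕ._+_ (h x) (nsum-cong F G h xs)

nsum-+ : ∀ {A : Set} (F G : A → ℕ) xs → nsum (L.map (λ x → F x ℕ.+ G x) xs) ≡ nsum (L.map F xs) ℕ.+ nsum (L.map G xs)
nsum-+ F G [] = refl
nsum-+ F G (x ∷ xs) = trans (cong (F x ℕ.+ G x ℕ.+_) (nsum-+ F G xs)) (ar (F x) (G x) _ _)
  where
  ar : ∀ a b c d → (a ℕ.+ b) ℕ.+ (c ℕ.+ d) ≡ (a ℕ.+ c) ℕ.+ (b ℕ.+ d)
  ar = ℕ-solve-∀

nsum-zero : ∀ {A : Set} (F : A → ℕ) {xs} → All (λ x → F x ≡ 0) xs → nsum (L.map F xs) ≡ 0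
nsum-zero F [] = refl
nsum-zero F (h ∷ hs) = cong₂ ℕ._+_ h (nsum-zero F hs)

nsum-swap : ∀ {A B : Set} (F : A → B → ℕ) xs ys →
            nsum (L.map (λ x → nsum (L.map (F x) ys)) xs) ≡ nsum (L.map (λ y → nsum (L.map (λ x → F x y) xs)) ys)
nsum-swap F [] ys = sym (nsum-zero (λ _ → 0) (All.universal (λ _ → refl) ys))
nsum-swap F (x ∷ xs) ys = trans (cong (nsum (L.map (F x) ys) ℕ.+_) (nsum-swap F xs ys))
  (sym (nsum-+ (F x) (λ y → nsum (L.map (λ x → F x y) xs)) ys))

xor-differ : ∀ {a b} → a ≢ b → a xor b ≡ true
xor-differ {true}  {true}  h = contradiction refl h
xor-differ {true}  {false} h = refl
xor-differ {false} {true}  h = refl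
xor-differ {false} {false} h = contradiction refl h

xor-same : ∀ {a b} → a xor b ≡ true → a ≢ b
xor-same {true}  {false} _ ()
xor-same {false} {true}  _ ()

sep-reps : ∀ {A : Set} {R : A → A → Set} → IsEquivalence R → Decidable R → ∀ (xs : List A) →
           ∃ λ ys → AllPairs (λ a b → ¬ R a b) ys × (∀ {x} → x ∈ xs → Any (R x) ys)
sep-reps R-equiv _R?_ [] = [] , [] , λ ()
sep-reps R-equiv _R?_ (x ∷ xs) with sep-reps R-equiv _R?_ xs
... | ys , sep , cover with Any.any? (x R?_) ys
... | yes a = ys , sep , λ { (here refl) → a ; (there i) → cover i }
... | no ¬a = x ∷ ys , Allₚ.¬Any⇒All¬ ys ¬a ∷ sep ,
      λ { (here refl) → here (IsEquivalence.refl R-equiv) ; (there i) → there (cover i) }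

module Flips (H : Map) (plane : IsPlaneMap H) (outer : Dart H)
             (S : EdgeSet H) (bip : Bipartite H S) where
  open Matchings H plane outer S bip public

  E : Fin nE → Set
  E = GE H S

  E? : ∀ e → Dec (E e)
  E? e = S e Bₚ.≟ true

  SameFace : Dart H → Dart H → Set
  SameFace = FaceRel H E

  face? : ∀ x y → Dec (SameFace x y)
  face? = faceRel? E?

  allowed⊆E : ∀ e → Allowed H S e → E e
  allowed⊆E e (M , p , h) = proj₁ p e h

  in⇒allowed : ∀ (M : PM) e → M ! e ≡ true → Allowed H S e
  in⇒allowed M e h = proj₁ M , proj₂ M , h

  sameFace⇒allowed : ∀ {x y} → SameFace x y → FaceRel H (Allowed H S) x y
  sameFace⇒allowed = faceRel-mono allowed⊆E

  not-allowed : ∀ (M : PM) e → ¬ Allowed H S e → M ! e ≡ false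
  not-allowed M e ¬a with M ! e in eq
  ... | false = refl
  ... | true = contradiction (in⇒allowed M e eq) ¬a

  -- A forbidden edge lies in neither matching, so no height jumps across it: heights live on the
  -- regions of G minus its forbidden edges.
  diff-allowed : ∀ M N {x y} → FaceRel H (Allowed H S) x y → diff M N x ≡ diff M N y
  diff-allowed M N f-refl = refl
  diff-allowed M N (f-φ {d}) = sym (diff-φ M N d)
  diff-allowed M N (f-α {d} ¬a) = sym (same⇒level M N d
    (trans (not-allowed M (proj₁ d) ¬a) (sym (not-allowed N (proj₁ d) ¬a))))
  diff-allowed M N (f-sym r) = sym (diff-allowed M N r)
  diff-allowed M N (f-trans r s) = trans (diff-allowed M N r) (diff-allowed M N s)

  diff-face : ∀ M N {x y} → SameFace x y → diff M N x ≡ diff M N y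
  diff-face M N = diff-allowed M N ∘ sameFace⇒allowed

  δ : Dart H → Dart H → ℤ
  δ f y = ind (face? f y) 1ℤ

  δ-in : ∀ {f y} → SameFace f y → δ f y ≡ 1ℤ
  δ-in {f} {y} = ind-yes (face? f y)

  δ-out : ∀ {f y} → ¬ SameFace f y → δ f y ≡ 0ℤ
  δ-out {f} {y} = ind-no (face? f y)

  δ-cong : ∀ f {x y} → SameFace x y → δ f x ≡ δ f y
  δ-cong f {x} {y} r = ind-⇔ (face? f x) (face? f y) (λ s → f-trans s r) (λ s → f-trans s (f-sym r))

  periph? : ∀ f e → Dec (Periph H E f e)
  periph? f e with E? e | face? f (e , false) | face? f (e , true)
  ... | no ¬s | _     | _     = no (¬s ∘ proj₁)
  ... | yes s | yes r | _     = yes (s , false , r)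
  ... | yes s | no _  | yes r = yes (s , true , r)
  ... | yes s | no ¬r | no ¬r' = no λ { (_ , false , r) → ¬r r ; (_ , true , r) → ¬r' r }

  off-periph : ∀ f d → ¬ Periph H E f (proj₁ d) → δ f (α′ d) ≡ δ f d
  off-periph f (e , b) ¬p with E? e
  ... | no ¬s = sym (δ-cong f (f-α ¬s))
  ... | yes s = trans (δ-out (λ r → ¬p (s , not b , r))) (sym (δ-out (λ r → ¬p (s , b , r))))

  Separating : Dart H → Fin nE → Set
  Separating f e = δ f (e , false) ≢ δ f (e , true)

  Flippable : Dart H → Set
  Flippable f = Finite H S outer f × IsCycle H (Periph H E f) × (∀ e → Periph H E f e → Separating f e)

  Unit : ℤ → Set
  Unit ε = ε ≡ 1ℤ ⊎ ε ≡ -1ℤ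

  Flip : Dart H → PM → PM → Set
  Flip f M N = ∃ λ ε → Unit ε × ∀ y → diff M N y ≡ ε ⊛ δ f y

  edge-level : ∀ {A : Set} (g : Dart H → A) e b → g (e , true) ≡ g (e , false) → g (e , not b) ≡ g (e , b)
  edge-level g e false h = h
  edge-level g e true  h = sym h

  level-edge : ∀ {A : Set} (g : Dart H → A) e b → g (e , not b) ≡ g (e , b) → g (e , true) ≡ g (e , false)
  level-edge g e false h = h
  level-edge g e true  h = sym h

  -- A function on faces that is constant across one edge of a cycle and across all edges off the
  -- cycle is constant, because its jumps around each vertex cancel.
  cycle-constant : ∀ {A : Set} (g : Dart H → A) (P : Fin nE → Set) → (∀ e → Dec (P e)) → IsCycle H P →
    (∀ d → g (φ′ d) ≡ g d) → (∀ e → ¬ P e → g (e , true) ≡ g (e , false)) →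
    ∀ e₀ → P e₀ → g (e₀ , true) ≡ g (e₀ , false) → ∀ x y → g x ≡ g y
  cycle-constant g P P? (_ , vertex , conn) g-φ off e₀ p₀ h₀ =
    spread-const g g-φ (λ (e , b) → edge-level g e b (all e))
    where
    Level : Fin nE → Set
    Level e = g (e , true) ≡ g (e , false)

    g-σ : ∀ e b → Level e → g (σ (e , b)) ≡ g (e , b)
    g-σ e b l = trans (cong g (sym (φα (e , b)))) (trans (g-φ (e , not b)) (edge-level g e b l))

    at-vertex : ∀ {v e e'} → P e → P e' → Inc H e v → Inc H e' v → Level e → Level e'
    at-vertex {v} {e} {e'} p p' i i' l with e F.≟ e'
    ... | yes refl = l
    ... | no ne with vertex v
    ... | inj₁ none = contradiction i (none e p)
    ... | inj₂ (e₁ , e₂ , _ , _ , _ , _ , _ , only) = level-edge g e' b' (trans (sym (trans (cong g (sym (φα d'))) (g-φ (e' , not b')))) (one-jump g d' others))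
      where
      b' : Bool
      b' = proj₁ (inc-dart i')
      d' : Dart H
      d' = e' , b'
      d'-tail : tl d' ≡ v
      d'-tail = proj₂ (inc-dart i')
      third : ∀ x → x ≡ e₁ ⊎ x ≡ e₂ → e ≡ e₁ ⊎ e ≡ e₂ → e' ≡ e₁ ⊎ e' ≡ e₂ → x ≡ e ⊎ x ≡ e'
      third x (inj₁ a) (inj₁ b) _ = inj₁ (trans a (sym b))
      third x (inj₂ a) (inj₂ b) _ = inj₁ (trans a (sym b))
      third x (inj₁ a) _ (inj₁ b) = inj₂ (trans a (sym b))
      third x (inj₂ a) _ (inj₂ b) = inj₂ (trans a (sym b))
      third x _ (inj₁ a) (inj₁ b) = contradiction (trans a (sym b)) ne
      third x _ (inj₂ a) (inj₂ b) = contradiction (trans a (sym b)) ne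
      others : ∀ d → tl d ≡ tl d' → d ≢ d' → g (σ d) ≡ g d
      others (x , b) t x≢ with P? x
      ... | no ¬p = g-σ x b (off x ¬p)
      ... | yes px with third x (only x px (dart-inc (trans t d'-tail))) (only e p i) (only e' p' i')
      ... | inj₁ refl = g-σ x b l
      ... | inj₂ refl = contradiction (same-dart refl t) x≢

    along : ∀ {u v} → Reach H P u v → (∀ e → P e → Inc H e u → Level e) → ∀ e → P e → Inc H e v → Level e
    along r-refl h = h
    along (r-step e b p r) h = along r λ e' p' i' →
      at-vertex p p' (dart-inc refl) i' (h e p (dart-inc refl))

    all : ∀ e → Level e
    all e with P? e
    ... | no ¬p = off e ¬p
    ... | yes p = along (conn e₀ e p₀ p) (λ e' p' i' → at-vertex p₀ p' (inj₁ refl) i' h₀) e p (inj₁ refl)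

  unit-step : ∀ M N d → M ! proj₁ d ≢ N ! proj₁ d → Unit (step M N d)
  unit-step M N (e , b) ne with proj₁ bip (end e b) | M ! e | N ! e
  ... | _     | true  | true  = contradiction refl ne
  ... | _     | false | false = contradiction refl ne
  ... | true  | true  | false = inj₂ refl
  ... | true  | false | true  = inj₁ refl
  ... | false | true  | false = inj₁ refl
  ... | false | false | true  = inj₂ refl

  δ-values : ∀ f y → δ f y ≡ 0ℤ ⊎ δ f y ≡ 1ℤ
  δ-values f y with face? f y
  ... | yes _ = inj₂ refl
  ... | no _  = inj₁ refl

  unit-neg : ∀ {ε} → Unit ε → Unit (- ε)
  unit-neg (inj₁ refl) = inj₂ refl
  unit-neg (inj₂ refl) = inj₁ refl

  -- Both `δ f` and the height `q` jump only across the facial cycle. The combination `r` is built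
  -- to be level across one of its edges, so it is constant by `cycle-constant`, and zero because it
  -- vanishes at `outer`. Thus `q` is plus or minus `δ f`.
  adj⇒flip : ∀ M N → Adj H S outer (proj₁ M) (proj₁ N) → ∃ λ f → Flippable f × Flip f M N
  adj⇒flip M N (f , fin , cyc@((e₀ , p₀) , _) , xor-P) = f , (fin , cyc , separating) , flip
    where
    q : Dart H → ℤ
    q = diff M N
    c₀ w₀ : ℤ
    c₀ = step M N (e₀ , false)
    w₀ = δ f (e₀ , true) ⊕ - δ f (e₀ , false)
    r : Dart H → ℤ
    r y = c₀ ⊛ δ f y ⊕ - (w₀ ⊛ q y)
    differ : ∀ e → Periph H E f e → M ! e ≢ N ! e
    differ e p = xor-same (proj₂ (xor-P e) p)
    same-off : ∀ e → ¬ Periph H E f e → M ! e ≡ N ! e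
    same-off e ¬p with M ! e Bₚ.≟ N ! e
    ... | yes h = h
    ... | no ne = contradiction (proj₁ (xor-P e) (xor-differ ne)) ¬p
    r-off : ∀ e → ¬ Periph H E f e → r (e , true) ≡ r (e , false)
    r-off e ¬p = cong₂ (λ a b → c₀ ⊛ a ⊕ - (w₀ ⊛ b)) (off-periph f (e , false) ¬p) (same⇒level M N (e , false) (same-off e ¬p))
    r₀ : r (e₀ , true) ≡ r (e₀ , false)
    r₀ = trans (cong (λ z → c₀ ⊛ δ f (e₀ , true) ⊕ - (w₀ ⊛ z)) (diff-jump M N (e₀ , false)))
               (ar c₀ (δ f (e₀ , true)) (δ f (e₀ , false)) (q (e₀ , false)))
      where
      ar : ∀ c a b x → c ⊛ a ⊕ - ((a ⊕ - b) ⊛ (x ⊕ c)) ≡ c ⊛ b ⊕ - ((a ⊕ - b) ⊛ x)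
      ar = solve-∀
    r-zero : ∀ y → c₀ ⊛ δ f y ≡ w₀ ⊛ q y
    r-zero y = trans (ar (c₀ ⊛ δ f y) (w₀ ⊛ q y)) (trans (cong (_⊕ w₀ ⊛ q y)
      (trans (cycle-constant r (Periph H E f) (periph? f) cyc
               (λ d → cong₂ (λ a b → c₀ ⊛ a ⊕ - (w₀ ⊛ b)) (sym (δ-cong f f-φ)) (diff-φ M N d)) r-off e₀ p₀ r₀ y outer)
             (trans (cong₂ (λ a b → c₀ ⊛ a ⊕ - (w₀ ⊛ b)) (δ-out fin) (diff-outer M N)) (ar' c₀ w₀))))
      (ℤₚ.+-identityˡ _))
      where
      ar : ∀ a b → a ≡ (a ⊕ - b) ⊕ b
      ar = solve-∀
      ar' : ∀ a b → a ⊛ 0ℤ ⊕ - (b ⊛ 0ℤ) ≡ 0ℤ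
      ar' = solve-∀
    c₀-unit : Unit c₀
    c₀-unit = unit-step M N (e₀ , false) (differ e₀ p₀)
    c₀≢0 : ∀ {c} → Unit c → c ≢ 0ℤ
    c₀≢0 (inj₁ refl) ()
    c₀≢0 (inj₂ refl) ()
    w₀-cases : w₀ ≡ 0ℤ ⊎ Unit w₀
    w₀-cases with δ-values f (e₀ , true) | δ-values f (e₀ , false)
    ... | inj₁ a | inj₁ b rewrite a | b = inj₁ refl
    ... | inj₁ a | inj₂ b rewrite a | b = inj₂ (inj₂ refl)
    ... | inj₂ a | inj₁ b rewrite a | b = inj₂ (inj₁ refl)
    ... | inj₂ a | inj₂ b rewrite a | b = inj₁ refl
    flip : Flip f M N
    flip = by w₀-cases
      where
      by : w₀ ≡ 0ℤ ⊎ Unit w₀ → Flip f M N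
      -- If `f` lay on both sides or neither side of `e₀`, then `r-zero` evaluated at `f` would give
      -- `c₀ ≡ 0ℤ`.
      by (inj₁ h) = contradiction (trans (sym (ℤₚ.*-identityʳ c₀)) (trans (cong (c₀ ⊛_) (sym (δ-in {f} f-refl)))
        (trans (r-zero f) (trans (cong (_⊛ q f) h) (ℤₚ.*-zeroˡ (q f)))))) (c₀≢0 c₀-unit)
      by (inj₂ (inj₁ h)) = c₀ , c₀-unit , λ y →
        trans (sym (ℤₚ.*-identityˡ (q y))) (trans (cong (_⊛ q y) (sym h)) (sym (r-zero y)))
      by (inj₂ (inj₂ h)) = - c₀ , unit-neg c₀-unit , λ y →
        trans (ar (q y)) (trans (cong -_ (trans (cong (_⊛ q y) (sym h)) (sym (r-zero y)))) (ar' c₀ (δ f y)))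
        where
        ar : ∀ a → a ≡ - (-1ℤ ⊛ a)
        ar = solve-∀
        ar' : ∀ a b → - (a ⊛ b) ≡ - a ⊛ b
        ar' = solve-∀
    separating : ∀ e → Periph H E f e → Separating f e
    separating e p h = differ e p (level⇒same M N (e , false)
      (trans (q≡ (e , true)) (trans (cong (proj₁ flip ⊛_) (sym h)) (sym (q≡ (e , false))))))
      where q≡ = proj₂ (proj₂ flip)

  unit-cancel : ∀ {ε} → Unit ε → ∀ {a b} → ε ⊛ a ≡ ε ⊛ b → a ≡ b
  unit-cancel (inj₁ refl) {a} {b} h = trans (sym (ℤₚ.*-identityˡ a)) (trans h (ℤₚ.*-identityˡ b))
  unit-cancel (inj₂ refl) {a} {b} h = trans (ar a) (trans (cong -_ h) (sym (ar b)))
    where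
    ar : ∀ a → a ≡ - (-1ℤ ⊛ a)
    ar = solve-∀

  flip⇒adj : ∀ {f} M N → Flippable f → Flip f M N → Adj H S outer (proj₁ M) (proj₁ N)
  flip⇒adj {f} M N (fin , cyc , sep) (ε , unit , q≡) = f , fin , cyc , λ e → to e , from e
    where
    in-S : ∀ e → M ! e ≢ N ! e → E e
    in-S e ne with M ! e in m | N ! e in n
    ... | true  | _     = pm⊆S M e m
    ... | false | true  = pm⊆S N e n
    ... | false | false = contradiction refl ne
    to : ∀ e → M ! e xor N ! e ≡ true → Periph H E f e
    to e x with periph? f e
    ... | yes p = p
    ... | no ¬p = contradiction (level⇒same M N (e , false)
            (trans (q≡ _) (trans (cong (ε ⊛_) (off-periph f (e , false) ¬p)) (sym (q≡ _))))) (xor-same x)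
    from : ∀ e → Periph H E f e → M ! e xor N ! e ≡ true
    from e p = xor-differ λ h → sep e p (unit-cancel unit
      (trans (sym (q≡ _)) (trans (sym (same⇒level M N (e , false) h)) (q≡ _))))

  private
    RC : Set
    RC = RConnected H S outer

  flip-at : ∀ {f M N y} → Flip f M N → SameFace f y → ∃ λ ε → Unit ε × diff M N y ≡ ε
  flip-at (ε , unit , h) r = ε , unit , trans (h _) (trans (cong (ε ⊛_) (δ-in r)) (ℤₚ.*-identityʳ ε))

  flip-off : ∀ {f M N y} → Flip f M N → ¬ SameFace f y → diff M N y ≡ 0ℤ
  flip-off (ε , unit , h) ¬r = trans (h _) (trans (cong (ε ⊛_) (δ-out ¬r)) (ℤₚ.*-zeroʳ ε))

  Advance : PM → PM → Set
  Advance M M' = ∃₂ λ T f → Flippable f × (∀ y → diff M T y ≡ δ f y) × 0ℤ ℤ.< diff M M' f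

  -- Follow a walk from M to M' up to the first flip that lifts some face above M while staying
  -- below M'; taking the join with M of the meet with M' turns it into a flip of M itself.
  private
    advance-along : ∀ M M' N {k} → Walk H S outer (proj₁ N) (proj₁ M') k →
      (∀ y → diff M N y ℤ.⊓ diff M M' y ≼ 0ℤ) → ∀ y → 0ℤ ℤ.< diff M M' y → Advance M M'
    advance-along M M' N (w-nil h) inv y pos = contradiction
      (subst (_≼ 0ℤ) (trans (cong (ℤ._⊓ diff M M' y) (trans (sym (ℤₚ.+-identityʳ _))
        (trans (cong (diff M N y ⊕_) (sym (diff-≐ N M' h y))) (sym (diff-trans M N M' y))))) (ℤₚ.⊓-idem _)) (inv y))
      (ℤₚ.<⇒≱ pos)
    advance-along M M' N (w-cons {M₁ = N₁} p adj w) inv y pos with adj⇒flip N (N₁ , p) adj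
    -- Invariant: wherever `M'` is above `M`, the current matching `N` is not. It fails at the end
    -- of the walk, and a flip can break it only at its own face `f`.
    ... | f , fl , flip with (diff M (N₁ , p) f ℤ.⊓ diff M M' f) ℤₚ.≤? 0ℤ
    ... | yes le = advance-along M M' (N₁ , p) w inv' y pos
      where
      inv' : ∀ z → diff M (N₁ , p) z ℤ.⊓ diff M M' z ≼ 0ℤ
      inv' z with face? f z
      ... | yes r = subst (_≼ 0ℤ) (cong₂ ℤ._⊓_ (diff-face M (N₁ , p) r) (diff-face M M' r)) le
      ... | no ¬r = subst (λ t → t ℤ.⊓ diff M M' z ≼ 0ℤ) (sym (trans (diff-trans M N (N₁ , p) z)
              (trans (cong (diff M N z ⊕_) (flip-off {f} {N} {N₁ , p} flip ¬r)) (ℤₚ.+-identityʳ _)))) (inv z)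
    ... | no ¬le = T , f , fl , height-T , pos-M'
      where
      N' : PM
      N' = N₁ , p
      pos-min : 0ℤ ℤ.< diff M N' f ℤ.⊓ diff M M' f
      pos-min = ℤₚ.≰⇒> ¬le
      pos-M' : 0ℤ ℤ.< diff M M' f
      pos-M' = ℤₚ.<-≤-trans pos-min (ℤₚ.i⊓j≤j (diff M N' f) (diff M M' f))
      pos-N' : 0ℤ ℤ.< diff M N' f
      pos-N' = ℤₚ.<-≤-trans pos-min (ℤₚ.i⊓j≤i (diff M N' f) (diff M M' f))
      N≤0 : diff M N f ≼ 0ℤ
      N≤0 with ℤₚ.⊓-sel (diff M N f) (diff M M' f)
      ... | inj₁ h = subst (_≼ 0ℤ) h (inv f)
      ... | inj₂ h = contradiction (subst (_≼ 0ℤ) h (inv f)) (ℤₚ.<⇒≱ pos-M')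
      N'≤1 : diff M N' f ≼ 1ℤ
      N'≤1 with flip-at {f} {N} {N'} flip f-refl
      ... | ε , unit , h = subst (_≼ 1ℤ) (sym (trans (diff-trans M N N' f) (cong (diff M N f ⊕_) h)))
              (ℤₚ.+-mono-≤ N≤0 (unit≤1 unit))
        where
        unit≤1 : ∀ {ε} → Unit ε → ε ≼ 1ℤ
        unit≤1 (inj₁ refl) = ℤₚ.≤-refl
        unit≤1 (inj₂ refl) = ℤ.-≤+
      -- Over `M`, the height of `T` is the minimum of those of `M'` and `N'`, cut off below at 0.
      -- Off `f` this is 0 by the invariant; on `f` it is 1, since `N'` has just risen there from a
      -- height at most 0.
      K T : PM
      K = proj₁ (meet N' M')
      T = proj₁ (join M K)
      diff-K : ∀ z → diff M K z ≡ diff M M' z ℤ.⊓ diff M N' z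
      diff-K z = trans (diff-trans M N' K z) (trans (cong (diff M N' z ⊕_) (proj₂ (meet N' M') z))
        (trans (ℤₚ.mono-≤-distrib-⊓ {diff M N' z ⊕_} (ℤₚ.+-monoʳ-≤ (diff M N' z)) (diff N' M' z) 0ℤ)
               (cong₂ ℤ._⊓_ (sym (diff-trans M N' M' z)) (ℤₚ.+-identityʳ _))))
      diff-T : ∀ z → diff M T z ≡ (diff M M' z ℤ.⊓ diff M N' z) ℤ.⊔ 0ℤ
      diff-T z = trans (proj₂ (join M K) z) (cong (ℤ._⊔ 0ℤ) (diff-K z))
      squeeze : ∀ {a b} → 0ℤ ℤ.< a → 0ℤ ℤ.< b → b ≼ 1ℤ → (a ℤ.⊓ b) ℤ.⊔ 0ℤ ≡ 1ℤ
      squeeze {a} {b} pa pb b≤1 with ℤₚ.≤-antisym b≤1 (ℤₚ.i<j⇒suc[i]≤j pb)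
      ... | refl = cong (ℤ._⊔ 0ℤ) (ℤₚ.i≥j⇒i⊓j≡j (ℤₚ.i<j⇒suc[i]≤j pa))
      height-T : ∀ z → diff M T z ≡ δ f z
      height-T z with face? f z
      ... | yes r = trans (diff-T z) (squeeze (subst (0ℤ ℤ.<_) (diff-face M M' r) pos-M')
              (subst (0ℤ ℤ.<_) (diff-face M N' r) pos-N') (subst (_≼ 1ℤ) (diff-face M N' r) N'≤1))
      ... | no ¬r = trans (diff-T z) (ℤₚ.i≤j⇒i⊔j≡j (subst (_≼ 0ℤ) (trans (cong (ℤ._⊓ diff M M' z) (sym
              (trans (diff-trans M N N' z) (trans (cong (diff M N z ⊕_) (flip-off {f} {N} {N'} flip ¬r)) (ℤₚ.+-identityʳ _)))))
              (ℤₚ.⊓-comm (diff M N' z) (diff M M' z))) (inv z)))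

  advance : RC → ∀ M M' y → 0ℤ ℤ.< diff M M' y → Advance M M'
  advance rc M M' = advance-along M M' M (proj₂ (rc _ _ (proj₂ M) (proj₂ M')))
    (λ y → subst (λ z → z ℤ.⊓ diff M M' y ≼ 0ℤ) (sym (diff-self M y)) (ℤₚ.i⊓j≤i 0ℤ (diff M M' y)))

  abstract
    faces : ∃ λ rs → AllPairs (λ a b → ¬ SameFace a b) rs × (∀ y → Any (SameFace y) rs)
    faces = let (rs , sep , cover) = sep-reps faceRel-equiv face? darts in rs , sep , λ y → cover (∈-darts y)

  reps : List (Dart H)
  reps = proj₁ faces

  ClassFunction : (Dart H → ℕ) → Set
  ClassFunction F = ∀ {x y} → SameFace x y → F x ≡ F y

  pick-sum : ∀ {gs} → AllPairs (λ a b → ¬ SameFace a b) gs → ∀ F → ClassFunction F → ∀ y →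
             Any (SameFace y) gs ⊎ F y ≡ 0 → nsum (L.map (λ g → ℤ.∣ δ y g ∣ ℕ.* F g) gs) ≡ F y
  pick-sum [] F F-cong y (inj₂ h) = sym h
  pick-sum {g ∷ gs} (far ∷ sep) F F-cong y c with face? y g
  ... | yes r = trans (cong₂ ℕ._+_ (ℕₚ.*-identityˡ (F g)) (nsum-zero _
          (All.map (λ {g'} ¬r → cong (λ z → ℤ.∣ z ∣ ℕ.* F g') (δ-out (λ s → ¬r (f-trans (f-sym r) s)))) far)))
          (trans (ℕₚ.+-identityʳ (F g)) (sym (F-cong r)))
  ... | no ¬r = pick-sum sep F F-cong y (narrow c)
    where
    narrow : Any (SameFace y) (g ∷ gs) ⊎ F y ≡ 0 → Any (SameFace y) gs ⊎ F y ≡ 0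
    narrow (inj₁ (here r)) = contradiction r ¬r
    narrow (inj₁ (there i)) = inj₁ i
    narrow (inj₂ h) = inj₂ h

  δ-sum : ∀ f → nsum (L.map (λ r → ℤ.∣ δ f r ∣) reps) ≡ 1
  δ-sum f = trans (nsum-cong _ _ (λ r → sym (ℕₚ.*-identityʳ _)) reps)
    (pick-sum (proj₁ (proj₂ faces)) (λ _ → 1) (λ _ → refl) f (inj₁ (proj₂ (proj₂ faces) f)))

  dist : PM → PM → ℕ
  dist M N = nsum (L.map (λ r → ℤ.∣ diff M N r ∣) reps)

  dist-sym : ∀ M N → dist M N ≡ dist N M
  dist-sym M N = nsum-cong _ _ (λ r → trans (sym (ℤₚ.∣-i∣≡∣i∣ (diff M N r))) (cong ℤ.∣_∣ (sym (diff-inverse M N r)))) reps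

  dist-≤-walk : ∀ M N {k} → Walk H S outer (proj₁ M) (proj₁ N) k → dist M N ≤ k
  dist-≤-walk M N (w-nil h) = ℕₚ.≤-reflexive (nsum-zero _ (All.universal (λ r → cong ℤ.∣_∣ (diff-≐ M N h r)) reps))
  dist-≤-walk M N (w-cons {M₁ = M₁} {k = k} p adj w) with adj⇒flip M (M₁ , p) adj
  ... | f , _ , ε , unit , q≡ = begin
      dist M N
        ≤⟨ nsum-mono _ _ (λ r → subst (_≤ ℤ.∣ diff M N₁ r ∣ ℕ.+ ℤ.∣ diff N₁ N r ∣) (cong ℤ.∣_∣ (sym (diff-trans M N₁ N r))) (ℤₚ.∣i+j∣≤∣i∣+∣j∣ (diff M N₁ r) (diff N₁ N r))) reps ⟩
      nsum (L.map (λ r → ℤ.∣ diff M N₁ r ∣ ℕ.+ ℤ.∣ diff N₁ N r ∣) reps)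
        ≡⟨ nsum-+ (λ r → ℤ.∣ diff M N₁ r ∣) (λ r → ℤ.∣ diff N₁ N r ∣) reps ⟩
      nsum (L.map (λ r → ℤ.∣ diff M N₁ r ∣) reps) ℕ.+ dist N₁ N
        ≡⟨ cong (ℕ._+ dist N₁ N) (trans (nsum-cong _ _ (λ r → trans (cong ℤ.∣_∣ (q≡ r)) (abs-unit unit (δ f r))) reps) (δ-sum f)) ⟩
      suc (dist N₁ N)
        ≤⟨ s≤s (dist-≤-walk N₁ N w) ⟩
      suc k ∎
    where
    open ℕₚ.≤-Reasoning
    N₁ : PM
    N₁ = M₁ , p
    abs-unit : ∀ {ε} → Unit ε → ∀ x → ℤ.∣ ε ⊛ x ∣ ≡ ℤ.∣ x ∣
    abs-unit (inj₁ refl) x = cong ℤ.∣_∣ (ℤₚ.*-identityˡ x)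
    abs-unit (inj₂ refl) x = trans (cong ℤ.∣_∣ (ℤₚ.-1*i≡-i x)) (ℤₚ.∣-i∣≡∣i∣ x)

  adj-sym : ∀ {M N} → Adj H S outer M N → Adj H S outer N M
  adj-sym {M} {N} (f , fin , cyc , h) = f , fin , cyc , λ e →
    (λ x → proj₁ (h e) (trans (Bₚ.xor-comm (M e) (N e)) x)) , λ p → trans (Bₚ.xor-comm (N e) (M e)) (proj₂ (h e) p)

  walk-snoc : ∀ {M N P k} → Walk H S outer M N k → Adj H S outer N P → IsPMG H S P → Walk H S outer M P (suc k)
  walk-snoc {M} {N} {P} (w-nil h) (f , fin , cyc , k) p = w-cons p (f , fin , cyc , λ e →
    (λ x → proj₁ (k e) (trans (cong (_xor P e) (sym (h e))) x)) ,
    λ q → trans (cong (_xor P e) (h e)) (proj₂ (k e) q)) (w-nil λ _ → refl)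
  walk-snoc (w-cons q a w) adj p = w-cons q a (walk-snoc w adj p)

  walk-reverse : ∀ {M N k} → IsPMG H S M → Walk H S outer M N k → Walk H S outer N M k
  walk-reverse p (w-nil h) = w-nil (sym ∘ h)
  walk-reverse {M} p (w-cons {M₁ = M₁} q a w) = walk-snoc (walk-reverse q w) (adj-sym {M} {M₁} a) p

  dist-advance : ∀ M N → (adv : Advance M N) → dist M N ≡ suc (dist (proj₁ adv) N)
  dist-advance M N (T , f , _ , hT , pos) = begin
    dist M N
      ≡⟨ nsum-cong _ _ (λ r → lower r (face? f r)) reps ⟩
    nsum (L.map (λ r → ℤ.∣ δ f r ∣ ℕ.+ ℤ.∣ diff T N r ∣) reps)
      ≡⟨ nsum-+ (λ r → ℤ.∣ δ f r ∣) (λ r → ℤ.∣ diff T N r ∣) reps ⟩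
    nsum (L.map (λ r → ℤ.∣ δ f r ∣) reps) ℕ.+ dist T N
      ≡⟨ cong (ℕ._+ dist T N) (δ-sum f) ⟩
    suc (dist T N) ∎
    where
    open ≡-Reasoning
    split : ∀ r → diff M N r ≡ δ f r ⊕ diff T N r
    split r = trans (diff-trans M T N r) (cong (_⊕ diff T N r) (hT r))
    one-more : ∀ x y → 0ℤ ℤ.< x → x ≡ 1ℤ ⊕ y → ℤ.∣ x ∣ ≡ suc ℤ.∣ y ∣
    one-more _ (+ n) _ refl = refl
    one-more _ ℤ.-[1+ zero ] (ℤ.+<+ ()) refl
    one-more _ ℤ.-[1+ suc n ] () refl
    lower : ∀ r → Dec (SameFace f r) → ℤ.∣ diff M N r ∣ ≡ ℤ.∣ δ f r ∣ ℕ.+ ℤ.∣ diff T N r ∣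
    lower r (yes s) = trans (one-more (diff M N r) (diff T N r) (subst (0ℤ ℤ.<_) (diff-face M N s) pos)
        (trans (split r) (cong (_⊕ diff T N r) (δ-in s))))
      (cong (λ z → ℤ.∣ z ∣ ℕ.+ ℤ.∣ diff T N r ∣) (sym (δ-in s)))
    lower r (no ¬s) = trans (cong ℤ.∣_∣ (trans (split r) (trans (cong (_⊕ diff T N r) (δ-out ¬s)) (ℤₚ.+-identityˡ (diff T N r)))))
      (cong (λ z → ℤ.∣ z ∣ ℕ.+ ℤ.∣ diff T N r ∣) (sym (δ-out ¬s)))

  advance-adj : ∀ M N → (adv : Advance M N) → Adj H S outer (proj₁ M) (proj₁ (proj₁ adv))
  advance-adj M N (T , f , fl , hT , _) =
    flip⇒adj M T fl (1ℤ , inj₁ refl , λ y → trans (hT y) (sym (ℤₚ.*-identityˡ _)))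

  from-reps : ∀ M N → All (λ r → diff M N r ≡ 0ℤ) reps → ∀ y → diff M N y ≡ 0ℤ
  from-reps M N h y = go h (proj₂ (proj₂ faces) y)
    where
    go : ∀ {rs} → All (λ r → diff M N r ≡ 0ℤ) rs → Any (SameFace y) rs → diff M N y ≡ 0ℤ
    go (h ∷ _) (here r) = trans (diff-face M N r) h
    go (_ ∷ h) (there i) = go h i

  -- Each `advance` lowers the distance by exactly one. It needs a face where the target is higher;
  -- at a face where it is lower, the roles of `M` and `N` are exchanged and the resulting walk is
  -- reversed.
  geodesic : RC → ∀ n M N → dist M N ≡ n → Walk H S outer (proj₁ M) (proj₁ N) n
  geodesic rc n M N eq with All.all? (λ r → diff M N r ℤₚ.≟ 0ℤ) reps
  ... | yes h = subst (Walk H S outer (proj₁ M) (proj₁ N))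
          (trans (sym (nsum-zero _ (All.map (cong ℤ.∣_∣) h))) eq) (w-nil (zero⇒≐ M N (from-reps M N h)))
  ... | no ¬h with Any.satisfied (Allₚ.¬All⇒Any¬ (λ r → diff M N r ℤₚ.≟ 0ℤ) reps ¬h)
  ... | y , ne with ℤₚ.<-cmp (diff M N y) 0ℤ
  ... | tri≈ _ z _ = contradiction z ne
  geodesic rc n M N eq | no _ | y , _ | tri> _ _ pos with advance rc M N y pos
  ... | adv with trans (sym (dist-advance M N adv)) eq
  geodesic rc (suc n) M N eq | no _ | y , _ | tri> _ _ pos | adv | refl =
    w-cons (proj₂ (proj₁ adv)) (advance-adj M N adv) (geodesic rc n (proj₁ adv) N refl)
  geodesic rc n M N eq | no _ | y , _ | tri< neg _ _ with advance rc N M y (subst (0ℤ ℤ.<_) (sym (diff-inverse M N y)) (ℤₚ.neg-mono-< neg))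
  ... | adv with trans (sym (dist-advance N M adv)) (trans (dist-sym N M) eq)
  geodesic rc (suc n) M N eq | no _ | y , _ | tri< neg _ _ | adv | refl = walk-reverse (proj₂ N)
    (w-cons (proj₂ (proj₁ adv)) (advance-adj N M adv) (geodesic rc n (proj₁ adv) M refl))

-- Hamming distance and unary encoding of heights

b2n : Bool → ℕ
b2n true  = 1
b2n false = 0

ham : ∀ m → (Fin m → Bool) → (Fin m → Bool) → ℕ
ham zero    u v = 0
ham (suc m) u v = b2n (u zero xor v zero) ℕ.+ ham m (u ∘ suc) (v ∘ suc)

ham-cong : ∀ m {u u' v v' : Fin m → Bool} → (∀ i → u i ≡ u' i) → (∀ i → v i ≡ v' i) → ham m u v ≡ ham m u' v'
ham-cong zero h k = refl
ham-cong (suc m) h k = cong₂ ℕ._+_ (cong₂ (λ a b → b2n (a xor b)) (h zero) (k zero)) (ham-cong m (h ∘ suc) (k ∘ suc))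

ham-≤ : ∀ m u v → ham m u v ≤ m
ham-≤ zero u v = z≤n
ham-≤ (suc m) u v = ℕₚ.+-mono-≤ (b2n≤1 (u zero xor v zero)) (ham-≤ m (u ∘ suc) (v ∘ suc))
  where
  b2n≤1 : ∀ b → b2n b ≤ 1
  b2n≤1 true = ℕₚ.≤-refl
  b2n≤1 false = z≤n

ham-split : ∀ a b (u v : Fin (a ℕ.+ b) → Bool) →
  ham (a ℕ.+ b) u v ≡ ham a (u ∘ (F._↑ˡ b)) (v ∘ (F._↑ˡ b)) ℕ.+ ham b (u ∘ (a F.↑ʳ_)) (v ∘ (a F.↑ʳ_))
ham-split zero b u v = refl
ham-split (suc a) b u v = trans (cong (b2n (u zero xor v zero) ℕ.+_) (ham-split a b (u ∘ suc) (v ∘ suc)))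
  (sym (ℕₚ.+-assoc (b2n (u zero xor v zero)) _ _))

-- In the unary code the j-th bit of x says whether j < x, so two codes differ exactly at the
-- positions from the smaller number up to the larger.
ham-thresholds : ∀ k {x y} → x ≤ k → y ≤ k →
  ham k (λ j → F.toℕ j ℕ.<ᵇ x) (λ j → F.toℕ j ℕ.<ᵇ y) ≡ ℕ.∣ x - y ∣
ham-thresholds zero z≤n z≤n = refl
ham-thresholds (suc k) z≤n z≤n = ham-thresholds k z≤n z≤n
ham-thresholds (suc k) z≤n (s≤s q) = cong suc (ham-thresholds k z≤n q)
ham-thresholds (suc k) {suc x} (s≤s p) z≤n = cong suc (trans (ham-thresholds k p z≤n) (ℕₚ.∣-∣-identityʳ x))
ham-thresholds (suc k) (s≤s p) (s≤s q) = ham-thresholds k p q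

nsum-tabulate : ∀ m {n} (F : Fin n → ℕ) (f : Fin m → Fin n) (u v : Fin m → Bool) →
  (∀ i → F (f i) ≡ b2n (u i xor v i)) → nsum (L.map F (L.tabulate f)) ≡ ham m u v
nsum-tabulate zero F f u v h = refl
nsum-tabulate (suc m) F f u v h = cong₂ ℕ._+_ (h zero) (nsum-tabulate m F (f ∘ suc) (u ∘ suc) (v ∘ suc) (h ∘ suc))

module _ (H : Map) (S : EdgeSet H) (outer : Dart H) where

  private
    -- Gives a name to the summand of hamming, which is built from a local function of Defs.
    summand : ∀ m u v → Σ (Fin m → ℕ) λ F → hamming H S outer m u v ≡ nsum (L.map F (allFin m))
    summand m u v = _ , refl

    summand-b2n : ∀ m u v i → proj₁ (summand m u v) i ≡ b2n (u i xor v i)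
    summand-b2n m u v i with u i xor v i
    ... | true  = refl
    ... | false = refl

  hamming≡ham : ∀ m u v → hamming H S outer m u v ≡ ham m u v
  hamming≡ham m u v = nsum-tabulate m (proj₁ (summand m u v)) id u v (summand-b2n m u v)

module Encoding {A : Set} (bound : A → ℕ) where

  width : List A → ℕ
  width rs = nsum (L.map bound rs)

  -- Concatenated unary codes, one block of `bound r` bits for each `r`; the Hamming distance
  -- becomes the sum of the distances of the values.
  encode : ∀ rs → (A → ℕ) → Fin (width rs) → Bool
  encode (r ∷ rs) val i = [ (λ j → F.toℕ j ℕ.<ᵇ val r) , encode rs val ]′ (F.splitAt (bound r) i)

  ham-encode : ∀ rs {x y : A → ℕ} → (∀ r → x r ≤ bound r) → (∀ r → y r ≤ bound r) →
    ham (width rs) (encode rs x) (encode rs y) ≡ nsum (L.map (λ r → ℕ.∣ x r - y r ∣) rs)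
  ham-encode [] hx hy = refl
  ham-encode (r ∷ rs) {x} {y} hx hy = trans (ham-split (bound r) (width rs) (encode (r ∷ rs) x) (encode (r ∷ rs) y))
    (cong₂ ℕ._+_
      (trans (ham-cong (bound r) (left x) (left y)) (ham-thresholds (bound r) (hx r) (hy r)))
      (trans (ham-cong (width rs) (right x) (right y)) (ham-encode rs hx hy)))
    where
    left : ∀ z i → encode (r ∷ rs) z (i F.↑ˡ width rs) ≡ (F.toℕ i ℕ.<ᵇ z r)
    left z i rewrite Fₚ.splitAt-↑ˡ (bound r) i (width rs) = refl
    right : ∀ z i → encode (r ∷ rs) z (bound r F.↑ʳ i) ≡ encode rs z i
    right z i rewrite Fₚ.splitAt-↑ʳ (bound r) (width rs) i = refl

length≤nsum : ∀ {A : Set} (F : A → ℕ) {xs} → All (λ x → 1 ≤ F x) xs → length xs ≤ nsum (L.map F xs)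
length≤nsum F [] = z≤n
length≤nsum F (h ∷ hs) = ℕₚ.+-mono-≤ h (length≤nsum F hs)

nsum≤length : ∀ {A : Set} (F : A → ℕ) {xs} → All (λ x → F x ≤ 1) xs → nsum (L.map F xs) ≤ length xs
nsum≤length F [] = z≤n
nsum≤length F (h ∷ hs) = ℕₚ.+-mono-≤ h (nsum≤length F hs)

nsum-tight : ∀ {A : Set} (F : A → ℕ) {xs} → All (λ x → 1 ≤ F x) xs → nsum (L.map F xs) ≤ length xs → All (λ x → F x ≤ 1) xs
nsum-tight F [] le = []
nsum-tight F {x ∷ xs} (h ∷ hs) le =
  ℕₚ.+-cancelʳ-≤ (length xs) (F x) 1 (ℕₚ.≤-trans (ℕₚ.+-monoʳ-≤ (F x) (length≤nsum F hs)) le)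
  ∷ nsum-tight F hs (ℕₚ.+-cancelˡ-≤ 1 _ _ (ℕₚ.≤-trans (ℕₚ.+-monoˡ-≤ _ h) le))

-- Extremal matchings, good faces and the isometric dimension

module Extremal (H : Map) (plane : IsPlaneMap H) (outer : Dart H)
                (S : EdgeSet H) (bip : Bipartite H S)
                (M₀ : ∃ (IsPMG H S)) (rc : RConnected H S outer) where
  open Flips H plane outer S bip public

  A : Fin nE → Set
  A = Allowed H S

  AFace : Dart H → Dart H → Set
  AFace = FaceRel H A

  aface? : ∀ x y → Dec (AFace x y)
  aface? = faceRel? allowed?

  abstract
    least-matching : ∃ λ m → ∀ N d → 0ℤ ≼ diff m N d
    least-matching = minimum M₀

    greatest-matching : ∃ λ m → ∀ N d → 0ℤ ≼ diff N m d
    greatest-matching = maximum M₀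

  bot top : PM
  bot = proj₁ least-matching
  top = proj₁ greatest-matching

  w : PM → Dart H → ℤ
  w = diff bot

  h : Dart H → ℤ
  h = w top

  0≤w : ∀ N y → 0ℤ ≼ w N y
  0≤w = proj₂ least-matching

  w≤h : ∀ N y → w N y ≼ h y
  w≤h N y = subst (_≼ h y) (ℤₚ.+-identityʳ _) (subst (w N y ⊕ 0ℤ ≼_) (sym (diff-trans bot N top y))
    (ℤₚ.+-monoʳ-≤ (w N y) (proj₂ greatest-matching N y)))

  h-aface : ∀ {x y} → AFace x y → h x ≡ h y
  h-aface = diff-allowed bot top

  module _ (y : Dart H) (y-finite : ¬ AFace y outer) (h-zero : h y ≡ 0ℤ) where
    private
      χ : Dart H → ℤ
      χ x = ind (aface? y x) 1ℤ

      χ-cong : ∀ {x z} → AFace x z → χ x ≡ χ z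
      χ-cong {x} {z} r = ind-⇔ (aface? y x) (aface? y z) (λ s → f-trans s r) (λ s → f-trans s (f-sym r))

      χ-values : ∀ x → (χ x ≡ 1ℤ × AFace y x) ⊎ χ x ≡ 0ℤ
      χ-values x with aface? y x
      ... | yes r = inj₁ (refl , r)
      ... | no _  = inj₂ refl

      χ-σ : ∀ d → χ (α′ d) ≡ χ d → χ (σ d) ≡ χ d
      χ-σ d l = trans (cong χ (sym (φα d))) (trans (sym (χ-cong f-φ)) l)

      σ-χ : ∀ d → χ (σ d) ≡ χ d → χ (α′ d) ≡ χ d
      σ-χ d l = trans (χ-cong f-φ) (trans (cong χ (φα d)) l)

      Boundary : Fin nE → Set
      Boundary e = χ (e , true) ≢ χ (e , false)

      boundary? : ∀ e → Dec (Boundary e)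
      boundary? e = ¬? (χ (e , true) ℤₚ.≟ χ (e , false))

      interior-level : ∀ e b → ¬ Boundary e → χ (e , not b) ≡ χ (e , b)
      interior-level e b ¬bd with χ (e , true) ℤₚ.≟ χ (e , false)
      ... | yes l = edge-level χ e b l
      ... | no ne = contradiction ne ¬bd

      boundary-dart : ∀ e b → Boundary e → χ (e , not b) ≢ χ (e , b)
      boundary-dart e b bd l = bd (level-edge χ e b l)

      boundary-allowed : ∀ e → Boundary e → A e
      boundary-allowed e bd with allowed? e
      ... | yes a = a
      ... | no ¬a = contradiction (sym (χ-cong (f-α ¬a))) bd

      -- Otherwise the edge lies in every matching, hence no other edge at its ends is allowed and
      -- both of its sides belong to the same region.
      inner-differs : ∀ e b → χ (e , b) ≡ 1ℤ → AFace y (e , b) → Boundary e → bot ! e ≢ top ! e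
      inner-differs e b χ1 r bd eq = boundary-dart e b bd (σ-χ d (one-jump χ d others))
        where
        d : Dart H
        d = e , b
        hd : h d ≡ 0ℤ
        hd = trans (sym (h-aface r)) h-zero
        hαd : h (α′ d) ≡ 0ℤ
        hαd = trans (same⇒level bot top d eq) hd
        squeezed : ∀ N x → h x ≡ 0ℤ → w N x ≡ 0ℤ
        squeezed N x hx = antisym-zero (subst (w N x ≼_) hx (w≤h N x)) (0≤w N x)
        fixed : ∀ N → bot ! e ≡ N ! e
        fixed N = level⇒same bot N d (trans (squeezed N (α′ d) hαd) (sym (squeezed N d hd)))
        bot-in : bot ! e ≡ true
        bot-in with boundary-allowed e bd
        ... | N , p , n = trans (fixed (N , p)) n
        others : ∀ d' → tl d' ≡ tl d → d' ≢ d → χ (σ d') ≡ χ d'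
        others d' t ne = χ-σ d' (sym (χ-cong (f-α not-a)))
          where
          not-a : ¬ A (proj₁ d')
          not-a (N , p , n) = ne (same-dart (trans (mate-unique (N , p) (tl d) (proj₁ d') n (dart-inc t))
            (sym (mate-unique (N , p) (tl d) e (trans (sym (fixed (N , p))) bot-in) (dart-inc refl)))) t)

      inside : ∀ e → Boundary e → ∃ λ b → χ (e , b) ≡ 1ℤ × AFace y (e , b)
      inside e bd with χ-values (e , true) | χ-values (e , false)
      ... | inj₁ c | _      = true , c
      ... | inj₂ _ | inj₁ c = false , c
      ... | inj₂ a | inj₂ b = contradiction (trans a (sym b)) bd

      differs : ∀ e → Boundary e → bot ! e ≢ top ! e
      differs e bd = let (b , c , r) = inside e bd in inner-differs e b c r bd

      -- From height 0 the jump is one up or one down, and heights over `bot` are never negative.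
      outside-height : ∀ e b → Boundary e → AFace y (e , b) → h (e , not b) ≡ 1ℤ
      outside-height e b bd r with unit-step bot top (e , b) (differs e bd)
      ... | inj₁ u = trans (diff-jump bot top (e , b)) (cong₂ _⊕_ (trans (sym (h-aface r)) h-zero) u)
      ... | inj₂ u = contradiction (subst (0ℤ ≼_) (trans (diff-jump bot top (e , b))
                       (cong₂ _⊕_ (trans (sym (h-aface r)) h-zero) u)) (0≤w top (e , not b))) λ ()

      t : EdgeSet H
      t e = if does (boundary? e) then top ! e else bot ! e

      t-boundary : ∀ e → Boundary e → t e ≡ top ! e
      t-boundary e = if-yes (boundary? e)

      t-interior : ∀ e → ¬ Boundary e → t e ≡ bot ! e
      t-interior e = if-no (boundary? e)

      changed : ∀ v e → Inc H e v → bot ! e ≢ top ! e → e ≡ mate bot v ⊎ e ≡ mate top v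
      changed v e i ne with e F.≟ mate bot v | e F.≟ mate top v
      ... | yes a | _ = inj₁ a
      ... | no _ | yes b = inj₂ b
      ... | no a | no b = contradiction (trans (not-mate bot v e i a) (sym (not-mate top v e i b))) ne

      -- At most two edges at `v` differ between `bot` and `top`. If `e` were one of them and not on
      -- the boundary, `e₁` would be the only boundary edge at `v`, and `χ` cannot have a single
      -- jump around a vertex. So at `v` the surgery agrees with `top` throughout.
      boundary-closed : ∀ v e₁ e → Boundary e₁ → Inc H e₁ v → Inc H e v → ¬ Boundary e → bot ! e ≡ top ! e
      boundary-closed v e₁ e bd₁ i₁ i ¬bd with bot ! e Bₚ.≟ top ! e
      ... | yes eq = eq
      ... | no ne = contradiction (σ-χ d₁ (one-jump χ d₁ others)) (boundary-dart e₁ (proj₁ (inc-dart i₁)) bd₁)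
        where
        d₁ : Dart H
        d₁ = e₁ , proj₁ (inc-dart i₁)
        t₁ : tl d₁ ≡ v
        t₁ = proj₂ (inc-dart i₁)
        two : ∀ x → x ≡ mate bot v ⊎ x ≡ mate top v → e₁ ≡ mate bot v ⊎ e₁ ≡ mate top v →
              e ≡ mate bot v ⊎ e ≡ mate top v → x ≡ e₁ ⊎ x ≡ e
        two x (inj₁ a) (inj₁ b) _ = inj₁ (trans a (sym b))
        two x (inj₂ a) (inj₂ b) _ = inj₁ (trans a (sym b))
        two x (inj₁ a) _ (inj₁ b) = inj₂ (trans a (sym b))
        two x (inj₂ a) _ (inj₂ b) = inj₂ (trans a (sym b))
        two x _ (inj₁ a) (inj₁ b) = contradiction (subst Boundary (trans a (sym b)) bd₁) ¬bd
        two x _ (inj₂ a) (inj₂ b) = contradiction (subst Boundary (trans a (sym b)) bd₁) ¬bd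
        others : ∀ d → tl d ≡ tl d₁ → d ≢ d₁ → χ (σ d) ≡ χ d
        others (x , b) tx x≢ with boundary? x
        ... | no ¬bx = χ-σ (x , b) (interior-level x b ¬bx)
        ... | yes bx with two x (changed v x (dart-inc (trans tx t₁)) (differs x bx)) (changed v e₁ i₁ (differs e₁ bd₁)) (changed v e i ne)
        ... | inj₁ refl = contradiction (same-dart refl tx) x≢
        ... | inj₂ refl = contradiction bx ¬bd

      T : PM
      T = t , glue t local
        where
        local : ∀ v → ∃ λ (N : PM) → ∀ e → Inc H e v → t e ≡ N ! e
        local v with any? (λ e → boundary? e ×-dec inc? e v)
        ... | no none = bot , λ e i → t-interior e (λ bd → none (e , bd , i))
        ... | yes (e₁ , bd₁ , i₁) = top , λ e i → by e i (boundary? e)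
          where
          by : ∀ e → Inc H e v → Dec (Boundary e) → t e ≡ top ! e
          by e i (yes bd) = t-boundary e bd
          by e i (no ¬bd) = trans (t-interior e ¬bd) (boundary-closed v e₁ e bd₁ i₁ i ¬bd)

      -- Leaving the region across a boundary edge, `h` rises from 0 to 1 and `- χ` from -1 to 0:
      -- the same jump, so `- χ` is the height of `T`.
      T-jump : ∀ d → - χ (α′ d) ≡ - χ d ⊕ step bot T d
      T-jump (e , b) = by (boundary? e)
        where
        by : Dec (Boundary e) → - χ (e , not b) ≡ - χ (e , b) ⊕ step bot T (e , b)
        by (no ¬bd) = trans (cong -_ (interior-level e b ¬bd)) (sym (trans (cong (- χ (e , b) ⊕_)
          (step-same bot T (e , b) (sym (t-interior e ¬bd)))) (ℤₚ.+-identityʳ _)))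
        by (yes bd) = trans (sides (χ-values (e , b)) (χ-values (e , not b)))
          (cong (- χ (e , b) ⊕_) (trans (sym jump) (step-cong bot top T (e , b) (sym (t-boundary e bd)))))
          where
          jump : step bot top (e , b) ≡ h (e , not b) ⊕ - h (e , b)
          jump = trans (ar (h (e , b)) (step bot top (e , b))) (cong (_⊕ - h (e , b)) (sym (diff-jump bot top (e , b))))
            where
            ar : ∀ a c → c ≡ (a ⊕ c) ⊕ - a
            ar = solve-∀
          zero-in : ∀ {x} → AFace y x → h x ≡ 0ℤ
          zero-in r = trans (sym (h-aface r)) h-zero
          sides : (χ (e , b) ≡ 1ℤ × AFace y (e , b)) ⊎ χ (e , b) ≡ 0ℤ →
                  (χ (e , not b) ≡ 1ℤ × AFace y (e , not b)) ⊎ χ (e , not b) ≡ 0ℤ →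
                  - χ (e , not b) ≡ - χ (e , b) ⊕ (h (e , not b) ⊕ - h (e , b))
          sides (inj₁ (c , _)) (inj₁ (c' , _)) = contradiction (trans c' (sym c)) (boundary-dart e b bd)
          sides (inj₂ c) (inj₂ c') = contradiction (trans c' (sym c)) (boundary-dart e b bd)
          sides (inj₁ (c , r)) (inj₂ c') rewrite c | c' | zero-in r | outside-height e b bd r = refl
          sides (inj₂ c) (inj₁ (c' , r)) rewrite c | c' | zero-in r
            | trans (cong (λ z → h (e , z)) (sym (not-involutive b))) (outside-height e (not b) bd r) = refl

      T-height : w T y ≡ -1ℤ
      T-height = trans (diff-unique bot T (λ x → - χ x)
        ((λ d → cong -_ (sym (χ-cong f-φ))) , cong -_ (ind-no (aface? y outer) y-finite) , T-jump) y)
        (cong -_ (ind-yes (aface? y y) f-refl))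

    -- If f does not move, its neighbours across every allowed edge all rise by one from bot to top;
    -- replacing bot by top along the boundary of f therefore lowers f below its minimum.
    unmoved-absurd : ⊥
    unmoved-absurd = contradiction (subst (0ℤ ≼_) T-height (0≤w T y)) λ ()

  h≡0⇒outer : ∀ y → h y ≡ 0ℤ → AFace y outer
  h≡0⇒outer y hy with aface? y outer
  ... | yes r = r
  ... | no ¬r = ⊥-elim (unmoved-absurd y ¬r hy)

  outer⇒h≡0 : ∀ y → AFace y outer → h y ≡ 0ℤ
  outer⇒h≡0 y r = trans (h-aface r) (diff-outer bot top)

  record Flipped (y : Dart H) : Set where
    field
      f         : Dart H
      flippable : Flippable f
      here-f    : SameFace f y
      before after : PM
      flip      : Flip f before after

  private
    -- A flip elsewhere leaves the height at `y` unchanged, so a walk between matchings of different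
    -- height at `y` must flip the face of `y`.
    flipped-along : ∀ M N {k} → Walk H S outer (proj₁ M) (proj₁ N) k → ∀ y → diff M N y ≢ 0ℤ → Flipped y
    flipped-along M N (w-nil eq) y ne = contradiction (diff-≐ M N eq y) ne
    flipped-along M N (w-cons {M₁ = M₁} p adj walk) y ne with adj⇒flip M (M₁ , p) adj
    ... | f , fl , flip with face? f y
    ... | yes r = record { f = f ; flippable = fl ; here-f = r ; before = M ; after = M₁ , p ; flip = flip }
    ... | no ¬r = flipped-along (M₁ , p) N walk y λ z → ne (trans (diff-trans M (M₁ , p) N y)
            (cong₂ _⊕_ (flip-off {f} {M} {M₁ , p} flip ¬r) z))

  flipped : ∀ y → ¬ AFace y outer → Flipped y
  flipped y fin = flipped-along bot top (proj₂ (rc _ _ (proj₂ bot) (proj₂ top))) y (λ z → fin (h≡0⇒outer y z))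

  -- The flip of the face of `x` changes the height on that face alone, yet the height is constant
  -- on the whole region of G minus its forbidden edges; hence `x'` lies in the same face of G.
  weaklyElementary : WeaklyElementary H S outer
  weaklyElementary x x' r fin = f-trans (f-sym here-f) f-x'
    where
    open Flipped (flipped x fin)
    f-x' : SameFace f x'
    f-x' with face? f x'
    ... | yes s = s
    ... | no ¬s with flip-at {f} {before} {after} flip here-f
    ... | _ , inj₁ refl , eq = contradiction (trans (sym eq) (trans (diff-allowed before after r) (flip-off {f} {before} {after} flip ¬s))) λ ()
    ... | _ , inj₂ refl , eq = contradiction (trans (sym eq) (trans (diff-allowed before after r) (flip-off {f} {before} {after} flip ¬s))) λ ()

  -- Every edge of the periphery changes in the flip, so it lies in one of the two matchings.
  flipped-allowed : ∀ {y} (F : Flipped y) → ∀ e → Periph H E (Flipped.f F) e → A e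
  flipped-allowed F e p with proj₂ (proj₂ (proj₂ (flip⇒adj before after flippable flip))) e
    where open Flipped F
  ... | _ , from with Flipped.before F ! e in b | Flipped.after F ! e in a
  ... | true  | _     = in⇒allowed (Flipped.before F) e b
  ... | false | true  = in⇒allowed (Flipped.after F) e a
  ... | false | false = contradiction (from p) λ ()

  periph-cong : ∀ {X : Fin nE → Set} {x y e} → FaceRel H X x y → Periph H X x e → Periph H X y e
  periph-cong r (s , b , q) = s , b , f-trans (f-sym r) q

  -- No edge of G on the periphery of a good face is forbidden, so deleting the forbidden edges
  -- glues nothing to that face, in particular not the infinite one.
  good⇒finite : ∀ y → GoodFace H S outer y → ¬ AFace y outer
  good⇒finite y (fin , good) r = fin (proj₁ (iff r) f-refl)
    where
    not-S : ∀ {x} → ¬ A (proj₁ x) → SameFace y x → ¬ E (proj₁ x)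
    not-S {e , b} ¬a s x∈E = good e (x∈E , b , s) (x∈E , ¬a)
    iff : ∀ {x z} → AFace x z → (SameFace y x → SameFace y z) × (SameFace y z → SameFace y x)
    iff f-refl = id , id
    iff f-φ = (λ s → f-trans s f-φ) , (λ s → f-trans s (f-sym f-φ))
    iff (f-α {x} ¬a) = (λ s → f-trans s (f-α (not-S ¬a s))) , (λ s → f-trans s (f-sym (f-α (not-S {α′ x} ¬a s))))
    iff (f-sym r) = proj₂ (iff r) , proj₁ (iff r)
    iff (f-trans r r') = proj₁ (iff r') ∘ proj₁ (iff r) , proj₂ (iff r) ∘ proj₂ (iff r')

  finite⇒good : ∀ y → ¬ AFace y outer → GoodFace H S outer y
  finite⇒good y fin = fin ∘ sameFace⇒allowed , λ e p (_ , ¬a) →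
    ¬a (flipped-allowed F e (periph-cong (f-sym (Flipped.here-f F)) p))
    where
    F : Flipped y
    F = flipped y fin

  rise : Dart H → ℕ
  rise y = ℤ.∣ h y ∣

  rise-class : ClassFunction rise
  rise-class r = cong ℤ.∣_∣ (diff-face bot top r)

  +rise : ∀ y → + rise y ≡ h y
  +rise y = ℤₚ.0≤i⇒+∣i∣≡i (0≤w top y)

  good⇒rise : ∀ y → GoodFace H S outer y → 1 ≤ rise y
  good⇒rise y good with rise y in eq
  ... | suc n = s≤s z≤n
  ... | zero = contradiction (h≡0⇒outer y (trans (sym (+rise y)) (cong +_ eq))) (good⇒finite y good)

  rise⇒good : ∀ y → rise y ≢ 0 → GoodFace H S outer y
  rise⇒good y ne = finite⇒good y (λ r → ne (cong ℤ.∣_∣ (outer⇒h≡0 y r)))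

  open Encoding rise

  idim : ℕ
  idim = width reps

  level : PM → Dart H → ℕ
  level N y = ℤ.∣ w N y ∣

  +level : ∀ N y → + level N y ≡ w N y
  +level N y = ℤₚ.0≤i⇒+∣i∣≡i (0≤w N y)

  level≤rise : ∀ N y → level N y ≤ rise y
  level≤rise N y = ℤₚ.drop‿+≤+ (subst (_≼ + rise y) (sym (+level N y)) (subst (w N y ≼_) (sym (+rise y)) (w≤h N y)))

  level-diff : ∀ M N y → ℕ.∣ level M y - level N y ∣ ≡ ℤ.∣ diff M N y ∣
  level-diff M N y = trans (ar (level M y) (level N y)) (cong ℤ.∣_∣ (sym (trans (diff-trans M bot N y)
    (cong₂ _⊕_ (trans (diff-inverse bot M y) (cong -_ (sym (+level M y)))) (sym (+level N y))))))
    where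
    ar : ∀ a b → ℕ.∣ a - b ∣ ≡ ℤ.∣ - (+ a) ⊕ + b ∣
    ar a b = trans (ℕₚ.∣-∣-comm a b) (trans (abs-⊖ b a) (cong ℤ.∣_∣ (trans (sym (ℤₚ.m-n≡m⊖n b a)) (ℤₚ.+-comm (+ b) (- (+ a))))))
      where
      abs-⊖ : ∀ a b → ℕ.∣ a - b ∣ ≡ ℤ.∣ a ℤ.⊖ b ∣
      abs-⊖ zero zero = refl
      abs-⊖ zero (suc b) = refl
      abs-⊖ (suc a) zero = refl
      abs-⊖ (suc a) (suc b) = trans (abs-⊖ a b) (cong ℤ.∣_∣ (sym (ℤₚ.[1+m]⊖[1+n]≡m⊖n a b)))

  -- Unary coding of the heights over `bot` gives the embedding. Minimality: `bot` and `top` are at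
  -- distance `idim`, while no two vertices of a k-cube are farther apart than k.
  idim-correct : IsIdim H S outer idim
  idim-correct = (f , λ M N p q →
      subst (Walk H S outer M N) (sym (hamming-dist M N p q)) (geodesic rc _ (M , p) (N , q) refl) ,
      λ j walk → subst (_≤ j) (sym (hamming-dist M N p q)) (dist-≤-walk (M , p) (N , q) walk))
    , λ k k<m (g , iso) → ℕₚ.<⇒≱ k<m (ℕₚ.≤-trans (dist-≤-walk bot top (proj₁ (iso _ _ (proj₂ bot) (proj₂ top))))
        (subst (_≤ k) (sym (hamming≡ham H S outer k (g _ (proj₂ bot)) (g _ (proj₂ top)))) (ham-≤ k (g _ (proj₂ bot)) (g _ (proj₂ top)))))
    where
    f : ∀ M → IsPMG H S M → Fin idim → Bool
    f M p = encode reps (level (M , p))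
    hamming-dist : ∀ M N p q → hamming H S outer idim (f M p) (f N q) ≡ dist (M , p) (N , q)
    hamming-dist M N p q = trans (hamming≡ham H S outer idim (f M p) (f N q))
      (trans (ham-encode reps (level≤rise (M , p)) (level≤rise (N , q)))
             (nsum-cong _ _ (level-diff (M , p) (N , q)) reps))

  module _ {d : ℕ} (good : NumGoodFaces H S outer d) where
    private
      goods : List (Dart H)
      goods = proj₁ good
      |goods| : length goods ≡ d
      |goods| = proj₁ (proj₂ good)
      goods-sep : AllPairs (λ a c → ¬ SameFace a c) goods
      goods-sep = proj₁ (proj₂ (proj₂ good))
      goods-good : All (GoodFace H S outer) goods
      goods-good = proj₁ (proj₂ (proj₂ (proj₂ good)))
      goods-complete : ∀ f → GoodFace H S outer f → Any (SameFace f) goods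
      goods-complete = proj₂ (proj₂ (proj₂ (proj₂ good)))

      goods-rise : All (λ g → 1 ≤ rise g) goods
      goods-rise = All.map (λ {y} → good⇒rise y) goods-good

      covered : ∀ y → Any (SameFace y) goods ⊎ rise y ≡ 0
      covered y with rise y ℕₚ.≟ 0
      ... | yes z = inj₂ z
      ... | no nz = inj₁ (goods-complete y (rise⇒good y nz))

      δ-sym : ∀ r g → ℤ.∣ δ r g ∣ ℕ.* rise g ≡ ℤ.∣ δ g r ∣ ℕ.* rise r
      δ-sym r g = by (face? r g)
        where
        by : Dec (SameFace r g) → ℤ.∣ δ r g ∣ ℕ.* rise g ≡ ℤ.∣ δ g r ∣ ℕ.* rise r
        by (yes s) = cong₂ (λ a b → ℤ.∣ a ∣ ℕ.* b) (trans (δ-in s) (sym (δ-in (f-sym s)))) (sym (rise-class s))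
        by (no ¬s) = trans (cong (λ a → ℤ.∣ a ∣ ℕ.* rise g) (δ-out ¬s)) (sym (cong (λ a → ℤ.∣ a ∣ ℕ.* rise r) (δ-out (¬s ∘ f-sym))))

      -- Two lists of representatives are compared by summing over pairs in the same face; faces
      -- missed by `goods` have rise 0.
      idim≡goods : idim ≡ nsum (L.map rise goods)
      idim≡goods = begin
        nsum (L.map rise reps)
          ≡⟨ nsum-cong _ _ (λ r → sym (pick-sum goods-sep rise rise-class r (covered r))) reps ⟩
        nsum (L.map (λ r → nsum (L.map (λ g → ℤ.∣ δ r g ∣ ℕ.* rise g) goods)) reps)
          ≡⟨ nsum-swap (λ r g → ℤ.∣ δ r g ∣ ℕ.* rise g) reps goods ⟩
        nsum (L.map (λ g → nsum (L.map (λ r → ℤ.∣ δ r g ∣ ℕ.* rise g) reps)) goods)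
          ≡⟨ nsum-cong _ _ (λ g → trans (nsum-cong _ _ (λ r → δ-sym r g) reps)
               (pick-sum (proj₁ (proj₂ faces)) rise rise-class g (inj₁ (proj₂ (proj₂ faces) g)))) goods ⟩
        nsum (L.map rise goods) ∎
        where open ≡-Reasoning

    good≤idim : d ≤ idim
    good≤idim = subst (_≤ idim) |goods| (subst (length goods ≤_) (sym idim≡goods) (length≤nsum rise goods-rise))

    idim≡good⇒rise≤1 : idim ≡ d → ∀ y → rise y ≤ 1
    idim≡good⇒rise≤1 eq y with covered y
    ... | inj₂ z = subst (_≤ 1) (sym z) z≤n
    ... | inj₁ c = pick (nsum-tight rise goods-rise (ℕₚ.≤-reflexive (trans (sym idim≡goods) (trans eq (sym |goods|))))) c
      where
      pick : ∀ {gs} → All (λ g → rise g ≤ 1) gs → Any (SameFace y) gs → rise y ≤ 1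
      pick (le ∷ _) (here r) = subst (_≤ 1) (sym (rise-class r)) le
      pick (_ ∷ les) (there i) = pick les i

    rise≤1⇒idim≡good : (∀ y → rise y ≤ 1) → idim ≡ d
    rise≤1⇒idim≡good le = ℕₚ.≤-antisym
      (subst (idim ≤_) |goods| (subst (_≤ length goods) (sym idim≡goods) (nsum≤length rise (All.universal le goods)))) good≤idim

-- Elementary components; forcing infinite faces bound the heights

module Forcing (H : Map) (plane : IsPlaneMap H) (outer : Dart H)
               (S : EdgeSet H) (bip : Bipartite H S)
               (M₀ : ∃ (IsPMG H S)) (rc : RConnected H S outer) where
  open Extremal H plane outer S bip M₀ rc public

  -- The region is a flippable face, whose periphery is a connected cycle of allowed edges; so all
  -- its edges belong to one component.
  face-connected : ∀ y z → ¬ AFace y outer → AFace y z → A (proj₁ y) → A (proj₁ z) →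
                   Reach H A (end (proj₁ y) false) (end (proj₁ z) false)
  face-connected y z fin r ay az = reach-mono (flipped-allowed F)
    (proj₂ (proj₂ (proj₁ (proj₂ flippable))) (proj₁ y) (proj₁ z)
      (allowed⊆E _ ay , proj₂ y , here-f) (allowed⊆E _ az , proj₂ z , f-trans here-f (weaklyElementary y z r fin)))
    where
    F : Flipped y
    F = flipped y fin
    open Flipped F

  h-σ : ∀ d → h (σ d) ≡ h (α′ d)
  h-σ = diff-σ bot top

  low-around : ∀ d₀ → h d₀ ≡ 0ℤ → ∀ d → tl d ≡ tl d₀ → h d ≼ 1ℤ
  low-around d₀ z d t with two-valued bot top (tl d₀)
  ... | a , values = bound (values d t)
    where
    a≤0 : a ≼ 0ℤ
    a≤0 with values d₀ refl
    ... | inj₁ e = ℤₚ.≤-reflexive (trans (sym e) z)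
    ... | inj₂ e = ℤₚ.≤-trans (ℤₚ.i≤i+j a 1ℤ) (ℤₚ.≤-reflexive (trans (sym e) z))
    bound : h d ≡ a ⊎ h d ≡ a ⊕ 1ℤ → h d ≼ 1ℤ
    bound (inj₁ e) = ℤₚ.≤-trans (ℤₚ.≤-reflexive e) (ℤₚ.≤-trans a≤0 (+≤+ z≤n))
    bound (inj₂ e) = ℤₚ.≤-trans (ℤₚ.≤-reflexive e) (ℤₚ.+-monoˡ-≤ 1ℤ a≤0)

  changed : ∀ u e → Inc H e u → top ! e ≢ bot ! e → e ≡ mate top u ⊎ e ≡ mate bot u
  changed u e i ne with e F.≟ mate top u | e F.≟ mate bot u
  ... | yes a | _ = inj₁ a
  ... | no _ | yes b = inj₂ b
  ... | no a | no b = contradiction (trans (not-mate top u e i a) (sym (not-mate bot u e i b))) ne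

  module Component (v : Fin nV) where

    K : Fin nE → Set
    K = CompE H S outer v

    InK : Fin nV → Set
    InK = InComp H S outer v

    inK? : ∀ u → Dec (InK u)
    inK? = reach? allowed? v

    K? : ∀ e → Dec (K e)
    K? e = allowed? e ×-dec inK? (end e false)

    P : Fin nE → Set
    P = Periph H K outer

    P? : ∀ e → Dec (P e)
    P? e = K? e ×-dec map′ [ (λ r → false , r) , (λ r → true , r) ]′ (λ { (false , r) → inj₁ r ; (true , r) → inj₂ r })
      (faceRel? K? outer (e , false) ⊎-dec faceRel? K? outer (e , true))

    K-end : ∀ e b → K e → InK (end e b)
    K-end e false (a , r) = r
    K-end e true  (a , r) = reach-trans r (reach-edge e false a)

    end-K : ∀ e b → A e → InK (end e b) → K e
    end-K e false a r = a , r
    end-K e true  a r = a , reach-trans r (reach-edge e true a)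

    inc-K : ∀ {e u} → A e → Inc H e u → InK u → K e
    inc-K a i r with inc-dart i
    ... | b , refl = end-K _ b a r

    P⇒K : ∀ {e} → P e → K e
    P⇒K = proj₁

    -- Membership in the outer region of the component propagates through finite faces of the other
    -- components, whose peripheries do not meet this component.
    private
      Outside : Dart H → Set
      Outside y = AFace y outer ⊎ (¬ AFace y outer × (∀ z → AFace y z → A (proj₁ z) → ¬ InK (end (proj₁ z) false)))

      outside-cong : ∀ {x y} → AFace x y → Outside x → Outside y
      outside-cong r (inj₁ s) = inj₁ (f-trans (f-sym r) s)
      outside-cong r (inj₂ (fin , none)) = inj₂ ((λ s → fin (f-trans r s)) , λ z s → none z (f-trans r s))

      outside-K : ∀ y → A (proj₁ y) → ¬ K (proj₁ y) → Outside y
      outside-K y a ¬k with aface? y outer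
      ... | yes r = inj₁ r
      ... | no fin = inj₂ (fin , λ z s az kz → ¬k (a , reach-trans kz (reach-sym (face-connected y z fin s a az))))

      outside-region : ∀ {x y} → FaceRel H K x y → (Outside x → Outside y) × (Outside y → Outside x)
      outside-region f-refl = id , id
      outside-region f-φ = outside-cong f-φ , outside-cong (f-sym f-φ)
      outside-region (f-α {d} ¬k) with allowed? (proj₁ d)
      ... | yes a = (λ _ → outside-K (α′ d) a ¬k) , λ _ → outside-K d a ¬k
      ... | no ¬a = outside-cong (f-α ¬a) , outside-cong (f-sym (f-α ¬a))
      outside-region (f-sym r) = proj₂ (outside-region r) , proj₁ (outside-region r)
      outside-region (f-trans r s) = proj₁ (outside-region s) ∘ proj₁ (outside-region r) , proj₂ (outside-region r) ∘ proj₂ (outside-region s)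

    region⇒outer : ∀ y → FaceRel H K outer y → K (proj₁ y) → AFace y outer
    region⇒outer y r (a , k) with proj₁ (outside-region r) (inj₁ f-refl)
    ... | inj₁ s = s
    ... | inj₂ (_ , none) = contradiction k (none y f-refl a)

    outer⇒region : ∀ y → AFace y outer → FaceRel H K outer y
    outer⇒region y r = faceRel-mono (λ _ → proj₁) (f-sym r)

    P-side : ∀ {e} → P e → ∃ λ b → AFace (e , b) outer
    P-side {e} (k , b , r) = b , region⇒outer (e , b) r k

    side-P : ∀ {e} b → K e → AFace (e , b) outer → P e
    side-P {e} b k r = k , b , outer⇒region (e , b) r

    mate-K : ∀ N u → InK u → K (mate N u)
    mate-K N u r = inc-K (in⇒allowed N (mate N u) (mate-in N u)) (mate-inc N u) r

    -- Otherwise no edge of the component bounds its outer region, which then spreads over all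
    -- darts, including those of the mate of `v`.
    P-nonempty : ∃ P
    P-nonempty with any? P?
    ... | yes p = p
    ... | no none = e , K-e , false , spread (FaceRel H K outer) (λ _ r → f-trans r f-φ) across outer f-refl (e , false)
      where
      e : Fin nE
      e = mate bot v
      K-e : K e
      K-e = mate-K bot v r-refl
      across : ∀ y → FaceRel H K outer y → FaceRel H K outer (α′ y)
      across (x , b) r with K? x
      ... | yes k = contradiction (x , k , b , r) none
      ... | no ¬k = f-trans r (f-α ¬k)

    HasP : Fin nV → Set
    HasP u = ∃[ e ] (P e × Inc H e u)

    hasP? : ∀ u → Dec (HasP u)
    hasP? u = any? (λ e → P? e ×-dec inc? e u)

    P-low : ∀ u → HasP u → ∀ d → tl d ≡ u → h d ≼ 1ℤ
    P-low u (e , p , i) d t with inc-dart i | P-side p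
    ... | b , tb | b' , r with b Bₚ.≟ b'
    ... | yes refl = low-around (e , b) (outer⇒h≡0 _ r) d (trans t (sym tb))
    -- The infinite region is on the other side of `e`; that side is seen at `u` as the next dart in
    -- the rotation.
    ... | no b≢b' = low-around (σ (e , b)) (trans (h-σ (e , b)) (trans (cong (λ z → h (e , z)) (sym (Bₚ.¬-not (b≢b' ∘ sym)))) (outer⇒h≡0 _ r)))
                      d (trans t (sym (trans (tail-σ (e , b)) tb)))

    module Large (big : MoreThanTwoVertices H S outer v) where

      -- An edge with the outer region on both sides lies in every matching, so it is a component.
      two-sided : ∀ e → K e → AFace (e , false) outer → AFace (e , true) outer → ⊥
      two-sided e k@(a , r) rf rt = pigeons (is-end ra) (is-end rb) (is-end rc')
        where
        x y z : Fin nV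
        x = proj₁ big
        y = proj₁ (proj₂ big)
        z = proj₁ (proj₂ (proj₂ big))
        rest = proj₂ (proj₂ (proj₂ big))
        ra : InK x
        ra = proj₁ (proj₂ (proj₂ (proj₂ rest)))
        rb : InK y
        rb = proj₁ (proj₂ (proj₂ (proj₂ (proj₂ rest))))
        rc' : InK z
        rc' = proj₂ (proj₂ (proj₂ (proj₂ (proj₂ rest))))
        fixed : ∀ N → bot ! e ≡ N ! e
        fixed N = level⇒same bot N (e , false) (diff-allowed bot N (f-trans rt (f-sym rf)))
        in-all : ∀ N → N ! e ≡ true
        in-all N = trans (sym (fixed N)) (trans (fixed (proj₁ a , proj₁ (proj₂ a))) (proj₂ (proj₂ a)))
        only : ∀ {u} e' → A e' → Inc H e u → Inc H e' u → e' ≡ e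
        only {u} e' (N , p , n) i i' = trans (mate-unique (N , p) u e' n i') (sym (mate-unique (N , p) u e (in-all (N , p)) i))
        closed : ∀ {u u'} → Reach H A u u' → Inc H e u → Inc H e u'
        closed r-refl i = i
        closed (r-step e' b a' s) i with only e' a' i (dart-inc refl)
        ... | refl = closed s (dart-inc refl)
        is-end : ∀ {u} → InK u → Inc H e u
        is-end s = closed (reach-trans (reach-sym r) s) (inj₁ refl)
        pigeons : Inc H e x → Inc H e y → Inc H e z → ⊥
        pigeons (inj₁ p) (inj₁ q) _ = proj₁ rest (trans (sym p) q)
        pigeons (inj₂ p) (inj₂ q) _ = proj₁ rest (trans (sym p) q)
        pigeons (inj₁ p) _ (inj₁ q) = proj₁ (proj₂ rest) (trans (sym p) q)
        pigeons (inj₂ p) _ (inj₂ q) = proj₁ (proj₂ rest) (trans (sym p) q)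
        pigeons _ (inj₁ p) (inj₁ q) = proj₁ (proj₂ (proj₂ rest)) (trans (sym p) q)
        pigeons _ (inj₂ p) (inj₂ q) = proj₁ (proj₂ (proj₂ rest)) (trans (sym p) q)

      -- One side of `e` has height 0. If `top` and `bot` agreed on `e`, so would the other, and the
      -- infinite region would lie on both sides.
      P⇒differ : ∀ e → P e → top ! e ≢ bot ! e
      P⇒differ e p eq with P-side p
      ... | false , r = two-sided e (P⇒K p) r (h≡0⇒outer _ (trans (same⇒level bot top (e , false) (sym eq)) (outer⇒h≡0 _ r)))
      ... | true  , r = two-sided e (P⇒K p) (h≡0⇒outer _ (trans (same⇒level bot top (e , true) (sym eq)) (outer⇒h≡0 _ r))) r

      -- `W` and `E'` repeat the local definitions inside `ForcingInfFace`, so that matchings of the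
      -- rest can be spoken of directly.
      W : Fin nV → Set
      W u = InK u × ¬ HasP u

      E' : Fin nE → Set
      E' e = K e × W (end e false) × W (end e true)

      W? : ∀ u → Dec (W u)
      W? u = inK? u ×-dec ¬? (hasP? u)

      E'? : ∀ e → Dec (E' e)
      E'? e = K? e ×-dec (W? (end e false) ×-dec W? (end e true))

      W-ends : ∀ {e} b → K e → W (end e b) → W (end e (not b)) → E' e
      W-ends false k p q = k , p , q
      W-ends true  k p q = k , q , p

      E'-inc : ∀ {e u} → E' e → Inc H e u → W u
      E'-inc (_ , p , q) (inj₁ refl) = p
      E'-inc (_ , p , q) (inj₂ refl) = q

      -- Both P-edges at a vertex of the cycle differ between top and bot, so they are its two mates.
      cycle-mates : IsCycle H P → ∀ u → HasP u → P (mate top u) × P (mate bot u)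
      cycle-mates cyc u (e , p , i) with proj₁ (proj₂ cyc) u
      ... | inj₁ none = contradiction i (none e p)
      ... | inj₂ (e₁ , e₂ , ne , p₁ , p₂ , i₁ , i₂ , _) with changed u e₁ i₁ (P⇒differ e₁ p₁) | changed u e₂ i₂ (P⇒differ e₂ p₂)
      ... | inj₁ a | inj₂ b = subst P a p₁ , subst P b p₂
      ... | inj₂ a | inj₁ b = subst P b p₂ , subst P a p₁
      ... | inj₁ a | inj₁ b = contradiction (trans a (sym b)) ne
      ... | inj₂ a | inj₂ b = contradiction (trans a (sym b)) ne

      -- Satisfied by `top` and by `bot`, each through one projection; what follows is proved for
      -- both at once.
      Extreme : PM → Set
      Extreme X = ∀ u → P (mate top u) × P (mate bot u) → P (mate X u)

      -- Vertices of the cycle are matched along the cycle, so the mate of a vertex off the cycle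
      -- cannot end on it.
      W-mate : IsCycle H P → ∀ X → Extreme X → ∀ u → W u → E' (mate X u)
      W-mate cyc X ext u (r , none) = W-ends b k (subst W (sym t) (r , none)) (K-end e (not b) k , λ hp →
          none (e , subst P (sym (mate-unique X (end e (not b)) e (mate-in X u) (dart-inc {b = not b} refl)))
                           (ext (end e (not b)) (cycle-mates cyc _ hp)) , mate-inc X u))
        where
        e : Fin nE
        e = mate X u
        b : Bool
        b = proj₁ (inc-dart (mate-inc X u))
        t : end e b ≡ u
        t = proj₂ (inc-dart (mate-inc X u))
        k : K e
        k = mate-K X u r

      restrict : PM → EdgeSet H
      restrict X e = if does (E'? e) then X ! e else false

      restrict-in : ∀ X {e} → restrict X e ≡ true → E' e × X ! e ≡ true
      restrict-in X {e} j = by (E'? e)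
        where
        by : Dec (E' e) → E' e × X ! e ≡ true
        by (yes p) = p , trans (sym (if-yes (E'? e) p)) j
        by (no ¬p) = contradiction (trans (sym j) (if-no (E'? e) ¬p)) λ ()

      restrict-PM : IsCycle H P → ∀ X → Extreme X → IsPM H W E' (restrict X)
      restrict-PM cyc X ext = (λ e j → proj₁ (restrict-in X j)) , λ u wu →
        mate X u , trans (if-yes (E'? (mate X u)) (W-mate cyc X ext u wu)) (mate-in X u) , mate-inc X u ,
        λ e j i → mate-unique X u e (proj₂ (restrict-in X j)) i

      -- Off the cycle `top` and `bot` restrict to the one perfect matching available, so the height
      -- is constant around such a vertex; on the cycle `P-low` bounds it. The bound 1 thus travels
      -- along paths of the component.
      low : ForcingInfFace H S outer v → ∀ u → InK u → ∀ d → tl d ≡ u → h d ≼ 1ℤ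
      low (cyc , _ , forced) u r = along (reach-trans (reach-sym (proj₂ (P⇒K (proj₂ P-nonempty)))) r)
          (proj₂ (P⇒K (proj₂ P-nonempty))) (P-low _ (proj₁ P-nonempty , proj₂ P-nonempty , inj₁ refl))
        where
        same-mates : ∀ u → W u → mate top u ≡ mate bot u
        same-mates u wu = [ (λ none → contradiction wu (none u)) , from-unique ]′ forced
          where
          from-unique : UniquePM H W E' → mate top u ≡ mate bot u
          from-unique (M , _ , unique) = mate-unique bot u (mate top u) (proj₂ (restrict-in bot
                (trans (unique _ (restrict-PM cyc bot (λ _ → proj₂)) (mate top u))
                  (trans (sym (unique _ (restrict-PM cyc top (λ _ → proj₁)) (mate top u)))
                    (trans (if-yes (E'? (mate top u)) (W-mate cyc top (λ _ → proj₁) u wu)) (mate-in top u))))))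
                (mate-inc top u)
        level-W : ∀ u → W u → ∀ d → tl d ≡ u → h (σ d) ≡ h d
        level-W u wu d t = trans (h-σ d) (same⇒level bot top d same)
          where
          same : bot ! proj₁ d ≡ top ! proj₁ d
          same with bot ! proj₁ d Bₚ.≟ top ! proj₁ d
          ... | yes eq = eq
          ... | no ne with changed u (proj₁ d) (dart-inc t) (ne ∘ sym)
          ... | inj₁ a = trans (trans (cong (proj₁ bot) (trans a (same-mates u wu))) (mate-in bot u))
                           (sym (trans (cong (proj₁ top) a) (mate-in top u)))
          ... | inj₂ b = trans (trans (cong (proj₁ bot) b) (mate-in bot u))
                           (sym (trans (cong (proj₁ top) (trans b (sym (same-mates u wu)))) (mate-in top u)))
        along : ∀ {x y} → Reach H A x y → InK x → (∀ d → tl d ≡ x → h d ≼ 1ℤ) → ∀ d → tl d ≡ y → h d ≼ 1ℤ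
        along r-refl k le = le
        along (r-step e b a s) k le = along s k' le'
          where
          k' : InK (end e (not b))
          k' = K-end e (not b) (end-K e b a k)
          -- The dart `(e , not b)` at the next vertex has the same height as `σ (e , b)` at the
          -- current one, where the bound is known.
          start : h (e , not b) ≼ 1ℤ
          start = subst (_≼ 1ℤ) (h-σ (e , b)) (le (σ (e , b)) (tail-σ (e , b)))
          le' : ∀ d → tl d ≡ end e (not b) → h d ≼ 1ℤ
          le' d t with hasP? (end e (not b))
          ... | yes hp = P-low _ hp d t
          ... | no ¬hp = rotate (λ d → h d ≼ 1ℤ) (λ d t → subst (_≼ 1ℤ) (sym (level-W _ (k' , ¬hp) d t)))
                           (e , not b) d refl t start

    -- If `v` were not an end of an edge of `P`, that edge would supply two further vertices of the
    -- component.
    small-low : ¬ MoreThanTwoVertices H S outer v → ∀ d → tl d ≡ v → h d ≼ 1ℤ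
    small-low small = P-low v (e , p , at-end)
      where
      e : Fin nE
      e = proj₁ P-nonempty
      p : P e
      p = proj₂ P-nonempty
      at-end : Inc H e v
      at-end with inc? e v
      ... | yes i = i
      ... | no ¬i = contradiction (end e false , end e true , v , loopless e , ¬i ∘ inj₁ , ¬i ∘ inj₂ ,
              K-end e false (P⇒K p) , K-end e true (P⇒K p) , r-refl) small

  forcing⇒low : (∀ v → MoreThanTwoVertices H S outer v → ForcingInfFace H S outer v) → ∀ y → rise y ≤ 1
  forcing⇒low force y with h y ℤₚ.≤? 1ℤ
  ... | yes le = ℤₚ.drop‿+≤+ (subst (_≼ 1ℤ) (sym (+rise y)) le)
  -- The size of the component is never decided: a height above 1 refutes the large case through
  -- `low`, and its negation feeds `small-low`.
  ... | no ¬le = contradiction (Component.small-low (tl y)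
          (λ big → ¬le (Component.Large.low (tl y) big (force (tl y) big) (tl y) r-refl y refl)) y refl) ¬le

-- Heights at most one make the infinite face forcing

allPairs-map : ∀ {A B : Set} {Q : A → Set} {f : A → B} → (∀ {x y} → Q x → Q y → f x ≡ f y → x ≡ y) →
               ∀ {xs} → AllPairs _≢_ xs → All Q xs → AllPairs _≢_ (L.map f xs)
allPairs-map inj [] [] = []
allPairs-map inj (ne ∷ sep) (q ∷ qs) =
  Allₚ.map⁺ (All.zipWith (λ (x≢y , q') eq → x≢y (inj q q' eq)) (ne , qs)) ∷ allPairs-map inj sep qs

module LowForcing (H : Map) (plane : IsPlaneMap H) (outer : Dart H)
                  (S : EdgeSet H) (bip : Bipartite H S)
                  (M₀ : ∃ (IsPMG H S)) (rc : RConnected H S outer)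
                  (flat : ∀ y → Extremal.rise H plane outer S bip M₀ rc y ≤ 1)
                  (v : Fin (Map.nV H)) (big : MoreThanTwoVertices H S outer v) where
  open Forcing H plane outer S bip M₀ rc
  open Component v
  open Large big

  h≤1 : ∀ y → h y ≼ 1ℤ
  h≤1 y = subst (_≼ 1ℤ) (+rise y) (+≤+ (flat y))

  h-inner : ∀ y → ¬ AFace y outer → h y ≡ 1ℤ
  h-inner y fin with h y in eq | h≤1 y | 0≤w top y
  ... | + 0 | _ | _ = contradiction (h≡0⇒outer y eq) fin
  ... | + 1 | _ | _ = refl
  ... | + (suc (suc n)) | +≤+ (s≤s ()) | _
  ... | ℤ.-[1+ n ] | _ | ()

  -- All regions other than the infinite one have height exactly 1, so an edge across which the
  -- height jumps must border the infinite one.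
  differ⇒P : ∀ e → K e → top ! e ≢ bot ! e → P e
  differ⇒P e k ne with aface? (e , false) outer | aface? (e , true) outer
  ... | yes r | _     = side-P false k r
  ... | no _  | yes r = side-P true k r
  ... | no f  | no t  = contradiction (sym (level⇒same bot top (e , false) (trans (h-inner _ t) (sym (h-inner _ f))))) ne

  off-P : ∀ e → K e → ¬ P e → top ! e ≡ bot ! e
  off-P e k ¬p with top ! e Bₚ.≟ bot ! e
  ... | yes eq = eq
  ... | no ne = contradiction (differ⇒P e k ne) ¬p

  HasP⇒InK : ∀ {u} → HasP u → InK u
  HasP⇒InK (e , p , i) with inc-dart i
  ... | b , refl = K-end e b (P⇒K p)

  mates-differ : ∀ u → HasP u → mate top u ≢ mate bot u
  mates-differ u (e , p , i) eq with changed u e i (P⇒differ e p)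
  ... | inj₁ a = P⇒differ e p (trans (trans (cong (proj₁ top) a) (mate-in top u)) (sym (trans (cong (proj₁ bot) (trans a eq)) (mate-in bot u))))
  ... | inj₂ b = P⇒differ e p (trans (trans (cong (proj₁ top) (trans b (sym eq))) (mate-in top u)) (sym (trans (cong (proj₁ bot) b) (mate-in bot u))))

  mates-P : ∀ u → HasP u → P (mate top u) × P (mate bot u)
  mates-P u hp =
    differ⇒P _ (mate-K top u k) (λ eq → mates-differ u hp
      (mate-unique bot u _ (trans (sym eq) (mate-in top u)) (mate-inc top u))) ,
    differ⇒P _ (mate-K bot u k) (λ eq → mates-differ u hp
      (sym (mate-unique top u _ (trans eq (mate-in bot u)) (mate-inc bot u))))
    where
    k : InK u
    k = HasP⇒InK hp

  e₀ : Fin nE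
  e₀ = proj₁ P-nonempty

  u₀ : Fin nV
  u₀ = end e₀ false

  u₀-InK : InK u₀
  u₀-InK = K-end e₀ false (P⇒K (proj₂ P-nonempty))

  R : Fin nV → Set
  R = Reach H P u₀

  R? : ∀ u → Dec (R u)
  R? = reach? P? u₀

  -- The matching that is top on the cycle of P through e₀ and bot elsewhere.
  j : EdgeSet H
  j e = if does (R? (end e false)) then top ! e else bot ! e

  R-InK : ∀ {u} → R u → InK u
  R-InK r = reach-trans u₀-InK (reach-mono (λ _ p → proj₁ (P⇒K p)) r)

  -- An edge of the component on which `top` and `bot` differ belongs to `P`, so `R` contains both
  -- of its ends or neither; this keeps `j` consistent at every vertex.
  R-ends : ∀ e → top ! e ≢ bot ! e → ∀ b b' → R (end e b) → R (end e b')
  R-ends e ne b b' r with b Bₚ.≟ b'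
  ... | yes refl = r
  ... | no b≢b' = subst (λ z → R (end e z)) (sym (Bₚ.¬-not (b≢b' ∘ sym))) (reach-trans r (reach-edge e b (differ⇒P e (end-K e b a (R-InK r)) ne)))
    where
    a : A e
    a with allowed? e
    ... | yes a = a
    ... | no ¬a = contradiction (trans (not-allowed top e ¬a) (sym (not-allowed bot e ¬a))) ne

  j-top : ∀ e b → R (end e b) → j e ≡ top ! e
  j-top e b r with top ! e Bₚ.≟ bot ! e
  ... | no ne = if-yes (R? (end e false)) (R-ends e ne b false r)
  ... | yes eq = by (R? (end e false))
    where
    by : Dec (R (end e false)) → j e ≡ top ! e
    by (yes p) = if-yes (R? (end e false)) p
    by (no ¬p) = trans (if-no (R? (end e false)) ¬p) (sym eq)

  j-bot : ∀ e b → ¬ R (end e b) → j e ≡ bot ! e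
  j-bot e b ¬r with top ! e Bₚ.≟ bot ! e
  ... | no ne = if-no (R? (end e false)) (¬r ∘ R-ends e ne false b)
  ... | yes eq = by (R? (end e false))
    where
    by : Dec (R (end e false)) → j e ≡ bot ! e
    by (yes p) = trans (if-yes (R? (end e false)) p) eq
    by (no ¬p) = if-no (R? (end e false)) ¬p

  abstract
    M₁ : PM
    M₁ = j , glue j local
      where
      local : ∀ u → ∃ λ (N : PM) → ∀ e → Inc H e u → j e ≡ N ! e
      local u with R? u
      ... | yes r = top , λ e i → let (b , t) = inc-dart i in j-top e b (subst R (sym t) r)
      ... | no ¬r = bot , λ e i → let (b , t) = inc-dart i in j-bot e b (¬r ∘ subst R t)

    M₁-top : ∀ e b → R (end e b) → M₁ ! e ≡ top ! e
    M₁-top = j-top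

    M₁-bot : ∀ e b → ¬ R (end e b) → M₁ ! e ≡ bot ! e
    M₁-bot = j-bot

  q : Dart H → ℤ
  q = w M₁

  Flat Full : Fin nV → Set
  Flat u = ∀ d → tl d ≡ u → q d ≡ 0ℤ
  Full u = ∀ d → tl d ≡ u → q d ≡ h d

  constant-around : ∀ M N u → (∀ e → Inc H e u → M ! e ≡ N ! e) → ∀ d d' → tl d ≡ u → tl d' ≡ u → diff M N d' ≡ diff M N d
  constant-around M N u same d d' t t' = rotate (λ x → diff M N x ≡ diff M N d)
    (λ x tx e → trans (trans (diff-σ M N x) (same⇒level M N x (same (proj₁ x) (dart-inc tx)))) e) d d' t t' refl

  -- `M₁` agrees with `top` or with `bot` at `u`, so one of the two parts of h = `q` + `diff M₁ top`
  -- is constant around `u`. Since h ≤ 1, at each face one part vanishes: a nonzero constant part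
  -- forces the other to be zero all around.
  flat-or-full : ∀ u → Flat u ⊎ Full u
  flat-or-full u = by (R? u)
    where
    e : Fin nE
    e = mate bot u
    d₀ : Dart H
    d₀ = e , proj₁ (inc-dart (mate-inc bot u))
    t₀ : tl d₀ ≡ u
    t₀ = proj₂ (inc-dart (mate-inc bot u))
    complement : ∀ d → h d ≡ q d ⊕ diff M₁ top d
    complement = diff-trans bot M₁ top
    full : ∀ d → diff M₁ top d ≡ 0ℤ → q d ≡ h d
    full d z = sym (trans (complement d) (trans (cong (q d ⊕_) z) (ℤₚ.+-identityʳ _)))
    bits : ∀ {a b c} → c ≡ a ⊕ b → c ≼ 1ℤ → 0ℤ ≼ a → 0ℤ ≼ b → a ≡ 0ℤ ⊎ b ≡ 0ℤ
    bits {+ zero} _ _ _ _ = inj₁ refl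
    bits {+ suc m} {+ zero} _ _ _ _ = inj₂ refl
    bits {+ suc m} {+ suc n} refl (+≤+ (s≤s le)) _ _ with subst (_≤ 0) (ℕₚ.+-suc m n) le
    ... | ()
    bits {ℤ.-[1+ _ ]} _ _ () _
    bits {+ _} {ℤ.-[1+ _ ]} _ _ _ ()
    either : ∀ d → q d ≡ 0ℤ ⊎ diff M₁ top d ≡ 0ℤ
    either d = bits (complement d) (h≤1 d) (0≤w M₁ d) (proj₂ greatest-matching M₁ d)
    by : Dec (R u) → Flat u ⊎ Full u
    by (yes r) with diff M₁ top d₀ ℤₚ.≟ 0ℤ
    ... | yes z = inj₂ λ d t → full d (trans (const d t) z)
      where
      const : ∀ d → tl d ≡ u → diff M₁ top d ≡ diff M₁ top d₀
      const d t = constant-around M₁ top u (λ e i → let (b , tb) = inc-dart i in M₁-top e b (subst R (sym tb) r)) d₀ d t₀ t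
    ... | no nz = inj₁ λ d t → [ id , (λ z → contradiction (trans (sym (const d t)) z) nz) ]′ (either d)
      where
      const : ∀ d → tl d ≡ u → diff M₁ top d ≡ diff M₁ top d₀
      const d t = constant-around M₁ top u (λ e i → let (b , tb) = inc-dart i in M₁-top e b (subst R (sym tb) r)) d₀ d t₀ t
    by (no ¬r) with q d₀ ℤₚ.≟ 0ℤ
    ... | yes z = inj₁ λ d t → trans (const d t) z
      where
      const : ∀ d → tl d ≡ u → q d ≡ q d₀
      const d t = constant-around bot M₁ u (λ e i → let (b , tb) = inc-dart i in sym (M₁-bot e b (¬r ∘ subst R tb))) d₀ d t₀ t
    ... | no nz = inj₂ λ d t → [ (λ z → contradiction (trans (sym (const d t)) z) nz) , full d ]′ (either d)
      where
      const : ∀ d → tl d ≡ u → q d ≡ q d₀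
      const d t = constant-around bot M₁ u (λ e i → let (b , tb) = inc-dart i in sym (M₁-bot e b (¬r ∘ subst R tb))) d₀ d t₀ t

  q-σ : ∀ d → q (σ d) ≡ q (α′ d)
  q-σ = diff-σ bot M₁

  edge-outer : ∀ e b → K e → h (e , b) ≡ 0ℤ → h (e , not b) ≡ 0ℤ → ⊥
  edge-outer e false k x y = two-sided e k (h≡0⇒outer _ x) (h≡0⇒outer _ y)
  edge-outer e true  k x y = two-sided e k (h≡0⇒outer _ y) (h≡0⇒outer _ x)

  -- Both faces along `e` are seen from both of its ends. Between a full and a flat end, `h` would
  -- equal `q` and so vanish on both sides, putting the infinite region on both sides of `e`.
  full-step : ∀ e b → K e → Full (end e b) → Full (end e (not b))
  full-step e b k fu with flat-or-full (end e (not b))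
  ... | inj₂ fu' = fu'
  ... | inj₁ fl = contradiction
      (trans (sym (trans (fu (σ d) (tail-σ d)) (h-σ d))) (trans (q-σ d) (fl (α′ d) refl)))
      (edge-outer e b k (trans (sym (fu d refl)) (trans (sym (trans (q-σ (α′ d)) (cong q (αα d)))) (fl (σ (α′ d)) (tail-σ (α′ d))))))
    where
    d : Dart H
    d = e , b

  full-along : ∀ {x y} → Reach H A x y → InK x → Full x → Full y
  full-along r-refl _ fu = fu
  full-along (r-step e b a r) k fu =
    full-along r (K-end e (not b) (end-K e b a k)) (full-step e b (end-K e b a k) fu)

  full-u₀ : Full u₀
  full-u₀ with flat-or-full u₀
  ... | inj₂ fu = fu
  -- Flatness at `u₀` would make `M₁` agree with `bot` on `e₀`, where it agrees with `top`.
  ... | inj₁ fl = contradiction (trans (sym (M₁-top e₀ false r-refl)) (sym (level⇒same bot M₁ d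
          (trans (trans (sym (q-σ d)) (fl (σ d) (tail-σ d))) (sym (fl d refl))))))
        (P⇒differ e₀ (proj₂ P-nonempty))
    where
    d : Dart H
    d = e₀ , false

  -- Every vertex of the component is full, so M₁ agrees with top on all of P.
  P-reach : ∀ e → P e → R (end e false)
  P-reach e p with R? (end e false)
  ... | yes r = r
  ... | no ¬r = contradiction (trans (sym same) (M₁-bot e false ¬r)) (P⇒differ e p)
    where
    d : Dart H
    d = e , false
    k : InK (end e false)
    k = K-end e false (P⇒K p)
    fu : Full (end e false)
    fu = full-along (reach-trans (reach-sym u₀-InK) k) u₀-InK full-u₀
    full⇒zero : ∀ x → q x ≡ h x → diff M₁ top x ≡ 0ℤ
    full⇒zero x eq = +-cancelˡ (q x) _ _ (trans (sym (diff-trans bot M₁ top x)) (trans (sym eq) (sym (ℤₚ.+-identityʳ _))))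
    same : M₁ ! e ≡ top ! e
    same = level⇒same M₁ top d (trans (full⇒zero (α′ d) (trans (sym (q-σ d)) (trans (fu (σ d) (tail-σ d)) (h-σ d))))
                                      (sym (full⇒zero d (fu d refl))))

  isCycle : IsCycle H P
  isCycle = P-nonempty , vertex , λ e e' p p' → reach-trans (reach-sym (P-reach e p)) (P-reach e' p')
    where
    vertex : ∀ u → (∀ e → P e → ¬ Inc H e u) ⊎
      (∃[ e₁ ] ∃[ e₂ ] (e₁ ≢ e₂ × P e₁ × P e₂ × Inc H e₁ u × Inc H e₂ u × (∀ e → P e → Inc H e u → e ≡ e₁ ⊎ e ≡ e₂)))
    vertex u with hasP? u
    ... | no none = inj₁ λ e p i → none (e , p , i)
    ... | yes hp = inj₂ (mate top u , mate bot u , mates-differ u hp , proj₁ (mates-P u hp) , proj₂ (mates-P u hp) ,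
            mate-inc top u , mate-inc bot u , λ e p i → changed u e i (P⇒differ e p))

  Black : Fin nV → Set
  Black u = proj₁ bip u ≡ true

  black-unique : ∀ e {u u'} → E e → Inc H e u → Inc H e u' → Black u → Black u' → u ≡ u'
  black-unique e s (inj₁ refl) (inj₁ refl) _ _ = refl
  black-unique e s (inj₂ refl) (inj₂ refl) _ _ = refl
  black-unique e s (inj₁ refl) (inj₂ refl) b b' = contradiction (trans b (sym b')) (proj₂ bip e s)
  black-unique e s (inj₂ refl) (inj₁ refl) b b' = contradiction (trans b' (sym b)) (proj₂ bip e s)

  black-end : ∀ e → E e → ∃ λ b → Black (end e b)
  black-end e s with proj₁ bip (end e false) in f | proj₁ bip (end e true) in t
  ... | true  | _     = false , f
  ... | false | true  = true , t
  ... | false | false = contradiction (trans f (sym t)) (proj₂ bip e s)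

  -- Every edge of `P` has exactly one black end and is there the `top` or the `bot` mate, so the
  -- edges of `P` are counted twice over the black vertices of the cycle.
  evenCycle : ∃[ k ] (EdgeCount H P k × 2 ∣ k)
  evenCycle = _ , (L.map (mate top) us L.++ L.map (mate bot) us , refl , distinct , inside , complete) , even
    where
    Q : Fin nV → Set
    Q u = Black u × HasP u
    Q? : ∀ u → Dec (Q u)
    Q? u = (proj₁ bip u Bₚ.≟ true) ×-dec hasP? u
    us : List (Fin nV)
    us = L.filter Q? (allFin nV)
    all-Q : All Q us
    all-Q = Allₚ.all-filter Q? (allFin nV)
    us-distinct : AllPairs _≢_ us
    us-distinct = AllPairsₚ.filter⁺ Q? (Uniqueₚ.allFin⁺ nV)
    mate-E : ∀ N u → E (mate N u)
    mate-E N u = pm⊆S N _ (mate-in N u)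
    meet-at : ∀ N N' {u u'} → Black u → Black u' → mate N u ≡ mate N' u' → u ≡ u'
    meet-at N N' {u} {u'} b b' eq = black-unique (mate N u) (mate-E N u) (mate-inc N u)
      (subst (λ e → Inc H e u') (sym eq) (mate-inc N' u')) b b'
    cross : ∀ {u u'} → Q u → Q u' → mate top u ≢ mate bot u'
    cross {u} {u'} (b , hp) (b' , _) eq with meet-at top bot {u} {u'} b b' eq
    ... | refl = mates-differ u hp eq
    distinct : AllPairs _≢_ (L.map (mate top) us L.++ L.map (mate bot) us)
    distinct = AllPairsₚ.++⁺
      (allPairs-map (λ q q' → meet-at top top (proj₁ q) (proj₁ q')) us-distinct all-Q)
      (allPairs-map (λ q q' → meet-at bot bot (proj₁ q) (proj₁ q')) us-distinct all-Q)
      (Allₚ.map⁺ (All.map (λ q → Allₚ.map⁺ (All.map (cross q) all-Q)) all-Q))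
    inside : All P (L.map (mate top) us L.++ L.map (mate bot) us)
    inside = Allₚ.++⁺ (Allₚ.map⁺ (All.map (λ {u} q → proj₁ (mates-P u (proj₂ q))) all-Q))
                      (Allₚ.map⁺ (All.map (λ {u} q → proj₂ (mates-P u (proj₂ q))) all-Q))
    complete : ∀ e → P e → e ∈ L.map (mate top) us L.++ L.map (mate bot) us
    complete e p with black-end e (allowed⊆E e (proj₁ (P⇒K p)))
    ... | b , bl with changed (end e b) e (dart-inc refl) (P⇒differ e p)
    ... | inj₁ a = ∈-++⁺ˡ (subst (_∈ L.map (mate top) us) (sym a)
            (∈-map⁺ (mate top) (∈-filter⁺ Q? (∈-allFin (end e b)) (bl , e , p , dart-inc refl))))
    ... | inj₂ a = ∈-++⁺ʳ (L.map (mate top) us) (subst (_∈ L.map (mate bot) us) (sym a)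
            (∈-map⁺ (mate bot) (∈-filter⁺ Q? (∈-allFin (end e b)) (bl , e , p , dart-inc refl))))
    even : 2 ∣ length (L.map (mate top) us L.++ L.map (mate bot) us)
    even = divides (length us) (trans (length-++ (L.map (mate top) us))
      (trans (cong₂ ℕ._+_ (length-map (mate top) us) (length-map (mate bot) us)) (ar (length us))))
      where
      ar : ∀ n → n ℕ.+ n ≡ n ℕ.* 2
      ar = ℕ-solve-∀

  E'-off : ∀ {e} → E' e → top ! e ≡ bot ! e
  E'-off {e} (k , (_ , none) , _) = off-P e k (λ p → none (e , p , inj₁ refl))

  module _ (M' : EdgeSet H) (pm : IsPM H W E' M') where

    extend : PM → EdgeSet H
    extend X e = if does (E'? e) then M' e else X ! e

    -- At a vertex of `W` the matching `X` uses an edge of `E'`, which `M'` replaces; at every other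
    -- vertex no edge of `E'` is incident and `X` is unchanged.
    extend-PM : ∀ X → Extreme X → IsPMG H S (extend X)
    extend-PM X ext = in-S , at
      where
      in-S : ∀ e → extend X e ≡ true → E e
      in-S e t = by (E'? e)
        where
        by : Dec (E' e) → E e
        by (yes e') = allowed⊆E e (proj₁ (proj₁ e'))
        by (no ¬e') = pm⊆S X e (trans (sym (if-no (E'? e) ¬e')) t)
      at : ∀ u → ⊤ → ∃[ e ] (extend X e ≡ true × Inc H e u × (∀ e' → extend X e' ≡ true → Inc H e' u → e' ≡ e))
      at u _ = by (W? u)
        where
        by : Dec (W u) → ∃[ e ] (extend X e ≡ true × Inc H e u × (∀ e' → extend X e' ≡ true → Inc H e' u → e' ≡ e))
        by (no ¬wu) = mate X u , trans (off (mate X u) (mate-inc X u)) (mate-in X u) , mate-inc X u ,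
            λ e' t i → mate-unique X u e' (trans (sym (off e' i)) t) i
          where
          off : ∀ e → Inc H e u → extend X e ≡ X ! e
          off e i = if-no (E'? e) (λ e' → ¬wu (E'-inc e' i))
        by (yes wu) with proj₂ pm u wu
        ... | e , m , i , unique = e , trans (if-yes (E'? e) (proj₁ pm e m)) m , i , only
          where
          only : ∀ e' → extend X e' ≡ true → Inc H e' u → e' ≡ e
          only e' t i' = by' (E'? e')
            where
            by' : Dec (E' e') → e' ≡ e
            by' (yes p) = unique e' (trans (sym (if-yes (E'? e') p)) t) i'
            by' (no ¬p) = contradiction (subst E' (sym (mate-unique X u e' (trans (sym (if-no (E'? e') ¬p)) t) i'))
              (W-mate isCycle X ext u wu)) ¬p

    Lo Hi : PM
    Lo = extend bot , extend-PM bot (λ _ → proj₂)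
    Hi = extend top , extend-PM top (λ _ → proj₁)

    -- Hi lies above Lo exactly as top lies above bot, which leaves no room for Lo above bot.
    Lo≐bot : Lo ≐ bot
    Lo≐bot e = sym (zero⇒≐ bot Lo zero-height e)
      where
      same-step : ∀ d → step bot top d ≡ step Lo Hi d
      same-step (x , b) = by (E'? x)
        where
        by : Dec (E' x) → step bot top (x , b) ≡ step Lo Hi (x , b)
        by (yes p) = trans (step-same bot top (x , b) (sym (E'-off p)))
          (sym (step-same Lo Hi (x , b) (trans (if-yes (E'? x) p) (sym (if-yes (E'? x) p)))))
        by (no ¬p) = cong₂ (λ s t → sgn (end x b) ⊛ (bit s ⊕ - bit t)) (sym (if-no (E'? x) ¬p)) (sym (if-no (E'? x) ¬p))
      parallel : ∀ y → diff Lo Hi y ≡ h y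
      parallel = diff-unique Lo Hi h (diff-φ bot top , diff-outer bot top ,
        λ d → trans (diff-jump bot top d) (cong (h d ⊕_) (same-step d)))
      zero-height : ∀ y → w Lo y ≡ 0ℤ
      zero-height y = antisym-zero (subst (_≼ 0ℤ) (trans (cong (_⊕ - h y) w-Hi) (ar (w Lo y) (h y)))
          (subst (w Hi y ⊕ - h y ≼_) (ℤₚ.+-inverseʳ (h y)) (ℤₚ.+-monoˡ-≤ (- h y) (w≤h Hi y)))) (0≤w Lo y)
        where
        w-Hi : w Hi y ≡ w Lo y ⊕ h y
        w-Hi = trans (diff-trans bot Lo Hi y) (cong (w Lo y ⊕_) (parallel y))
        ar : ∀ a b → (a ⊕ b) ⊕ - b ≡ a
        ar = solve-∀

    unique : ∀ e → M' e ≡ restrict bot e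
    unique e = by (E'? e)
      where
      by : Dec (E' e) → M' e ≡ restrict bot e
      by (yes p) = trans (sym (if-yes (E'? e) p)) (trans (Lo≐bot e) (sym (if-yes (E'? e) p)))
      by (no ¬p) = trans outside (sym (if-no (E'? e) ¬p))
        where
        outside : M' e ≡ false
        outside with M' e in m
        ... | false = refl
        ... | true  = contradiction (proj₁ pm e m) ¬p

  forcing : ForcingInfFace H S outer v
  -- If the cycle covers the whole component, `restrict bot` is empty and is still the unique
  -- matching asked for.
  forcing = isCycle , evenCycle , inj₂ (restrict bot , restrict-PM isCycle bot (λ _ → proj₂) , unique)

theorem3p7 : (H : Map) → IsPlaneMap H → (outer : Dart H) →
    (S : EdgeSet H) → Bipartite H S → (∃[ M ] IsPMG H S M) →
    RConnected H S outer → (d : ℕ) → NumGoodFaces H S outer d →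
    Σ ℕ λ m → IsIdim H S outer m × d ≤ m ×
    (m ≡ d ⇔ (WeaklyElementary H S outer ×
    (∀ v → MoreThanTwoVertices H S outer v → ForcingInfFace H S outer v)))
theorem3p7 H plane outer S bip M₀ rc d good = idim , idim-correct , good≤idim good ,
    mk⇔ (λ eq → weaklyElementary , LowForcing.forcing H plane outer S bip M₀ rc (idim≡good⇒rise≤1 good eq))
        (λ (_ , force) → rise≤1⇒idim≡good good (forcing⇒low force))
  where open Forcing H plane outer S bip M₀ rc
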